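{- A matroid $M$ is claw-free if and only if $M$ is isomorphic to a matroid that can be obtained, by finitely many applications of the lift-join operation $\otimes$, from matroids each of which is either a PG-sum, an even-plane matroid, or the complement of a triangle-free matroid. Equivalently, $M$ is claw-free if and only if $M$ belongs to the smallest isomorphism-closed class of matroids that contains all PG-sums, all even-plane matroids and all complements of triangle-free matroids, and is closed under lift-joins.
   Context: A matroid is a pair $M=(E,G)$ where $G$ is the set of nonzero vectors of a finite-dimensional $\mathbb F_2$-vector space $V(G)=G\cup\{0\}\cong\mathbb F_2^n$ (the point set of $\mathrm{PG}(n-1,2)$) and $E\subseteq G$. The integer $n\ge 0$ is the dimension of $M$. Two matroids $(E_1,G_1),(E_2,G_2)$ are isomorphic if some linear isomorphism $V(G_1)\to V(G_2)$ maps $E_1$ onto $E_2$. A flat of $G$ is a set $F\subseteq G$ such that $F\cup\{0\}$ is a subspace of $V(G)$; its dimension is the dimension of that subspace. Triangles and planes are flats of dimension $2$ and $3$. The induced restriction of $M$ to a flat $F$ is $M|F=(E\cap F,F)$; $M$ is $N$-free if no induced restriction of $M$ is isomorphic to $N$. A claw is the matroid $(B,G)$ with $G$ of dimension $3$ and $B$ a basis of $V(G)$; $M$ is claw-free if it is $N$-free for $N$ a claw. $M$ is triangle-free if $E$ contains no triangle of $G$. The complement of $M$ is $M^c=(G\setminus E,G)$. $M$ is a PG-sum if $E$ is the disjoint union of two (possibly empty) flats of $G$. $M$ is even-plane if $|E\cap P|$ is even for every plane $P$ of $G$. For $X,Y\subseteq V(G)$, $X+Y=\{x+y:x\in X,y\in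 Y\}$. Lift-join: for matroids $M_1=(E_1,G_1)$, $M_2=(E_2,G_2)$, let $G_1\oplus G_2$ denote the set of nonzero vectors of the vector space direct sum $V(G_1)\oplus V(G_2)$, in which each $V(G_i)$ is identified with its copy; then $M_1\otimes M_2=(E_1\cup(E_2+V(G_1)),\,G_1\oplus G_2)$. -}

module Defs where

open import Data.Bool using (Bool; true; false; _∧_; _∨_; not; _xor_; if_then_else_)
open import Data.Nat using (ℕ; zero; suc; _+_)
open import Data.Nat.Divisibility using (_∣_)
open import Data.Vec using (Vec; []; _∷_; replicate; zipWith; take; drop)
open import Data.List using (List; []; _∷_; _++_; map; filter; length)
open import Data.Product using (Σ; _×_; _,_; ∃; ∃-syntax)
open import Data.Sum using (_⊎_)
open import Data.Empty using (⊥)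
open import Relation.Nullary using (¬_)
open import Relation.Binary.PropositionalEquality using (_≡_; _≢_; refl; cong)
open import Function.Bundles using (_⇔_)

-- The vector space F₂ⁿ, as Vec Bool n (true = 1, xor = addition)

V : ℕ → Set
V n = Vec Bool n

0ᵛ : ∀ {n} → V n
0ᵛ = replicate _ false

infixl 6 _⊕_
_⊕_ : ∀ {n} → V n → V n → V n
_⊕_ = zipWith _xor_

isZero : ∀ {n} → V n → Bool
isZero []          = true
isZero (true ∷ _)  = false
isZero (false ∷ x) = isZero x

allV : (n : ℕ) → List (V n)
allV zero    = [] ∷ []
allV (suc n) = map (false ∷_) (allV n) ++ map (true ∷_) (allV n)

-- Matroids: M = (E, G) with G = F₂ⁿ ∖ {0}; E is a (decidable) subset
-- of F₂ⁿ not containing 0.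

record Matroid : Set where
  constructor mk
  field
    dim  : ℕ
    E    : V dim → Bool
    E-0  : E 0ᵛ ≡ false
open Matroid public

-- Linear maps F₂ᵏ → F₂ⁿ (additivity = F₂-linearity)
Linear : ∀ {k n} → (V k → V n) → Set
Linear f = ∀ x y → f (x ⊕ y) ≡ f x ⊕ f y

Injective : ∀ {k n} → (V k → V n) → Set
Injective f = ∀ x y → f x ≡ f y → x ≡ y

_≅_ : Matroid → Matroid → Set
M₁ ≅ M₂ = Σ (V (dim M₁) → V (dim M₂)) λ f → Σ (V (dim M₂) → V (dim M₁)) λ g →
  Linear f × (∀ x → g (f x) ≡ x) × (∀ y → f (g y) ≡ y) ×
  (∀ x → E M₂ (f x) ≡ E M₁ x)

-- Flats of G (possibly empty), as subsets F of F₂ⁿ with 0 ∉ F and F ∪ {0}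
-- closed under addition.
IsFlat : ∀ {n} → (V n → Bool) → Set
IsFlat F = F 0ᵛ ≡ false ×
  (∀ x y → F x ≡ true → F y ≡ true → x ≢ y → F (x ⊕ y) ≡ true)

-- "Some induced restriction M|F is isomorphic to N":
-- a flat F of M of dimension dim N together with a linear isomorphism
-- V(F) ≅ F₂^{dim N} carrying E ∩ F onto E_N; equivalently an injective
-- linear map g : F₂^{dim N} → F₂^{dim M} (with image F ∪ {0}) such that
-- g x ∈ E iff x ∈ E_N.
RestrictsTo : Matroid → Matroid → Set
RestrictsTo M N = Σ (V (dim N) → V (dim M)) λ g →
  Linear g × Injective g × (∀ x → E M (g x) ≡ E N x)

Free : Matroid → Matroid → Set
Free M N = ¬ RestrictsTo M N

IsClaw : Matroid → Set
IsClaw N = Σ (dim N ≡ 3) λ _ → ∃[ b₁ ] ∃[ b₂ ] ∃[ b₃ ]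
  ( -- linear independence of b₁, b₂, b₃ over F₂
    (isZero b₁ ≡ false) × (isZero b₂ ≡ false) × (isZero b₃ ≡ false) ×
    (isZero (b₁ ⊕ b₂) ≡ false) × (isZero (b₁ ⊕ b₃) ≡ false) ×
    (isZero (b₂ ⊕ b₃) ≡ false) × (isZero (b₁ ⊕ b₂ ⊕ b₃) ≡ false) ×
    (∀ x → (E N x ≡ true) ⇔ (x ≡ b₁ ⊎ x ≡ b₂ ⊎ x ≡ b₃)))

ClawFree : Matroid → Set
ClawFree M = ∀ N → IsClaw N → Free M N

TriangleFree : Matroid → Set
TriangleFree M = ∀ a b → isZero a ≡ false → isZero b ≡ false → a ≢ b →
  ¬ (E M a ≡ true × E M b ≡ true × E M (a ⊕ b) ≡ true)

complement-0 : ∀ n (E : V n → Bool) →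
  (if isZero (0ᵛ {n}) then false else not (E 0ᵛ)) ≡ false
complement-0 zero    E = refl
complement-0 (suc n) E = complement-0 n (λ x → E (false ∷ x))

_ᶜ : Matroid → Matroid
mk n E _ ᶜ = mk n (λ x → if isZero x then false else not (E x)) (complement-0 n E)

PGSum : Matroid → Set
PGSum M = ∃[ F₁ ] ∃[ F₂ ] IsFlat F₁ × IsFlat F₂ ×
  (∀ x → ¬ (F₁ x ≡ true × F₂ x ≡ true)) ×
  (∀ x → E M x ≡ (F₁ x ∨ F₂ x))

-- Even-plane: |E ∩ P| even for every plane P (a plane = image of an
-- injective linear map F₂³ → F₂ⁿ, minus 0; E ∌ 0 so counting over all
-- of F₂³ is the same)
countE : ∀ {n} → (V n → Bool) → (V 3 → V n) → ℕ
countE E g = length (filter (λ x → Data.Bool._≟_ (E (g x)) true) (allV 3))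
  where import Data.Bool

EvenPlane : Matroid → Set
EvenPlane M = ∀ (g : V 3 → V (dim M)) → Linear g → Injective g →
  2 ∣ countE (E M) g

-- Lift-join M₁ ⊗ M₂ on V(G₁) ⊕ V(G₂) = F₂^{n₁+n₂}, vectors written (x, y)
-- with x ∈ V(G₁) (first n₁ coordinates), y ∈ V(G₂):
-- E = E₁ ∪ (E₂ + V(G₁)),  i.e. (x,y) ∈ E iff (y = 0 and x ∈ E₁) or y ∈ E₂.
take-0 : ∀ m n → take m (0ᵛ {m + n}) ≡ 0ᵛ
take-0 zero    n = refl
take-0 (suc m) n = cong (false ∷_) (take-0 m n)

drop-0 : ∀ m n → drop m (0ᵛ {m + n}) ≡ 0ᵛ
drop-0 zero    n = refl
drop-0 (suc m) n = drop-0 m n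

joinE : ∀ n₁ n₂ → (V n₁ → Bool) → (V n₂ → Bool) → V (n₁ + n₂) → Bool
joinE n₁ n₂ E₁ E₂ v = (E₁ (take n₁ v) ∧ isZero (drop n₁ v)) ∨ E₂ (drop n₁ v)

joinE-0 : ∀ n₁ n₂ (E₁ : V n₁ → Bool) (E₂ : V n₂ → Bool) →
  E₁ 0ᵛ ≡ false → E₂ 0ᵛ ≡ false → joinE n₁ n₂ E₁ E₂ 0ᵛ ≡ false
joinE-0 n₁ n₂ E₁ E₂ p q
  rewrite take-0 n₁ n₂ | drop-0 n₁ n₂ | p | q = refl

_⊗_ : Matroid → Matroid → Matroid
mk n₁ E₁ p ⊗ mk n₂ E₂ q = mk (n₁ + n₂) (joinE n₁ n₂ E₁ E₂) (joinE-0 n₁ n₂ E₁ E₂ p q)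

data Generated : Matroid → Set where
  pg-sum     : ∀ {M} → PGSum M → Generated M
  even-plane : ∀ {M} → EvenPlane M → Generated M
  co-tf      : ∀ {M} → TriangleFree M → Generated (M ᶜ)
  lift-join  : ∀ {M₁ M₂} → Generated M₁ → Generated M₂ → Generated (M₁ ⊗ M₂)
  iso        : ∀ {M N} → M ≅ N → Generated M → Generated N

{-# OPTIONS --safe #-}
module Submission where

-- A set E is claw-free iff no x, y, z in E have all of x + y, x + z, y + z, x + y + z outside
-- E, and all generators, lift-joins and isomorphisms respect this condition.
--
-- Conversely, M is a nontrivial lift-join iff some proper nonzero subspace Y satisfies
-- f (x + v) = f x for v in Y and x outside Y, where f is the indicator function of E.
-- Suppose that M is claw-free without such a decomposer Y, and that its complement contains
-- a triangle. Let Z be a maximal subspace disjoint from E containing that triangle. Looking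
-- at planes that meet Z in a line, every coset x + Z outside Z meets E in an affine subspace;
-- let D x ≤ Z be its direction. Planes that meet Z in a point restrict how the groups
-- D x, D y, D (x + y) on a line of V/Z can differ. In the absence of a decomposer the groups
-- D x have trivial intersection, generate Z, and pairwise intersect in index at most 2; this
-- forces all of them to have index at most 2 in Z, or all of them to have order at most 2.
-- In the first case f is a quadratic form, that is, M is even-plane: f (x + e) - f x is
-- bilinear in x and e in Z, and a nonzero third derivative of f would allow one to construct
-- a claw. In the second case adjacency (x + y in E) is an equivalence relation on E
-- with at most two classes, which are the two flats of a PG-sum.

open import Defs
open import Data.Bool using (Bool; true; false; _∧_; _∨_; not; _xor_; T)
import Data.Bool as Bool
import Data.List as List
open import Data.Bool.Properties using (xor-assoc; xor-comm; xor-same; xor-identityˡ; xor-identityʳ; ∨-identityʳ; ∨-zeroʳ; ∧-identityʳ; ∧-zeroʳ; not-involutive)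
open import Data.Empty using (⊥; ⊥-elim)
open import Data.Fin using (Fin; zero; suc)
open import Data.List using (List; []; _∷_; filter; foldr; length)
open import Data.List.Membership.Propositional using (_∈_)
open import Data.List.Membership.Propositional.Properties using (∈-++⁺ˡ; ∈-++⁺ʳ; ∈-map⁺)
open import Data.List.Relation.Unary.Any using (here; there)
open import Data.Nat using (ℕ; zero; suc; _+_; _<_; z≤n; s≤s)
open import Data.Nat.Divisibility using (_∣_; _∣?_; _∣0; ∣m∣n⇒∣m+n; ∣-refl)
open import Data.Nat.Properties using (+-suc; ≤-refl; ≤-trans; m<m+n; m<n+m)
open import Data.Product using (Σ; ∃; ∃-syntax; _×_; _,_; proj₁; proj₂)
open import Data.Sum using (_⊎_; inj₁; inj₂; [_,_])
open import Data.Vec using (Vec; []; _∷_; _++_; drop; head; lookup; map; take)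
open import Data.Vec.Properties using (zipWith-assoc; zipWith-comm; zipWith-identityˡ; zipWith-identityʳ; drop-zipWith; take-zipWith; take++drop≡id; ++-injectiveˡ; ++-injectiveʳ; ≡-dec)
open import Function.Bundles using (_⇔_; mk⇔; Equivalence)
open import Relation.Binary.PropositionalEquality using (_≡_; _≢_; refl; sym; trans; cong; cong₂; subst; module ≡-Reasoning)
open import Relation.Nullary using (¬_; Dec; yes; no; contradiction; does)
open import Relation.Nullary.Decidable using (map′; _×-dec_; _⊎-dec_; _→-dec_; ¬?; dec-true; decidable-stable; toWitnessFalse)

-- Primality is used by contradiction, and the obstacle is that plane arguments control only
-- translations by points of E, not by a whole subspace. The remedy: inside a candidate subspace W,
-- keep only the points whose translation preserves `f` outside W. If the points of E ∩ W are among
-- them, `f` vanishes on the rest of W, so invariance there costs nothing. The candidates W are Z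
-- itself and stabilisers of a union F of cosets of Z, where F collects the cosets whose group D x
-- has a property to be refuted or propagated. The index-or-order dichotomy parallels the classical
-- one for subspaces that pairwise meet in hyperplanes: they share a hyperplane or lie in a common
-- space of one more dimension.

private variable
  k n : ℕ

-- Vector arithmetic over F₂ and a solver for its identities

⊕-assoc : (x y z : V n) → (x ⊕ y) ⊕ z ≡ x ⊕ (y ⊕ z)
⊕-assoc = zipWith-assoc xor-assoc

⊕-comm : (x y : V n) → x ⊕ y ≡ y ⊕ x
⊕-comm = zipWith-comm xor-comm

⊕-identityˡ : (x : V n) → 0ᵛ ⊕ x ≡ x
⊕-identityˡ = zipWith-identityˡ xor-identityˡ

⊕-identityʳ : (x : V n) → x ⊕ 0ᵛ ≡ x
⊕-identityʳ = zipWith-identityʳ xor-identityʳ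

⊕-same : (x : V n) → x ⊕ x ≡ 0ᵛ
⊕-same []      = refl
⊕-same (b ∷ x) = cong₂ _∷_ (xor-same b) (⊕-same x)

⊕-interchange : (a b c d : V n) → (a ⊕ b) ⊕ (c ⊕ d) ≡ (a ⊕ c) ⊕ (b ⊕ d)
⊕-interchange a b c d = begin
  (a ⊕ b) ⊕ (c ⊕ d)  ≡⟨ ⊕-assoc a b (c ⊕ d) ⟩
  a ⊕ (b ⊕ (c ⊕ d))  ≡⟨ cong (a ⊕_) (⊕-assoc b c d) ⟨
  a ⊕ ((b ⊕ c) ⊕ d)  ≡⟨ cong (λ t → a ⊕ (t ⊕ d)) (⊕-comm b c) ⟩
  a ⊕ ((c ⊕ b) ⊕ d)  ≡⟨ cong (a ⊕_) (⊕-assoc c b d) ⟩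
  a ⊕ (c ⊕ (b ⊕ d))  ≡⟨ ⊕-assoc a c (b ⊕ d) ⟨
  (a ⊕ c) ⊕ (b ⊕ d)  ∎
  where open ≡-Reasoning

infix 4 _≟ᵛ_
_≟ᵛ_ : (x y : V n) → Dec (x ≡ y)
_≟ᵛ_ = ≡-dec Bool._≟_

isZero-0ᵛ : ∀ n → isZero (0ᵛ {n}) ≡ true
isZero-0ᵛ zero    = refl
isZero-0ᵛ (suc n) = isZero-0ᵛ n

isZero-true : (x : V n) → isZero x ≡ true → x ≡ 0ᵛ
isZero-true []          _ = refl
isZero-true (false ∷ x) p = cong (false ∷_) (isZero-true x p)

isZero-false : (x : V n) → isZero x ≡ false → x ≢ 0ᵛ
isZero-false {n} _ p refl with trans (sym p) (isZero-0ᵛ n)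
... | ()

≢0-isZero : (x : V n) → x ≢ 0ᵛ → isZero x ≡ false
≢0-isZero x x≢0 with isZero x in eq
... | false = refl
... | true  = contradiction (isZero-true x eq) x≢0

≡-from-⊕ : (x y : V n) → x ⊕ y ≡ 0ᵛ → x ≡ y
≡-from-⊕ x y p = begin
  x            ≡⟨ ⊕-identityʳ x ⟨
  x ⊕ 0ᵛ       ≡⟨ cong (x ⊕_) (⊕-same y) ⟨
  x ⊕ (y ⊕ y)  ≡⟨ ⊕-assoc x y y ⟨
  (x ⊕ y) ⊕ y  ≡⟨ cong (_⊕ y) p ⟩
  0ᵛ ⊕ y       ≡⟨ ⊕-identityˡ y ⟩
  y            ∎
  where open ≡-Reasoning

infixr 7 _·_
_·_ : Bool → V n → V n
true  · x = x
false · x = 0ᵛ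

·-xor : (a b : Bool) (x : V n) → (a xor b) · x ≡ a · x ⊕ b · x
·-xor false b     x = sym (⊕-identityˡ _)
·-xor true  false x = sym (⊕-identityʳ x)
·-xor true  true  x = sym (⊕-same x)

comb : Vec (V n) k → V k → V n
comb []      []      = 0ᵛ
comb (x ∷ ρ) (b ∷ c) = b · x ⊕ comb ρ c

comb-linear : (ρ : Vec (V n) k) → Linear (comb ρ)
comb-linear []      []      []      = sym (⊕-identityˡ 0ᵛ)
comb-linear (x ∷ ρ) (b ∷ c) (d ∷ e) = begin
  (b xor d) · x ⊕ comb ρ (c ⊕ e)              ≡⟨ cong₂ _⊕_ (·-xor b d x) (comb-linear ρ c e) ⟩
  (b · x ⊕ d · x) ⊕ (comb ρ c ⊕ comb ρ e)     ≡⟨ ⊕-interchange _ _ _ _ ⟩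
  (b · x ⊕ comb ρ c) ⊕ (d · x ⊕ comb ρ e)     ∎
  where open ≡-Reasoning

comb-0 : (ρ : Vec (V n) k) → comb ρ 0ᵛ ≡ 0ᵛ
comb-0 []      = refl
comb-0 (x ∷ ρ) = trans (⊕-identityˡ _) (comb-0 ρ)

infixl 6 _:+_
data Expr (k : ℕ) : Set where
  var  : Fin k → Expr k
  :0   : Expr k
  _:+_ : Expr k → Expr k → Expr k

pattern v0 = var zero
pattern v1 = var (suc zero)
pattern v2 = var (suc (suc zero))
pattern v3 = var (suc (suc (suc zero)))
pattern v4 = var (suc (suc (suc (suc zero))))
pattern v5 = var (suc (suc (suc (suc (suc zero)))))
pattern v6 = var (suc (suc (suc (suc (suc (suc zero))))))

⟦_⟧ : Expr k → Vec (V n) k → V n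
⟦ var i  ⟧ ρ = lookup ρ i
⟦ :0     ⟧ ρ = 0ᵛ
⟦ a :+ b ⟧ ρ = ⟦ a ⟧ ρ ⊕ ⟦ b ⟧ ρ

unit : Fin k → V k
unit zero    = true ∷ 0ᵛ
unit (suc i) = false ∷ unit i

nf : Expr k → V k
nf (var i)  = unit i
nf :0       = 0ᵛ
nf (a :+ b) = nf a ⊕ nf b

comb-unit : (ρ : Vec (V n) k) (i : Fin k) → comb ρ (unit i) ≡ lookup ρ i
comb-unit (x ∷ ρ) zero    = trans (cong (x ⊕_) (comb-0 ρ)) (⊕-identityʳ x)
comb-unit (x ∷ ρ) (suc i) = trans (⊕-identityˡ _) (comb-unit ρ i)

nf-correct : (ρ : Vec (V n) k) (e : Expr k) → ⟦ e ⟧ ρ ≡ comb ρ (nf e)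
nf-correct ρ (var i)  = sym (comb-unit ρ i)
nf-correct ρ :0       = sym (comb-0 ρ)
nf-correct ρ (a :+ b) =
  trans (cong₂ _⊕_ (nf-correct ρ a) (nf-correct ρ b)) (sym (comb-linear ρ (nf a) (nf b)))

T⇒≡true : ∀ {b} → T b → b ≡ true
T⇒≡true {true} _ = refl

-- Decides identities between sums of the vectors in ρ by comparing coefficients over F₂.
⊕! : (ρ : Vec (V n) k) (e₁ e₂ : Expr k) {_ : T (isZero (nf e₁ ⊕ nf e₂))} → ⟦ e₁ ⟧ ρ ≡ ⟦ e₂ ⟧ ρ
⊕! ρ e₁ e₂ {p} = begin
  ⟦ e₁ ⟧ ρ         ≡⟨ nf-correct ρ e₁ ⟩
  comb ρ (nf e₁)   ≡⟨ cong (comb ρ) (≡-from-⊕ (nf e₁) (nf e₂) (isZero-true _ (T⇒≡true p))) ⟩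
  comb ρ (nf e₂)   ≡⟨ nf-correct ρ e₂ ⟨
  ⟦ e₂ ⟧ ρ         ∎
  where open ≡-Reasoning

⊕-cancelˡ : (x y : V n) → x ⊕ (x ⊕ y) ≡ y
⊕-cancelˡ x y = ⊕! (x ∷ y ∷ []) (v0 :+ (v0 :+ v1)) v1

⊕-cancelʳ : (x y : V n) → (x ⊕ y) ⊕ y ≡ x
⊕-cancelʳ x y = ⊕! (x ∷ y ∷ []) ((v0 :+ v1) :+ v1) v0

-- Boolean case analysis and exhaustive search over F₂ⁿ

clash : ∀ {a} {A : Set a} {b : Bool} → b ≡ true → b ≡ false → A
clash refl ()

¬true⇒false : ∀ {b} → ¬ b ≡ true → b ≡ false
¬true⇒false {false} _ = refl
¬true⇒false {true}  p = ⊥-elim (p refl)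

¬false⇒true : ∀ {b} → ¬ b ≡ false → b ≡ true
¬false⇒true {true}  _ = refl
¬false⇒true {false} p = ⊥-elim (p refl)

true? : (b : Bool) → b ≡ true ⊎ b ≡ false
true? true  = inj₁ refl
true? false = inj₂ refl

all? : ∀ {n} {P : V n → Set} → (∀ x → Dec (P x)) → Dec (∀ x → P x)
all? {zero}  P? = map′ (λ { p [] → p }) (λ f → f []) (P? [])
all? {suc n} P? = map′ (λ { (p , q) (false ∷ x) → p x ; (p , q) (true ∷ x) → q x })
  (λ f → (λ x → f (false ∷ x)) , (λ x → f (true ∷ x)))
  (all? (λ x → P? (false ∷ x)) ×-dec all? (λ x → P? (true ∷ x)))

any? : ∀ {n} {P : V n → Set} → (∀ x → Dec (P x)) → Dec (∃ P)
any? P? with all? (λ x → ¬? (P? x))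
... | yes none = no λ { (x , p) → none x p }
... | no some  = yes (search P? some)
  where
  search : ∀ {n} {P : V n → Set} → (∀ x → Dec (P x)) → ¬ (∀ x → ¬ P x) → ∃ P
  search {zero}  P? some with P? []
  ... | yes p = [] , p
  ... | no ¬p = ⊥-elim (some λ { [] → ¬p })
  search {suc n} P? some with all? (λ x → ¬? (P? (false ∷ x)))
  ... | no s     = let (x , p) = search (λ x → P? (false ∷ x)) s in false ∷ x , p
  ... | yes none =
    let (x , p) = search (λ x → P? (true ∷ x))
                    (λ s → some λ { (false ∷ x) → none x ; (true ∷ x) → s x })
    in true ∷ x , p

-- Without function extensionality a subset differs from its tabulated copy, so `resp` has to carry
-- `Q` from one to the other.
anySet? : ∀ {n} {Q : (V n → Bool) → Set} →
  (∀ {Y Y′} → (∀ x → Y x ≡ Y′ x) → Q Y → Q Y′) → (∀ Y → Dec (Q Y)) → Dec (∃ Q)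
anySet? {zero} {Q} resp Q? with Q? (λ _ → true) | Q? (λ _ → false)
... | yes q | _     = yes (_ , q)
... | no _  | yes q = yes (_ , q)
... | no ¬t | no ¬f = no none
  where
  none : ¬ ∃ Q
  none (Y , q) with Y [] in eq
  ... | true  = ¬t (resp (λ { [] → eq }) q)
  ... | false = ¬f (resp (λ { [] → eq }) q)
anySet? {suc n} {Q} resp Q? =
  map′ (λ { (Y₀ , Y₁ , q) → glue Y₀ Y₁ , q })
       (λ { (Y , q) → (λ x → Y (false ∷ x)) , (λ x → Y (true ∷ x))
                    , resp (λ { (false ∷ x) → refl ; (true ∷ x) → refl }) q })
       (anySet? (λ e → λ { (Y₁ , q) → Y₁ , resp (λ { (false ∷ x) → e x ; (true ∷ x) → refl }) q })
         λ Y₀ → anySet? (λ e → resp (λ { (false ∷ x) → refl ; (true ∷ x) → e x }))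
           λ Y₁ → Q? (glue Y₀ Y₁))
  where
  glue : (V n → Bool) → (V n → Bool) → V (suc n) → Bool
  glue Y₀ Y₁ (false ∷ x) = Y₀ x
  glue Y₀ Y₁ (true  ∷ x) = Y₁ x

-- Complements of subspaces

record IsSubspace (Y : V n → Bool) : Set where
  field
    has-0  : Y 0ᵛ ≡ true
    closed : ∀ x y → Y x ≡ true → Y y ≡ true → Y (x ⊕ y) ≡ true

-- Coordinates in which Y is the first summand: `Y-ι` makes Y the copy of V n₁, and the copy of V n₂
-- is a complement.
record Splitting (Y : V n → Bool) : Set where
  field
    n₁ n₂    : ℕ
    dims     : n₁ + n₂ ≡ n
    π₁       : V n → V n₁
    π₂       : V n → V n₂
    ι        : V n₁ → V n₂ → V n
    ι-linear : ∀ a b c d → ι (a ⊕ c) (b ⊕ d) ≡ ι a b ⊕ ι c d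
    π₁-ι     : ∀ u v → π₁ (ι u v) ≡ u
    π₂-ι     : ∀ u v → π₂ (ι u v) ≡ v
    ι-π      : ∀ x → ι (π₁ x) (π₂ x) ≡ x
    Y-ι      : ∀ u v → Y (ι u v) ≡ isZero v

-- Gaussian elimination on the first coordinate. A vector `true ∷ w` of Y becomes a new basis vector
-- of Y and clears the first coordinate of the others; without such a vector the coordinate goes to
-- the complement.
splitting : (Y : V n → Bool) → IsSubspace Y → Splitting Y
splitting {zero} Y sub = record
  { n₁ = 0 ; n₂ = 0 ; dims = refl ; π₁ = λ x → x ; π₂ = λ x → x ; ι = λ _ _ → []
  ; ι-linear = λ _ _ _ _ → refl ; π₁-ι = λ { [] v → refl } ; π₂-ι = λ { u [] → refl }
  ; ι-π = λ { [] → refl } ; Y-ι = λ { u [] → IsSubspace.has-0 sub } }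
splitting {suc n} Y sub
  with splitting (λ x → Y (false ∷ x))
         (record { has-0 = IsSubspace.has-0 sub ; closed = λ x y → IsSubspace.closed sub _ _ })
     | any? (λ x → Y (true ∷ x) Bool.≟ true)
... | S | yes (w , Yw) = record
  { n₁ = suc S.n₁ ; n₂ = S.n₂ ; dims = cong suc S.dims
  ; π₁ = λ { (b ∷ x) → b ∷ S.π₁ (x ⊕ b · w) }
  ; π₂ = λ { (b ∷ x) → S.π₂ (x ⊕ b · w) }
  ; ι = λ { (b ∷ u) v → b ∷ (S.ι u v ⊕ b · w) }
  ; ι-linear = λ { (p ∷ a) b (q ∷ c) d → cong ((p xor q) ∷_)
      (trans (cong₂ _⊕_ (S.ι-linear a b c d) (·-xor p q w)) (⊕-interchange _ _ _ _)) }
  ; π₁-ι = λ { (b ∷ u) v → cong (b ∷_) (trans (cong S.π₁ (⊕-cancelʳ _ (b · w))) (S.π₁-ι u v)) }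
  ; π₂-ι = λ { (b ∷ u) v → trans (cong S.π₂ (⊕-cancelʳ _ (b · w))) (S.π₂-ι u v) }
  ; ι-π = λ { (b ∷ x) → cong (b ∷_) (trans (cong (_⊕ b · w) (S.ι-π _)) (⊕-cancelʳ x (b · w))) }
  ; Y-ι = λ { (false ∷ u) v → trans (cong (λ t → Y (false ∷ t)) (⊕-identityʳ _)) (S.Y-ι u v)
            ; (true ∷ u) v → trans (shift (S.ι u v)) (S.Y-ι u v) } }
  where
  module S = Splitting S
  Yw-shift : ∀ b x → Y (b ∷ x) ≡ true → Y (not b ∷ (x ⊕ w)) ≡ true
  Yw-shift b x p = subst (λ b → Y (b ∷ (x ⊕ w)) ≡ true) (xor-comm b true)
    (IsSubspace.closed sub (b ∷ x) (true ∷ w) p Yw)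
  shift : ∀ x → Y (true ∷ (x ⊕ w)) ≡ Y (false ∷ x)
  shift x with true? (Y (false ∷ x)) | true? (Y (true ∷ (x ⊕ w)))
  ... | inj₁ p | _      = trans (Yw-shift false x p) (sym p)
  ... | inj₂ p | inj₂ q = trans q (sym p)
  ... | inj₂ p | inj₁ q =
    clash (subst (λ t → Y (false ∷ t) ≡ true) (⊕-cancelʳ x w) (Yw-shift true (x ⊕ w) q)) p
... | S | no none = record
  { n₁ = S.n₁ ; n₂ = suc S.n₂ ; dims = trans (+-suc S.n₁ S.n₂) (cong suc S.dims)
  ; π₁ = λ { (b ∷ x) → S.π₁ x }
  ; π₂ = λ { (b ∷ x) → b ∷ S.π₂ x }
  ; ι = λ { u (b ∷ v) → b ∷ S.ι u v }
  ; ι-linear = λ { a (p ∷ b) c (q ∷ d) → cong ((p xor q) ∷_) (S.ι-linear a b c d) }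
  ; π₁-ι = λ { u (b ∷ v) → S.π₁-ι u v }
  ; π₂-ι = λ { u (b ∷ v) → cong (b ∷_) (S.π₂-ι u v) }
  ; ι-π = λ { (b ∷ x) → cong (b ∷_) (S.ι-π x) }
  ; Y-ι = λ { u (false ∷ v) → S.Y-ι u v
            ; u (true ∷ v) → ¬true⇒false (λ p → none (_ , p)) } }
  where module S = Splitting S

-- Claws as triples of vectors

-- Linear independence of x, y, z is automatic: every dependency would make
-- one of the vectors that are mapped to false equal to 0, x, y or z.
NoClaw : (V n → Bool) → Set
NoClaw f = ∀ x y z → f x ≡ true → f y ≡ true → f z ≡ true →
  f (x ⊕ y) ≡ false → f (x ⊕ z) ≡ false → f (y ⊕ z) ≡ false → f (x ⊕ y ⊕ z) ≡ false → ⊥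

module Transport {n} (f : V n → Bool) where

  infixl 4 _◂_
  _◂_ : ∀ {b v w} → f v ≡ b → v ≡ w → f w ≡ b
  p ◂ refl = p

module ClawSpan (f : V n → Bool) (f0 : f 0ᵛ ≡ false) {x y z : V n}
  (fx : f x ≡ true) (fy : f y ≡ true) (fz : f z ≡ true)
  (fxy : f (x ⊕ y) ≡ false) (fxz : f (x ⊕ z) ≡ false) (fyz : f (y ⊕ z) ≡ false)
  (fxyz : f (x ⊕ y ⊕ z) ≡ false) where

  open Transport f

  ρ : Vec (V n) 3
  ρ = x ∷ y ∷ z ∷ []

  clawE : V 3 → Bool
  clawE (true  ∷ false ∷ false ∷ []) = true
  clawE (false ∷ true  ∷ false ∷ []) = true
  clawE (false ∷ false ∷ true  ∷ []) = true
  clawE _                            = false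

  span-E : ∀ c → f (comb ρ c) ≡ clawE c
  span-E (true  ∷ true  ∷ true  ∷ []) = fxyz ◂ ⊕! ρ (v0 :+ v1 :+ v2) (v0 :+ (v1 :+ (v2 :+ :0)))
  span-E (true  ∷ true  ∷ false ∷ []) = fxy ◂ ⊕! ρ (v0 :+ v1) (v0 :+ (v1 :+ (:0 :+ :0)))
  span-E (true  ∷ false ∷ true  ∷ []) = fxz ◂ ⊕! ρ (v0 :+ v2) (v0 :+ (:0 :+ (v2 :+ :0)))
  span-E (true  ∷ false ∷ false ∷ []) = fx ◂ ⊕! ρ v0 (v0 :+ (:0 :+ (:0 :+ :0)))
  span-E (false ∷ true  ∷ true  ∷ []) = fyz ◂ ⊕! ρ (v1 :+ v2) (:0 :+ (v1 :+ (v2 :+ :0)))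
  span-E (false ∷ true  ∷ false ∷ []) = fy ◂ ⊕! ρ v1 (:0 :+ (v1 :+ (:0 :+ :0)))
  span-E (false ∷ false ∷ true  ∷ []) = fz ◂ ⊕! ρ v2 (:0 :+ (:0 :+ (v2 :+ :0)))
  span-E (false ∷ false ∷ false ∷ []) = f0 ◂ ⊕! ρ :0 (:0 :+ (:0 :+ (:0 :+ :0)))

  translate : ∀ a c → comb ρ a ≡ 0ᵛ → f (comb ρ (a ⊕ c)) ≡ f (comb ρ c)
  translate a c p = cong f (trans (comb-linear ρ a c) (trans (cong (_⊕ comb ρ c) p) (⊕-identityˡ _)))

  moves : ∀ a c → comb ρ a ≡ 0ᵛ → clawE (a ⊕ c) ≡ clawE c
  moves a c p = trans (sym (span-E (a ⊕ c))) (trans (translate a c p) (span-E c))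

  -- A kernel vector would be a period of `clawE`, but the set of three unit vectors of F₂³ has no
  -- nonzero period.
  kernel : ∀ a → comb ρ a ≡ 0ᵛ → a ≡ 0ᵛ
  kernel (false ∷ false ∷ false ∷ []) _ = refl
  kernel a@(true  ∷ false ∷ false ∷ []) p = clash refl (moves a 0ᵛ p)
  kernel a@(false ∷ true  ∷ false ∷ []) p = clash refl (moves a 0ᵛ p)
  kernel a@(false ∷ false ∷ true  ∷ []) p = clash refl (moves a 0ᵛ p)
  kernel a@(true  ∷ true  ∷ false ∷ []) p = clash refl (sym (moves a (false ∷ false ∷ true ∷ []) p))
  kernel a@(true  ∷ false ∷ true  ∷ []) p = clash refl (sym (moves a (false ∷ true ∷ false ∷ []) p))
  kernel a@(false ∷ true  ∷ true  ∷ []) p = clash refl (sym (moves a (true ∷ false ∷ false ∷ []) p))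
  kernel a@(true  ∷ true  ∷ true  ∷ []) p = clash refl (sym (moves a (true ∷ false ∷ false ∷ []) p))

  comb-injective : Injective (comb ρ)
  comb-injective a b p = ≡-from-⊕ a b (kernel (a ⊕ b)
    (trans (comb-linear ρ a b) (trans (cong (_⊕ comb ρ b) p) (⊕-same _))))

unitClaw : ∀ (f : V 3 → Bool) (p : f 0ᵛ ≡ false) →
  (∀ c → f c ≡ true ⇔ (c ≡ true ∷ false ∷ false ∷ [] ⊎ c ≡ false ∷ true ∷ false ∷ [] ⊎
                        c ≡ false ∷ false ∷ true ∷ [])) →
  IsClaw (mk 3 f p)
unitClaw f p eq = refl , _ , _ , _ , refl , refl , refl , refl , refl , refl , refl , eq

clawFree⇒noClaw : ∀ M → ClawFree M → NoClaw (E M)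
clawFree⇒noClaw M cf x y z fx fy fz fxy fxz fyz fxyz =
  cf (mk 3 clawE refl) (unitClaw clawE refl λ c → mk⇔ (to c) (from c))
    (comb ρ , comb-linear ρ , comb-injective , span-E)
  where
  open ClawSpan (E M) (E-0 M) fx fy fz fxy fxz fyz fxyz
  to : ∀ c → clawE c ≡ true → _
  to (true  ∷ false ∷ false ∷ []) _ = inj₁ refl
  to (false ∷ true  ∷ false ∷ []) _ = inj₂ (inj₁ refl)
  to (false ∷ false ∷ true  ∷ []) _ = inj₂ (inj₂ refl)
  from : ∀ c → _ → clawE c ≡ true
  from c (inj₁ refl)        = refl
  from c (inj₂ (inj₁ refl)) = refl
  from c (inj₂ (inj₂ refl)) = refl

noClaw⇒clawFree : ∀ M → NoClaw (E M) → ClawFree M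
noClaw⇒clawFree M nc (mk _ h _)
  (refl , b₁ , b₂ , b₃ , i₁ , i₂ , i₃ , i₁₂ , i₁₃ , i₂₃ , i₁₂₃ , h⇔) (g , lin , _ , g-E) =
  nc (g b₁) (g b₂) (g b₃)
    (in-E (inj₁ refl)) (in-E (inj₂ (inj₁ refl))) (in-E (inj₂ (inj₂ refl)))
    -- Adding any bᵢ to a sum of two or three of them gives another nontrivial combination, which is
    -- nonzero by independence.
    (out (b₁ ⊕ b₂) (i₂ ◃ s v1 (v0 :+ v1 :+ v0)) (i₁ ◃ s v0 (v0 :+ v1 :+ v1)) i₁₂₃ ◂ lin b₁ b₂)
    (out (b₁ ⊕ b₃) (i₃ ◃ s v2 (v0 :+ v2 :+ v0)) (i₁₂₃ ◃ s (v0 :+ v1 :+ v2) (v0 :+ v2 :+ v1))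
         (i₁ ◃ s v0 (v0 :+ v2 :+ v2)) ◂ lin b₁ b₃)
    (out (b₂ ⊕ b₃) (i₁₂₃ ◃ s (v0 :+ v1 :+ v2) (v1 :+ v2 :+ v0)) (i₃ ◃ s v2 (v1 :+ v2 :+ v1))
         (i₂ ◃ s v1 (v1 :+ v2 :+ v2)) ◂ lin b₂ b₃)
    (out (b₁ ⊕ b₂ ⊕ b₃) (i₂₃ ◃ s (v1 :+ v2) (v0 :+ v1 :+ v2 :+ v0))
         (i₁₃ ◃ s (v0 :+ v2) (v0 :+ v1 :+ v2 :+ v1)) (i₁₂ ◃ s (v0 :+ v1) (v0 :+ v1 :+ v2 :+ v2))
      ◂ trans (lin (b₁ ⊕ b₂) b₃) (cong (_⊕ g b₃) (lin b₁ b₂)))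
  where
  open Transport (E M)
  open Transport isZero renaming (_◂_ to _◃_)
  s : (e₁ e₂ : Expr 3) {_ : T (isZero (nf e₁ ⊕ nf e₂))} → ⟦ e₁ ⟧ (b₁ ∷ b₂ ∷ b₃ ∷ []) ≡ ⟦ e₂ ⟧ (b₁ ∷ b₂ ∷ b₃ ∷ [])
  s e₁ e₂ {p} = ⊕! _ e₁ e₂ {p}
  in-E : ∀ {x} → _ → E M (g x) ≡ true
  in-E {x} p = trans (g-E x) (Equivalence.from (h⇔ x) p)
  distinct : ∀ {x y : V 3} → isZero (x ⊕ y) ≡ false → x ≢ y
  distinct {x = x} i refl = isZero-false (x ⊕ x) i (⊕-same x)
  out : ∀ x → isZero (x ⊕ b₁) ≡ false → isZero (x ⊕ b₂) ≡ false → isZero (x ⊕ b₃) ≡ false →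
    E M (g x) ≡ false
  out x j₁ j₂ j₃ = ¬true⇒false λ p → case (Equivalence.to (h⇔ x) (trans (sym (g-E x)) p))
    where
    case : _ → ⊥
    case (inj₁ q)        = distinct j₁ q
    case (inj₂ (inj₁ q)) = distinct j₂ q
    case (inj₂ (inj₂ q)) = distinct j₃ q

-- Generators and lift-joins contain no claw

pgSum⇒noClaw : ∀ {M} → PGSum M → NoClaw (E M)
pgSum⇒noClaw {M} (F₁ , F₂ , (_ , cl₁) , (_ , cl₂) , _ , E≡) x y z fx fy fz fxy fxz fyz fxyz =
  pigeonhole (side x fx) (side y fy) (side z fz)
  where
  open Transport (E M)
  side : ∀ v → E M v ≡ true → F₁ v ≡ true ⊎ F₂ v ≡ true
  side v p with F₁ v | E≡ v
  ... | true  | _ = inj₁ refl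
  ... | false | q = inj₂ (trans (sym q) p)
  E-F₁ : ∀ v → F₁ v ≡ true → E M v ≡ true
  E-F₁ v p rewrite E≡ v | p = refl
  E-F₂ : ∀ v → F₂ v ≡ true → E M v ≡ true
  E-F₂ v p with F₁ v | E≡ v
  ... | true  | q = q
  ... | false | q = trans q p
  same : ∀ {u v} {F : V (dim M) → Bool} → (∀ a b → F a ≡ true → F b ≡ true → a ≢ b → F (a ⊕ b) ≡ true) →
    (∀ v → F v ≡ true → E M v ≡ true) → u ≢ v → E M (u ⊕ v) ≡ false → F u ≡ true → F v ≡ true → ⊥
  same cl E-F u≢v q p₁ p₂ = clash (E-F _ (cl _ _ p₁ p₂ u≢v)) q
  x≢y : x ≢ y
  x≢y refl = clash (fz ◂ ⊕! (x ∷ z ∷ []) v1 (v0 :+ v0 :+ v1)) fxyz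
  x≢z : x ≢ z
  x≢z refl = clash (fy ◂ ⊕! (x ∷ y ∷ []) v1 (v0 :+ v1 :+ v0)) fxyz
  y≢z : y ≢ z
  y≢z refl = clash (fx ◂ ⊕! (x ∷ y ∷ []) v0 (v0 :+ v1 :+ v1)) fxyz
  -- Two of the three points lie in the same flat, which then contains their sum.
  pigeonhole : _ → _ → _ → ⊥
  pigeonhole (inj₁ p) (inj₁ q) _        = same cl₁ E-F₁ x≢y fxy p q
  pigeonhole (inj₂ p) (inj₂ q) _        = same cl₂ E-F₂ x≢y fxy p q
  pigeonhole (inj₁ p) (inj₂ q) (inj₁ r) = same cl₁ E-F₁ x≢z fxz p r
  pigeonhole (inj₁ p) (inj₂ q) (inj₂ r) = same cl₂ E-F₂ y≢z fyz q r
  pigeonhole (inj₂ p) (inj₁ q) (inj₁ r) = same cl₁ E-F₁ y≢z fyz q r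
  pigeonhole (inj₂ p) (inj₁ q) (inj₂ r) = same cl₂ E-F₂ x≢z fxz p r

filter-cong : ∀ {A : Set} {h h′ : A → Bool} → (∀ a → h a ≡ h′ a) → ∀ as →
  filter (λ a → h a Bool.≟ true) as ≡ filter (λ a → h′ a Bool.≟ true) as
filter-cong eq [] = refl
filter-cong {h = h} {h′} eq (a ∷ as) rewrite eq a with h′ a
... | true  = cong (a ∷_) (filter-cong eq as)
... | false = filter-cong eq as

-- A claw spans a plane with exactly three points of E.
evenPlane⇒noClaw : ∀ {M} → EvenPlane M → NoClaw (E M)
evenPlane⇒noClaw {M} even x y z fx fy fz fxy fxz fyz fxyz =
  toWitnessFalse {a? = 2 ∣? 3} _ (subst (2 ∣_) (cong length (filter-cong span-E (allV 3)))
    (even (comb ρ) (comb-linear ρ) comb-injective))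
  where open ClawSpan (E M) (E-0 M) fx fy fz fxy fxz fyz fxyz

complement-false : ∀ M x → x ≢ 0ᵛ → E (M ᶜ) x ≡ false → E M x ≡ true
complement-false M x x≢0 p with isZero x in z | E M x
... | true  | _     = contradiction (isZero-true x z) x≢0
... | false | true  = refl

-- If x, y, z form a claw, then x ⊕ y, x ⊕ z and y ⊕ z form a triangle of the complement.
co-triangleFree⇒noClaw : ∀ {M} → TriangleFree M → NoClaw (E (M ᶜ))
co-triangleFree⇒noClaw {M} tf x y z fx fy fz fxy fxz fyz fxyz =
  tf (x ⊕ y) (x ⊕ z) (≢0-isZero _ xy≢0) (≢0-isZero _ xz≢0)
    (λ p → yz≢0 (trans (sym xyxz) (trans (cong (_⊕ (x ⊕ z)) p) (⊕-same _))))
    (complement-false M _ xy≢0 fxy , complement-false M _ xz≢0 fxz ,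
     (complement-false M _ yz≢0 fyz ◃ sym xyxz))
  where
  open Transport (E M) renaming (_◂_ to _◃_)
  open Transport (E (M ᶜ))
  xyxz : (x ⊕ y) ⊕ (x ⊕ z) ≡ y ⊕ z
  xyxz = ⊕! (x ∷ y ∷ z ∷ []) ((v0 :+ v1) :+ (v0 :+ v2)) (v1 :+ v2)
  xy≢0 : x ⊕ y ≢ 0ᵛ
  xy≢0 p = clash {b = E (M ᶜ) z} fz (fxyz ◂ trans (cong (_⊕ z) p) (⊕-identityˡ z))
  xz≢0 : x ⊕ z ≢ 0ᵛ
  xz≢0 p = clash {b = E (M ᶜ) y} fy (fxyz ◂ trans (⊕! (x ∷ y ∷ z ∷ []) (v0 :+ v1 :+ v2) ((v0 :+ v2) :+ v1))
                             (trans (cong (_⊕ y) p) (⊕-identityˡ y)))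
  yz≢0 : y ⊕ z ≢ 0ᵛ
  yz≢0 p = clash {b = E (M ᶜ) x} fx (fxyz ◂ trans (⊕-assoc x y z) (trans (cong (x ⊕_) p) (⊕-identityʳ x)))

noClaw-pullback : ∀ {m n} {f : V m → Bool} {h : V n → Bool} (g : V m → V n) → Linear g →
  (∀ x → h (g x) ≡ f x) → NoClaw h → NoClaw f
noClaw-pullback {f = f} {h} g lin eq nc x y z fx fy fz fxy fxz fyz fxyz =
  nc (g x) (g y) (g z) (tr fx) (tr fy) (tr fz)
    (tr fxy ◂ lin x y) (tr fxz ◂ lin x z) (tr fyz ◂ lin y z)
    (tr fxyz ◂ trans (lin (x ⊕ y) z) (cong (_⊕ g z) (lin x y)))
  where
  open Transport h
  tr : ∀ {v b} → f v ≡ b → h (g v) ≡ b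
  tr {v} p = trans (eq v) p

isZero-⊕ : (u v : V n) → isZero u ≡ true → isZero v ≡ true → isZero (u ⊕ v) ≡ true
isZero-⊕ u v p q rewrite isZero-true u p | ⊕-identityˡ v = q

∨-split : ∀ a b → a ∨ b ≡ false → a ≡ false × b ≡ false
∨-split false b p = refl , p

-- Points outside V(G₁) keep their value under translation by V(G₁). A triple with points of both
-- kinds therefore has a pairwise sum in E; the other triples lie in V(G₁) or project to V(G₂).
join-noClaw : ∀ M₁ M₂ → NoClaw (E M₁) → NoClaw (E M₂) → NoClaw (E (M₁ ⊗ M₂))
join-noClaw (mk n₁ E₁ _) (mk n₂ E₂ E₂0) nc₁ nc₂ x y z fx fy fz fxy fxz fyz fxyz =
  split (true? (isZero (drop n₁ x))) (true? (isZero (drop n₁ y))) (true? (isZero (drop n₁ z)))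
  where
  open Transport E₁ renaming (_◂_ to _◂₁_)
  open Transport E₂ renaming (_◂_ to _◂₂_)
  f = joinE n₁ n₂ E₁ E₂
  open Transport f
  t : V (n₁ + n₂) → V n₁
  t = take n₁
  d : V (n₁ + n₂) → V n₂
  d = drop n₁
  d-⊕ : ∀ u v → d (u ⊕ v) ≡ d u ⊕ d v
  d-⊕ u v = drop-zipWith _xor_ u v
  t-⊕ : ∀ u v → t (u ⊕ v) ≡ t u ⊕ t v
  t-⊕ u v = take-zipWith _xor_ u v
  on-ground : ∀ v → isZero (d v) ≡ true → f v ≡ E₁ (t v)
  on-ground v p rewrite isZero-true (d v) p | E₂0 | isZero-0ᵛ n₂ with E₁ (t v)
  ... | true  = refl
  ... | false = refl
  off-ground : ∀ v → isZero (d v) ≡ false → f v ≡ E₂ (d v)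
  off-ground v p rewrite p with E₁ (t v)
  ... | true  = refl
  ... | false = refl
  f-false : ∀ v → f v ≡ false → E₂ (d v) ≡ false
  f-false v p = proj₂ (∨-split _ _ p)
  mixed : ∀ u v → isZero (d u) ≡ true → isZero (d v) ≡ false → f v ≡ true → f (u ⊕ v) ≡ false → ⊥
  mixed u v p q fv fuv = clash (trans (sym (off-ground v q)) fv)
    (f-false (u ⊕ v) fuv ◂₂ trans (d-⊕ u v) (trans (cong (_⊕ d v) (isZero-true _ p)) (⊕-identityˡ _)))
  split : _ → _ → _ → ⊥
  split (inj₁ p) (inj₂ q) _ = mixed x y p q fy fxy
  split (inj₁ p) _ (inj₂ r) = mixed x z p r fz fxz
  split (inj₂ p) (inj₁ q) _ = mixed y x q p fx (fxy ◂ ⊕-comm x y)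
  split (inj₂ p) _ (inj₁ r) = mixed z x r p fx (fxz ◂ ⊕-comm x z)
  split (inj₁ p) (inj₁ q) (inj₁ r) = nc₁ (t x) (t y) (t z)
    (trans (sym (on-ground x p)) fx) (trans (sym (on-ground y q)) fy) (trans (sym (on-ground z r)) fz)
    (down (x ⊕ y) fxy (dz x y p q) ◂₁ t-⊕ x y) (down (x ⊕ z) fxz (dz x z p r) ◂₁ t-⊕ x z)
    (down (y ⊕ z) fyz (dz y z q r) ◂₁ t-⊕ y z)
    (down (x ⊕ y ⊕ z) fxyz (dz (x ⊕ y) z (dz x y p q) r) ◂₁ trans (t-⊕ (x ⊕ y) z) (cong (_⊕ t z) (t-⊕ x y)))
    where
    dz : ∀ u v → isZero (d u) ≡ true → isZero (d v) ≡ true → isZero (d (u ⊕ v)) ≡ true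
    dz u v a b = trans (cong isZero (d-⊕ u v)) (isZero-⊕ (d u) (d v) a b)
    down : ∀ v → f v ≡ false → isZero (d v) ≡ true → E₁ (t v) ≡ false
    down v a b = trans (sym (on-ground v b)) a
  split (inj₂ p) (inj₂ q) (inj₂ r) = nc₂ (d x) (d y) (d z)
    (trans (sym (off-ground x p)) fx) (trans (sym (off-ground y q)) fy) (trans (sym (off-ground z r)) fz)
    (f-false (x ⊕ y) fxy ◂₂ d-⊕ x y) (f-false (x ⊕ z) fxz ◂₂ d-⊕ x z) (f-false (y ⊕ z) fyz ◂₂ d-⊕ y z)
    (f-false (x ⊕ y ⊕ z) fxyz ◂₂ trans (d-⊕ (x ⊕ y) z) (cong (_⊕ d z) (d-⊕ x y)))

generated⇒noClaw : ∀ {M} → Generated M → NoClaw (E M)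
generated⇒noClaw (pg-sum {M} p)              = pgSum⇒noClaw {M} p
generated⇒noClaw (even-plane {M} p)          = evenPlane⇒noClaw {M} p
generated⇒noClaw (co-tf {M} p)               = co-triangleFree⇒noClaw {M} p
generated⇒noClaw (lift-join {M₁} {M₂} p q)   = join-noClaw M₁ M₂ (generated⇒noClaw p) (generated⇒noClaw q)
generated⇒noClaw (iso {M} {N} (f , g , lin , gf , fg , eq) p) =
  noClaw-pullback g g-linear (λ y → trans (sym (eq (g y))) (cong (E N) (fg y))) (generated⇒noClaw p)
  where
  g-linear : Linear g
  g-linear x y = begin
    g (x ⊕ y)                  ≡⟨ cong₂ (λ a b → g (a ⊕ b)) (fg x) (fg y) ⟨
    g (f (g x) ⊕ f (g y))      ≡⟨ cong g (lin (g x) (g y)) ⟨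
    g (f (g x ⊕ g y))          ≡⟨ gf _ ⟩
    g x ⊕ g y                  ∎
    where open ≡-Reasoning

-- Prime matroids

record Subspace (P : V n → Set) : Set where
  field
    0∈  : P 0ᵛ
    ⊕∈  : ∀ {x y} → P x → P y → P (x ⊕ y)

Invariant : (V n → Bool) → (V n → Bool) → Set
Invariant f Y = ∀ x v → Y x ≡ false → Y v ≡ true → f (x ⊕ v) ≡ f x

-- A matroid is prime if it is not a lift-join in a nontrivial way: a proper nonzero Y as
-- below could serve as V(G₁).
Prime : (V n → Bool) → Set
Prime f = ∀ Y → IsSubspace Y → Invariant f Y → ∀ w → Y w ≡ true → w ≢ 0ᵛ → ∀ x → Y x ≡ true

does-true : ∀ {A : Set} (a? : Dec A) → does a? ≡ true → A
does-true (yes a) _ = a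

does-false : ∀ {A : Set} (a? : Dec A) → does a? ≡ false → ¬ A
does-false (no ¬a) _ = ¬a

prime-dec : {f : V n → Bool} → Prime f → {P : V n → Set} (P? : ∀ x → Dec (P x)) → Subspace P →
  (∀ x v → ¬ P x → P v → f (x ⊕ v) ≡ f x) → ∀ w → P w → w ≢ 0ᵛ → ∀ x → P x
prime-dec prime P? sub inv w Pw w≢0 x = does-true (P? x)
  (prime (λ v → does (P? v))
    (record { has-0  = dec-true (P? _) (Subspace.0∈ sub)
            ; closed = λ u v p q → dec-true (P? _) (Subspace.⊕∈ sub (does-true (P? u) p) (does-true (P? v) q)) })
    (λ u v p q → inv u v (does-false (P? u) p) (does-true (P? v) q))
    w (dec-true (P? w) Pw) w≢0 x)

-- `Z-max` encodes maximality: if the coset of x missed E, x could be adjoined to Z. The distinct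
-- nonzero `a₀`, `b₀` give Z dimension at least two.
record Configuration (n : ℕ) : Set₁ where
  field
    f       : V n → Bool
    noClaw  : NoClaw f
    prime   : Prime f
    Z       : V n → Set
    Z?      : ∀ x → Dec (Z x)
    Z-sub   : Subspace Z
    Z-false : ∀ {z} → Z z → f z ≡ false
    Z-max   : ∀ {x} → ¬ Z x → ∃[ z ] Z z × f (x ⊕ z) ≡ true
    a₀ b₀   : V n
    Za₀     : Z a₀
    Zb₀     : Z b₀
    a₀≢0    : a₀ ≢ 0ᵛ
    b₀≢0    : b₀ ≢ 0ᵛ
    a₀≢b₀   : a₀ ≢ b₀
    x₀      : V n
    fx₀     : f x₀ ≡ true

-- Cosets of Z and the groups D x

module Cosets {n} (C : Configuration n) where

  open Configuration C public
  open Subspace Z-sub renaming (0∈ to Z-0; ⊕∈ to Z-⊕)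
  open Transport f public

  private variable
    c d e t u v w x y z : V n

  infixl 4 _◂ᶻ_
  _◂ᶻ_ : Z u → u ≡ v → Z v
  p ◂ᶻ refl = p

  f⇒∉Z : f x ≡ true → ¬ Z x
  f⇒∉Z p q = clash p (Z-false q)

  f-cong : u ≡ v → f u ≡ f v
  f-cong = cong f

  coset-sym : Z (x ⊕ y) → Z (y ⊕ x)
  coset-sym {x} {y} p = p ◂ᶻ ⊕-comm x y

  coset-trans : Z (x ⊕ y) → Z (y ⊕ z) → Z (x ⊕ z)
  coset-trans {x} {y} {z} p q = Z-⊕ p q ◂ᶻ ⊕! (x ∷ y ∷ z ∷ []) ((v0 :+ v1) :+ (v1 :+ v2)) (v0 :+ v2)

  coset-refl : Z (x ⊕ x)
  coset-refl {x} = Z-0 ◂ᶻ sym (⊕-same x)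

  coset-Z : Z (x ⊕ y) → Z x → Z y
  coset-Z {x} {y} p q = Z-⊕ q p ◂ᶻ ⊕-cancelˡ x y

  shift∈ : Z e → Z (x ⊕ (x ⊕ e))
  shift∈ {e} {x} Ze = Ze ◂ᶻ sym (⊕-cancelˡ x e)

  rep : ¬ Z x → ∃[ u ] Z (x ⊕ u) × f u ≡ true
  rep {x} x∉ = let (z , Zz , p) = Z-max x∉ in x ⊕ z , shift∈ Zz , p

  -- The claw would be x, x ⊕ d, x ⊕ e, whose pairwise sums lie in Z.
  affine : f x ≡ true → Z d → Z e → f (x ⊕ d) ≡ true → f (x ⊕ e) ≡ true → f (x ⊕ (d ⊕ e)) ≡ true
  affine {x} {d} {e} fx Zd Ze fxd fxe with true? (f (x ⊕ (d ⊕ e)))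
  ... | inj₁ p = p
  ... | inj₂ p = ⊥-elim (noClaw x (x ⊕ d) (x ⊕ e) fx fxd fxe
    (Z-false Zd ◂ s v1 (v0 :+ (v0 :+ v1)))
    (Z-false Ze ◂ s v2 (v0 :+ (v0 :+ v2)))
    (Z-false (Z-⊕ Zd Ze) ◂ s (v1 :+ v2) ((v0 :+ v1) :+ (v0 :+ v2)))
    (p ◂ s (v0 :+ (v1 :+ v2)) (v0 :+ (v0 :+ v1) :+ (v0 :+ v2))))
    where
    s : ∀ e₁ e₂ {_ : T (isZero (nf e₁ ⊕ nf e₂))} → _
    s e₁ e₂ {p} = ⊕! (x ∷ d ∷ e ∷ []) e₁ e₂ {p}

  -- For x in E, D x is the direction space of the affine subspace E ∩ (x ⊕ Z).
  record D (x e : V n) : Set where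
    constructor mkD
    field
      inZ   : Z e
      fixes : ∀ z → Z z → f (x ⊕ z ⊕ e) ≡ f (x ⊕ z)
  open D public

  D? : ∀ x e → Dec (D x e)
  D? x e = map′ (λ { (p , q) → mkD p q }) (λ { (mkD p q) → p , q })
    (Z? e ×-dec all? (λ z → Z? z →-dec (f (x ⊕ z ⊕ e) Bool.≟ f (x ⊕ z))))

  infixl 4 _◂ᴰ_
  _◂ᴰ_ : D x d → d ≡ e → D x e
  p ◂ᴰ refl = p

  D-apply : D x e → Z (x ⊕ u) → f (u ⊕ e) ≡ f u
  D-apply {x} {e} {u} p q = begin
    f (u ⊕ e)              ≡⟨ f-cong (cong (_⊕ e) (⊕-cancelˡ x u)) ⟨
    f (x ⊕ (x ⊕ u) ⊕ e)    ≡⟨ fixes p _ q ⟩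
    f (x ⊕ (x ⊕ u))        ≡⟨ f-cong (⊕-cancelˡ x u) ⟩
    f u                    ∎
    where open ≡-Reasoning

  D-shift : Z (x ⊕ u) → D x e → D u e
  D-shift {x} {u} q p = mkD (inZ p) λ z Zz →
    D-apply p (Z-⊕ q Zz ◂ᶻ ⊕-assoc x u z)

  -- `affine` completes parallelograms, so the difference of two points of E in a coset is a period
  -- of the whole coset.
  D-intro : f x ≡ true → Z e → f (x ⊕ e) ≡ true → D x e
  D-intro {x} {e} fx Ze fxe = mkD Ze fix
    where
    fix : ∀ z → Z z → f (x ⊕ z ⊕ e) ≡ f (x ⊕ z)
    fix z Zz with true? (f (x ⊕ z)) | true? (f (x ⊕ z ⊕ e))
    ... | inj₁ p | _      = trans (affine fx Zz Ze p fxe ◂ sym (⊕-assoc x z e)) (sym p)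
    ... | inj₂ p | inj₂ q = trans q (sym p)
    ... | inj₂ p | inj₁ q = clash
      (affine fx (Z-⊕ Zz Ze) Ze (q ◂ ⊕-assoc x z e) fxe ◂ ⊕! (x ∷ z ∷ e ∷ []) (v0 :+ (v1 :+ v2 :+ v2)) (v0 :+ v1))
      p

  D-rep : Z (x ⊕ u) → f u ≡ true → Z e → f (u ⊕ e) ≡ true → D x e
  D-rep q fu Ze fue = D-shift (coset-sym q) (D-intro fu Ze fue)

  D-0 : D x 0ᵛ
  D-0 = mkD Z-0 λ z _ → f-cong (⊕-identityʳ _)

  D-⊕ : D x d → D x e → D x (d ⊕ e)
  D-⊕ {x} {d} {e} p q = mkD (Z-⊕ (inZ p) (inZ q)) λ z Zz → begin
    f (x ⊕ z ⊕ (d ⊕ e))    ≡⟨ f-cong (⊕! (x ∷ z ∷ d ∷ e ∷ []) (v0 :+ v1 :+ (v2 :+ v3)) (v0 :+ (v1 :+ v2) :+ v3)) ⟩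
    f (x ⊕ (z ⊕ d) ⊕ e)    ≡⟨ fixes q _ (Z-⊕ Zz (inZ p)) ⟩
    f (x ⊕ (z ⊕ d))        ≡⟨ f-cong (⊕-assoc x z d) ⟨
    f (x ⊕ z ⊕ d)          ≡⟨ fixes p z Zz ⟩
    f (x ⊕ z)              ∎
    where open ≡-Reasoning

  D-cancelʳ : D x (d ⊕ e) → D x e → D x d
  D-cancelʳ {d = d} {e} p q = D-⊕ p q ◂ᴰ ⊕-cancelʳ d e

  D-cancelˡ : D x (d ⊕ e) → D x d → D x e
  D-cancelˡ {d = d} {e} p q = D-⊕ q p ◂ᴰ ⊕-cancelˡ d e

  moved : ¬ D x e → Z e → Z (x ⊕ u) → f u ≡ true → f (u ⊕ e) ≡ false
  moved ¬p Ze q fu = ¬true⇒false λ r → ¬p (D-rep q fu Ze r)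

  D-separates : D x e → ¬ D y e → ¬ Z (x ⊕ y)
  D-separates p ¬q r = ¬q (D-shift r p)

  -- Lines x, y, x ⊕ y of V/Z

  line-swap : x ⊕ y ≡ w → y ⊕ x ≡ w
  line-swap {x} {y} p = trans (⊕-comm y x) p

  line-rot : x ⊕ y ≡ w → x ⊕ w ≡ y
  line-rot {x} {y} refl = ⊕-cancelˡ x y

  line-rot′ : x ⊕ y ≡ w → y ⊕ w ≡ x
  line-rot′ p = line-rot (line-swap p)

  line-separates : x ⊕ y ≡ w → D x e → ¬ D y e → ¬ Z w
  line-separates refl = D-separates

  -- Otherwise u, u ⊕ e, t would be a claw: its sums are e in Z and the points v, v ⊕ e, t ⊕ e.
  paired : D u e → D v e → u ⊕ t ≡ v → f t ≡ true → f (t ⊕ e) ≡ false →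
    f u ≡ true → f v ≡ true
  paired {u} {e} {t = t} p q refl ft fte fu with true? (f (u ⊕ t))
  ... | inj₁ r = r
  ... | inj₂ r = ⊥-elim (noClaw u (u ⊕ e) t fu (trans (D-apply p coset-refl) fu) ft
    (Z-false (inZ p) ◂ s v1 (v0 :+ (v0 :+ v1)))
    r
    (trans (D-apply q coset-refl) r ◂ s (v0 :+ v2 :+ v1) (v0 :+ v1 :+ v2))
    (fte ◂ s (v2 :+ v1) (v0 :+ (v0 :+ v1) :+ v2)))
    where
    s : ∀ e₁ e₂ {_ : T (isZero (nf e₁ ⊕ nf e₂))} → _
    s e₁ e₂ {p} = ⊕! (u ∷ e ∷ t ∷ []) e₁ e₂ {p}

  same-value : (f u ≡ true → f v ≡ true) → (f v ≡ true → f u ≡ true) → f v ≡ f u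
  same-value {u} {v} to from with true? (f u) | true? (f v)
  ... | inj₁ p | _      = trans (to p) (sym p)
  ... | inj₂ p | inj₁ q = clash (from q) p
  ... | inj₂ p | inj₂ q = trans q (sym p)

  translated : D u e → D v e → u ⊕ t ≡ v → f t ≡ true → f (t ⊕ e) ≡ false → f v ≡ f u
  translated p q l ft fte =
    same-value (paired p q l ft fte) (paired q p (line-swap (line-rot′ l)) ft fte)

  -- What `Invariant` demands of a coset w inside the decomposer and a coset x outside it,
  -- restricted to translations by points of E.
  Subordinate : V n → V n → Set
  Subordinate w x = ∀ {u t} → Z (x ⊕ u) → Z (w ⊕ t) → f t ≡ true → f (u ⊕ t) ≡ f u

  -- If e fixes exactly two of the three cosets on a line of V/Z, the third one is subordinate.
  subordinate : x ⊕ y ≡ w → D x e → D y e → ¬ D w e → Subordinate w x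
  subordinate {x} {y} refl p q ¬r {u} {t} xu wt ft =
    translated (D-shift xu p) (D-shift yut q) refl ft (moved ¬r (inZ p) wt ft)
    where
    yut : Z (y ⊕ (u ⊕ t))
    yut = Z-⊕ xu wt ◂ᶻ ⊕! (x ∷ y ∷ u ∷ t ∷ []) ((v0 :+ v2) :+ (v0 :+ v1 :+ v3)) (v1 :+ (v2 :+ v3))

  -- Both t and t ⊕ d lie in E, and their translations differ by d.
  subordinate-⊆ : ¬ Z w → Subordinate w x → D w d → D x d
  subordinate-⊆ {w} {x} {d} w∉ sub p = let (t , wt , ft) = rep w∉ in mkD (inZ p) λ z Zz → begin
    f (x ⊕ z ⊕ d)                ≡⟨ sub (shift∈ (Z-⊕ Zz (inZ p)) ◂ᶻ cong (x ⊕_) (sym (⊕-assoc x z d))) wt ft ⟨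
    f (x ⊕ z ⊕ d ⊕ t)            ≡⟨ f-cong (⊕! (x ∷ z ∷ d ∷ t ∷ []) (v0 :+ v1 :+ v2 :+ v3) (v0 :+ v1 :+ (v3 :+ v2))) ⟩
    f (x ⊕ z ⊕ (t ⊕ d))          ≡⟨ sub (shift∈ Zz) (Z-⊕ wt (inZ p) ◂ᶻ ⊕-assoc w t d) (trans (D-apply p wt) ft) ⟩
    f (x ⊕ z)                    ∎
    where open ≡-Reasoning

  -- Translation by a point t of E in w ⊕ Z carries the values of `f` on one coset to the other, so
  -- periods are carried along.
  subordinate-≡ : x ⊕ y ≡ w → ¬ Z w → Subordinate w x → D x d → D y d
  subordinate-≡ {x} {y} {d = d} refl w∉ sub p = let (t , wt , ft) = rep w∉ in mkD (inZ p) λ z Zz →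
    let ρ : Vec (V n) 5
        ρ = x ∷ y ∷ z ∷ d ∷ t ∷ []
        xu : Z (x ⊕ (y ⊕ z ⊕ t))
        xu = Z-⊕ wt Zz ◂ᶻ ⊕! ρ (v0 :+ v1 :+ v4 :+ v2) (v0 :+ (v1 :+ v2 :+ v4))
    in begin
    f (y ⊕ z ⊕ d)                ≡⟨ f-cong (⊕! ρ (v1 :+ v2 :+ v3) ((v1 :+ v2 :+ v4 :+ v3) :+ v4)) ⟩
    f (y ⊕ z ⊕ t ⊕ d ⊕ t)        ≡⟨ sub (Z-⊕ xu (inZ p) ◂ᶻ ⊕-assoc x (y ⊕ z ⊕ t) d) wt ft ⟩
    f (y ⊕ z ⊕ t ⊕ d)            ≡⟨ D-apply p xu ⟩
    f (y ⊕ z ⊕ t)                ≡⟨ sub xu wt ft ⟨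
    f (y ⊕ z ⊕ t ⊕ t)            ≡⟨ f-cong (⊕-cancelʳ _ t) ⟩
    f (y ⊕ z)                    ∎
    where open ≡-Reasoning

  module TwoOfThree (line : x ⊕ y ≡ w) (w∉ : ¬ Z w) (p : D x e) (q : D y e) (¬r : ¬ D w e) where

    w⊆x : D w d → D x d
    w⊆x = subordinate-⊆ w∉ (subordinate line p q ¬r)

    x⊆y : D x d → D y d
    x⊆y = subordinate-≡ line w∉ (subordinate line p q ¬r)

    y⊆x : D y d → D x d
    y⊆x = subordinate-≡ (line-swap line) w∉ (subordinate (line-swap line) q p ¬r)

  module OneOfThree (line : x ⊕ y ≡ w) (x∉ : ¬ Z x) (y∉ : ¬ Z y)
    (p : D x e) (¬q : ¬ D y e) (¬r : ¬ D w e) where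

    -- x ⊕ u, x ⊕ u ⊕ e, v span a plane with 0 at e and v ⊕ e; it would be a claw
    -- if both remaining points were 0.
    third : Z (x ⊕ u) → Z (y ⊕ v) → f u ≡ true → f v ≡ true →
      ∃[ s ] (s ≡ u ⊕ v ⊎ s ≡ u ⊕ v ⊕ e) × f s ≡ true
    third {u} {v} xu yv fu fv with true? (f (u ⊕ v)) | true? (f (u ⊕ v ⊕ e))
    ... | inj₁ g | _      = _ , inj₁ refl , g
    ... | inj₂ _ | inj₁ g = _ , inj₂ refl , g
    ... | inj₂ g | inj₂ h = ⊥-elim (noClaw u (u ⊕ e) v fu (trans (D-apply p xu) fu) fv
      (Z-false (inZ p) ◂ s v2 (v0 :+ (v0 :+ v2)))
      g
      (h ◂ s (v0 :+ v1 :+ v2) (v0 :+ v2 :+ v1))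
      (moved ¬q (inZ p) yv fv ◂ s (v1 :+ v2) (v0 :+ (v0 :+ v2) :+ v1)))
      where
      s : ∀ e₁ e₂ {_ : T (isZero (nf e₁ ⊕ nf e₂))} → _
      s e₁ e₂ {p} = ⊕! (u ∷ v ∷ e ∷ []) e₁ e₂ {p}

    -- Each application of `third` fixes a point of E in w ⊕ Z up to e, and the difference of two
    -- such points is a period.
    difference : ∀ {u u′ v v′ d} → Z (x ⊕ u) → Z (x ⊕ u′) → Z (y ⊕ v) → Z (y ⊕ v′) →
      f u ≡ true → f u′ ≡ true → f v ≡ true → f v′ ≡ true → u ⊕ u′ ⊕ (v ⊕ v′) ≡ d →
      D w d ⊎ D w (d ⊕ e)
    difference {u} {u′} {v} {v′} xu xu′ yv yv′ fu fu′ fv fv′ refl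
      with third xu yv fu fv | third xu′ yv′ fu′ fv′
    ... | s , s≡ , fs | s′ , s′≡ , fs′ = pick s≡ s′≡
      where
      ρ : Vec (V n) 5
      ρ = u ∷ u′ ∷ v ∷ v′ ∷ e ∷ []
      uv : Z (w ⊕ (u ⊕ v))
      uv = Z-⊕ xu yv ◂ᶻ trans (⊕-interchange x u y v) (cong (_⊕ (u ⊕ v)) line)
      ws : s ≡ u ⊕ v ⊎ s ≡ u ⊕ v ⊕ e → Z (w ⊕ s)
      ws (inj₁ refl) = uv
      ws (inj₂ refl) = Z-⊕ uv (inZ p) ◂ᶻ ⊕-assoc w (u ⊕ v) e
      Zδ : Z (u ⊕ u′ ⊕ (v ⊕ v′))
      Zδ = Z-⊕ (coset-trans (coset-sym xu) xu′) (coset-trans (coset-sym yv) yv′)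
      diff : ∀ {δ} → s ⊕ δ ≡ s′ → Z δ → D w δ
      diff q Zδ = D-rep (ws s≡) fs Zδ (fs′ ◂ sym q)
      pick : _ → _ → _
      pick (inj₁ refl) (inj₁ refl) = inj₁ (diff (⊕! ρ (v0 :+ v2 :+ (v0 :+ v1 :+ (v2 :+ v3))) (v1 :+ v3)) Zδ)
      pick (inj₁ refl) (inj₂ refl) = inj₂
        (diff (⊕! ρ (v0 :+ v2 :+ (v0 :+ v1 :+ (v2 :+ v3) :+ v4)) (v1 :+ v3 :+ v4)) (Z-⊕ Zδ (inZ p)))
      pick (inj₂ refl) (inj₁ refl) = inj₂
        (diff (⊕! ρ (v0 :+ v2 :+ v4 :+ (v0 :+ v1 :+ (v2 :+ v3) :+ v4)) (v1 :+ v3)) (Z-⊕ Zδ (inZ p)))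
      pick (inj₂ refl) (inj₂ refl) = inj₁
        (diff (⊕! ρ (v0 :+ v2 :+ v4 :+ (v0 :+ v1 :+ (v2 :+ v3))) (v1 :+ v3 :+ v4)) Zδ)

    y→w : D y d → D w d ⊎ D w (d ⊕ e)
    y→w {d} q = let (u , xu , fu) = rep x∉ ; (v , yv , fv) = rep y∉ in
      difference xu xu yv (Z-⊕ yv (inZ q) ◂ᶻ ⊕-assoc y v d) fu fu fv (trans (D-apply q yv) fv)
        (⊕! (u ∷ v ∷ d ∷ []) (v0 :+ v0 :+ (v1 :+ (v1 :+ v2))) v2)

    x→w : D x d → D w d ⊎ D w (d ⊕ e)
    x→w {d} q = let (u , xu , fu) = rep x∉ ; (v , yv , fv) = rep y∉ in
      difference xu (Z-⊕ xu (inZ q) ◂ᶻ ⊕-assoc x u d) yv yv fu (trans (D-apply q xu) fu) fv fv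
        (⊕! (u ∷ v ∷ d ∷ []) (v0 :+ (v0 :+ v2) :+ (v1 :+ v1)) v2)

  -- Since x ⊕ e = y ⊕ w and so on, x, y, w would be a claw if e moved all three out of E.
  aligned : f x ≡ true → f y ≡ true → f w ≡ true → Z e → x ⊕ y ⊕ w ≡ e → D x e ⊎ D y e ⊎ D w e
  aligned {x} {y} {w} fx fy fw Ze refl
    with true? (f (x ⊕ e′)) | true? (f (y ⊕ e′)) | true? (f (w ⊕ e′))
    where e′ = x ⊕ y ⊕ w
  ... | inj₁ p | _      | _      = inj₁ (D-intro fx Ze p)
  ... | inj₂ _ | inj₁ p | _      = inj₂ (inj₁ (D-intro fy Ze p))
  ... | inj₂ _ | inj₂ _ | inj₁ p = inj₂ (inj₂ (D-intro fw Ze p))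
  ... | inj₂ p | inj₂ q | inj₂ r = ⊥-elim (noClaw x y w fx fy fw
    (r ◂ s (v2 :+ (v0 :+ v1 :+ v2)) (v0 :+ v1)) (q ◂ s (v1 :+ (v0 :+ v1 :+ v2)) (v0 :+ v2))
    (p ◂ s (v0 :+ (v0 :+ v1 :+ v2)) (v1 :+ v2)) (Z-false Ze))
    where
    s : ∀ e₁ e₂ {_ : T (isZero (nf e₁ ⊕ nf e₂))} → _
    s e₁ e₂ {p} = ⊕! (x ∷ y ∷ w ∷ []) e₁ e₂ {p}

  -- Unlike `translated`, this needs no common period of u and v that moves w. By `aligned`, p ⊕ w
  -- differs from a point of E in its coset by an element of one of three groups, and all of these
  -- lie in D q.
  translated-flat : u ⊕ w ≡ v → f w ≡ true → ¬ Z u → ¬ Z v → (∀ {e} → D w e → D u e) →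
    (∀ {e} → D u e → D v e) → (∀ {e} → D v e → D u e) → f v ≡ f u
  translated-flat {u} {w} {v} line fw u∉ v∉ w⊆u u⊆v v⊆u =
    same-value (half line v∉ u⊆v (λ p → u⊆v (w⊆u p))) (half (line-swap (line-rot′ line)) u∉ v⊆u w⊆u)
    where
    half : ∀ {p q} → p ⊕ w ≡ q → ¬ Z q → (∀ {e} → D p e → D q e) → (∀ {e} → D w e → D q e) →
      f p ≡ true → f q ≡ true
    half {p} {q} refl q∉ p⊆q w⊆q fp with rep q∉
    ... | s , qs , fs with aligned fp fw fs qs refl
    ... | r = trans (D-apply (D-s r) qs) fs ◂ ⊕! (p ⊕ w ∷ s ∷ []) (v1 :+ (v0 :+ v1)) v0
      where
      D-s : _ → D q (q ⊕ s)
      D-s (inj₁ g)        = p⊆q g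
      D-s (inj₂ (inj₁ g)) = w⊆q g
      D-s (inj₂ (inj₂ g)) = D-shift (coset-sym qs) g

  -- Consequences of primality

  x₀∉Z : ¬ Z x₀
  x₀∉Z = f⇒∉Z fx₀

  -- The points of W whose translation preserves f outside W form a decomposer,
  -- because they contain E ∩ W.
  no-decomposer : {W : V n → Set} (W? : ∀ x → Dec (W x)) → Subspace W → ∀ {u} → ¬ W u →
    (∀ {w u} → f w ≡ true → W w → ¬ W u → f (u ⊕ w) ≡ f u) →
    ∀ {v} → W v → (∀ {u} → ¬ W u → f (u ⊕ v) ≡ f u) → v ≡ 0ᵛ
  no-decomposer {W} W? W-sub {u₀} u₀∉ sub {v} Wv stab = decidable-stable (v ≟ᵛ 0ᵛ) λ v≢0 →
    u₀∉ (proj₁ (prime-dec prime Y? Y-sub Y-inv v (Wv , λ u → stab {u}) v≢0 u₀))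
    where
    open Subspace W-sub renaming (0∈ to W-0; ⊕∈ to W-⊕)
    Y : V n → Set
    Y v = W v × (∀ u → ¬ W u → f (u ⊕ v) ≡ f u)
    Y? : ∀ v → Dec (Y v)
    Y? v = W? v ×-dec all? λ u → ¬? (W? u) →-dec (f (u ⊕ v) Bool.≟ f u)
    Y-sub : Subspace Y
    Y-sub = record
      { 0∈ = W-0 , λ u _ → f-cong (⊕-identityʳ u)
      ; ⊕∈ = λ { {x} {y} (Wx , p) (Wy , q) → W-⊕ Wx Wy , λ u u∉ →
          trans (f-cong (sym (⊕-assoc u x y)))
            (trans (q (u ⊕ x) (λ r → u∉ (W-⊕ r Wx ◂ᵂ ⊕-cancelʳ u x))) (p u u∉)) } }
      where
      _◂ᵂ_ : ∀ {u v} → W u → u ≡ v → W v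
      p ◂ᵂ refl = p
    f-false : ∀ {x} → W x → ¬ Y x → f x ≡ false
    f-false Wx ¬Yx = ¬true⇒false λ fx → ¬Yx (Wx , λ u u∉ → sub fx Wx u∉)
    Y-inv : ∀ x v → ¬ Y x → Y v → f (x ⊕ v) ≡ f x
    Y-inv x v ¬Yx Yv@(Wv , p) with W? x
    ... | no x∉  = p x x∉
    ... | yes Wx = trans
      (f-false (W-⊕ Wx Wv) λ q → ¬Yx (subst Y (⊕-cancelʳ x v) (Subspace.⊕∈ Y-sub q Yv)))
      (sym (f-false Wx ¬Yx))

  -- For W = Z the subordination hypothesis of `no-decomposer` is vacuous, because Z misses E.
  Z-moved : Z e → e ≢ 0ᵛ → ∃[ x ] ¬ Z x × ¬ D x e
  Z-moved {e} Ze e≢0 with any? (λ x → ¬? (Z? x) ×-dec ¬? (D? x e))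
  ... | yes p   = p
  ... | no none = ⊥-elim (e≢0 (no-decomposer Z? Z-sub x₀∉Z (λ fw Zw _ → ⊥-elim (f⇒∉Z fw Zw)) Ze
    λ {u} u∉ → D-apply (decidable-stable (D? u e) λ ¬p → none (u , u∉ , ¬p)) coset-refl))

  record Stable (F : V n → Set) : Set where
    field
      F?     : ∀ x → Dec (F x)
      resp   : ∀ {x y} → Z (x ⊕ y) → F x → F y
      F⇒∉Z   : ∀ {x} → F x → ¬ Z x

  -- The set X of all points outside F whose translation preserves F is a subspace.
  -- As f is prime, it must have a point of E that is not subordinate to the points outside X.
  module Stabiliser {F : V n → Set} (F-stable : Stable F) where
    open Stable F-stable

    X : V n → Set
    X x = ¬ F x × (∀ k → F k → F (k ⊕ x))

    X? : ∀ x → Dec (X x)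
    X? x = ¬? (F? x) ×-dec all? λ k → F? k →-dec F? (k ⊕ x)

    F-≡ : ∀ {u v} → u ≡ v → F u → F v
    F-≡ refl p = p

    X-F : ∀ {x y} → X x → F (y ⊕ x) → F y
    X-F {x} {y} (_ , p) q = F-≡ (⊕-cancelʳ y x) (p _ q)

    Z⊆X : ∀ {z} → Z z → X z
    Z⊆X Zz = (λ p → F⇒∉Z p Zz) , λ k Fk → resp (shift∈ Zz) Fk

    X-sub : Subspace X
    X-sub = record
      { 0∈ = Z⊆X Z-0
      ; ⊕∈ = λ { {x} {y} Xx Xy → (λ p → proj₁ Xx (X-F Xy p)) ,
                  λ k Fk → F-≡ (⊕-assoc k x y) (proj₂ Xy _ (proj₂ Xx k Fk)) } }

    X-cancel : ∀ {u w} → X w → X (u ⊕ w) → X u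
    X-cancel {u} {w} Xw Xuw = subst X (⊕-cancelʳ u w) (Subspace.⊕∈ X-sub Xuw Xw)

    outside : ∀ {u} → ¬ X u → F u ⊎ ∃[ k ] F k × ¬ F (k ⊕ u)
    outside {u} ¬Xu with F? u | any? (λ k → F? k ×-dec ¬? (F? (k ⊕ u)))
    ... | yes Fu | _      = inj₁ Fu
    ... | no _   | yes p  = inj₂ p
    ... | no ¬Fu | no none =
      ⊥-elim (¬Xu (¬Fu , λ k Fk → decidable-stable (F? (k ⊕ u)) λ ¬p → none (k , Fk , ¬p)))

    -- A point of E in m ⊕ Z lies in X and would preserve `f` outside X, so `no-decomposer` would
    -- make it 0.
    trivial : ∀ {k m} → F k → X m → ¬ Z m →
      ¬ (∀ {w u} → f w ≡ true → X w → ¬ X u → f (u ⊕ w) ≡ f u)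
    trivial {k} {m} Fk Xm m∉ sub with rep m∉
    ... | t , mt , ft = f⇒∉Z ft (Z-0 ◂ᶻ sym
      (no-decomposer X? X-sub {k} (λ p → proj₁ p Fk) sub Xt (sub ft Xt)))
      where
      Xt : X t
      Xt = subst X (⊕-cancelˡ m t) (Subspace.⊕∈ X-sub Xm (Z⊆X mt))

  -- As E is covered by the translates s ⊕ U of points s in E, the points s ⊕ U together with U
  -- form a subspace, which would be a decomposer.
  spanned : {U : V n → Set} → (∀ x → Dec (U x)) → Subspace U → (∀ {e} → U e → Z e) →
    (∀ {x e} → ¬ Z x → D x e → U e) → ∀ {e} → Z e → U e
  spanned {U} U? U-sub U⊆Z D⊆U {e} Ze = finish (all-Y e)
    where
    open Subspace U-sub renaming (0∈ to U-0; ⊕∈ to U-⊕)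
    Y : V n → Set
    Y v = ∃[ e ] U e × (f (v ⊕ e) ≡ true ⊎ v ≡ e)
    Y? : ∀ v → Dec (Y v)
    Y? v = any? λ e → U? e ×-dec ((f (v ⊕ e) Bool.≟ true) ⊎-dec (v ≟ᵛ e))
    Y-≡ : ∀ {u v} → u ≡ v → Y u → Y v
    Y-≡ refl p = p
    Y-sub : Subspace Y
    Y-sub = record { 0∈ = 0ᵛ , U-0 , inj₂ refl ; ⊕∈ = add }
      where
      add : ∀ {x y} → Y x → Y y → Y (x ⊕ y)
      add {x} {y} (d , Ud , inj₂ refl) (e , Ue , inj₂ refl) = d ⊕ e , U-⊕ Ud Ue , inj₂ refl
      add {x} {y} (d , Ud , inj₂ refl) (e , Ue , inj₁ q) = x ⊕ e , U-⊕ Ud Ue ,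
        inj₁ (q ◂ ⊕! (x ∷ y ∷ e ∷ []) (v1 :+ v2) (v0 :+ v1 :+ (v0 :+ v2)))
      add {x} {y} (d , Ud , inj₁ p) (e , Ue , inj₂ refl) = d ⊕ y , U-⊕ Ud Ue ,
        inj₁ (p ◂ ⊕! (x ∷ y ∷ d ∷ []) (v0 :+ v2) (v0 :+ v1 :+ (v2 :+ v1)))
      add {x} {y} (d , Ud , inj₁ p) (e , Ue , inj₁ q) with Z? (x ⊕ d ⊕ (y ⊕ e))
      ... | yes Zg = d ⊕ e ⊕ g , U-⊕ (U-⊕ Ud Ue) (D⊆U (f⇒∉Z p) (D-intro p Zg
                       (q ◂ sym (⊕-cancelˡ (x ⊕ d) (y ⊕ e)))))
                   , inj₂ (⊕! (x ∷ y ∷ d ∷ e ∷ []) (v0 :+ v1) (v2 :+ v3 :+ (v0 :+ v2 :+ (v1 :+ v3))))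
        where g = x ⊕ d ⊕ (y ⊕ e)
      -- For two points of E and a third one in the coset of their sum, `aligned` puts the defect g
      -- into one of their groups, hence into U.
      ... | no ∉Z with rep ∉Z
      ... | s , xs , fs = d ⊕ e ⊕ g , U-⊕ (U-⊕ Ud Ue) (Ug (aligned p q fs xs refl))
                   , inj₁ (fs ◂ ⊕! (x ∷ y ∷ d ∷ e ∷ s ∷ []) v4
                             (v0 :+ v1 :+ (v2 :+ v3 :+ (v0 :+ v2 :+ (v1 :+ v3) :+ v4))))
        where
        g = x ⊕ d ⊕ (y ⊕ e) ⊕ s
        Ug : _ → U g
        Ug (inj₁ r)        = D⊆U (f⇒∉Z p) r
        Ug (inj₂ (inj₁ r)) = D⊆U (f⇒∉Z q) r
        Ug (inj₂ (inj₂ r)) = D⊆U (f⇒∉Z fs) r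
    f-false : ∀ {v} → ¬ Y v → f v ≡ false
    f-false {v} ¬p = ¬true⇒false λ q → ¬p (0ᵛ , U-0 , inj₁ (q ◂ sym (⊕-identityʳ v)))
    all-Y : ∀ v → Y v
    -- Y contains E, so `f` vanishes outside Y and invariance is automatic.
    all-Y = prime-dec prime Y? Y-sub
      (λ x v ¬Yx Yv → trans
        (f-false λ q → ¬Yx (Y-≡ (⊕-cancelʳ x v) (Subspace.⊕∈ Y-sub q Yv)))
        (sym (f-false ¬Yx)))
      x₀ (0ᵛ , U-0 , inj₁ (fx₀ ◂ sym (⊕-identityʳ x₀))) λ { refl → x₀∉Z Z-0 }
    finish : Y e → U e
    finish (d , Ud , inj₁ p)    = clash p (Z-false (Z-⊕ Ze (U⊆Z Ud)))
    finish (d , Ud , inj₂ refl) = Ud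

  escapes : {U : V n → Set} → (∀ x → Dec (U x)) → Subspace U → (∀ {e} → U e → Z e) →
    ∀ {e} → Z e → ¬ U e → ∃[ y ] ∃[ c ] ¬ Z y × D y c × ¬ U c
  escapes U? U-sub U⊆Z Ze ¬Ue
    with any? (λ y → any? λ c → ¬? (Z? y) ×-dec (D? y c ×-dec ¬? (U? c)))
  ... | yes (y , c , p) = y , c , p
  ... | no none = ⊥-elim (¬Ue (spanned U? U-sub U⊆Z
    (λ {x} {e} x∉ p → decidable-stable (U? e) λ ¬q → none (x , e , x∉ , p , ¬q)) Ze))

  -- D x ∩ D y has index at most 2 in D x. Otherwise the stabiliser X of the set F of
  -- points whose group contains a and b is subordinate to all points outside X.
  module Gap {a b l} (l∉ : ¬ Z l) (¬la : ¬ D l a) (¬lb : ¬ D l b) (¬lab : ¬ D l (a ⊕ b)) where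

    F : V n → Set
    F x = ¬ Z x × D x a × D x b

    F-stable : Stable F
    F-stable = record
      { F?   = λ x → ¬? (Z? x) ×-dec (D? x a ×-dec D? x b)
      ; resp = λ { p (x∉ , xa , xb) → (λ Zy → x∉ (coset-Z (coset-sym p) Zy)) , D-shift p xa , D-shift p xb }
      ; F⇒∉Z = proj₁ }

    open Stable F-stable
    open Stabiliser F-stable

    -- D l misses a, b and a ⊕ b, so `OneOfThree` forbids D m to lose a; then `TwoOfThree` gives D k
    -- = D m.
    full-line : ∀ {k m} → F k → k ⊕ l ≡ m → F m
    full-line {k} {m} (k∉ , ka , kb) line with D? m a
    ... | yes ma = line-separates line ka ¬la , ma , x⊆y kb
      where open TwoOfThree (line-rot line) l∉ ka ma ¬la
    ... | no ¬ma with OneOfThree.x→w (line-rot line) k∉ (line-separates line ka ¬la) ka ¬ma ¬la kb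
    ... | inj₁ lb  = ⊥-elim (¬lb lb)
    ... | inj₂ lba = ⊥-elim (¬lab (lba ◂ᴰ ⊕-comm b a))

    Xl : X l
    Xl = (λ { (_ , la , _) → ¬la la }) , λ k Fk → full-line Fk refl

    missing : ∀ {u} → ¬ F u → ¬ Z u → ∃[ e ] ¬ D u e × (∀ {k} → F k → D k e)
    missing {u} ¬Fu u∉ with D? u a
    ... | no ¬p = a , ¬p , λ Fk → proj₁ (proj₂ Fk)
    ... | yes p = b , (λ q → ¬Fu (u∉ , p , q)) , λ Fk → proj₂ (proj₂ Fk)

    ⊆-F : ∀ {u v} → ¬ Z v → (∀ {e} → D u e → D v e) → F u → F v
    ⊆-F v∉ u⊆v (_ , ua , ub) = v∉ , u⊆v ua , u⊆v ub

    same-on : ∀ {k u v} → F k → ¬ F u → ¬ Z u → ¬ Z v → k ⊕ u ≡ v → ∀ {e} → D k e → D u e → D v e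
    same-on {k} {u} {v} Fk ¬Fu u∉ v∉ line {e} ke ue = decidable-stable (D? v e) λ ¬ve →
      ¬Fu (⊆-F u∉ (TwoOfThree.x⊆y line v∉ ke ue ¬ve) Fk)

    -- In the span of k, u, w in V/Z, the element ℓ (a or b) lies in D k and D (k ⊕ w) but not in D
    -- w. Hence D k = D (k ⊕ w) contains D w, and k and k ⊕ w link u with u ⊕ w.
    module _ {w} (fw : f w ≡ true) (Xw : X w) {k u} (Fk : F k) (¬Fku : ¬ F (k ⊕ u)) (¬Xu : ¬ X u) (¬Fu : ¬ F u) where

      w∉ : ¬ Z w
      w∉ = f⇒∉Z fw

      uw ku kw kuw : V n
      uw  = u ⊕ w
      ku  = k ⊕ u
      kw  = k ⊕ w
      kuw = k ⊕ uw

      Fkw : F kw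
      Fkw = proj₂ Xw k Fk

      ¬Fuw : ¬ F uw
      ¬Fuw p = ¬Fu (X-F Xw p)

      ¬Fkuw : ¬ F kuw
      ¬Fkuw p = ¬Fku (X-F Xw (F-≡ (sym (⊕-assoc k u w)) p))

      u∉ : ¬ Z u
      u∉ p = ¬Xu (Z⊆X p)

      uw∉ : ¬ Z uw
      uw∉ p = ¬Xu (X-cancel Xw (Z⊆X p))

      ku∉ : ¬ Z ku
      ku∉ p = ¬Fu (resp p Fk)

      kuw∉ : ¬ Z kuw
      kuw∉ p = ¬Fuw (resp p Fk)

      ℓ : V n
      ℓ = proj₁ (missing (proj₁ Xw) w∉)

      ¬wℓ : ¬ D w ℓ
      ¬wℓ = proj₁ (proj₂ (missing (proj₁ Xw) w∉))

      F-ℓ : ∀ {k} → F k → D k ℓ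
      F-ℓ = proj₂ (proj₂ (missing (proj₁ Xw) w∉))

      module K = TwoOfThree {x = k} {y = kw} (⊕-cancelˡ k w) w∉ (F-ℓ Fk) (F-ℓ Fkw) ¬wℓ

      kw⊕ku≡uw : kw ⊕ ku ≡ uw
      kw⊕ku≡uw = ⊕! (k ∷ u ∷ w ∷ []) (v0 :+ v2 :+ (v0 :+ v1)) (v1 :+ v2)

      kw⊕kuw≡u : kw ⊕ kuw ≡ u
      kw⊕kuw≡u = ⊕! (k ∷ u ∷ w ∷ []) (v0 :+ v2 :+ (v0 :+ (v1 :+ v2))) v1

      -- The route from u to u ⊕ w passes through k ⊕ u; both steps add a point of F.
      u→uw : ∀ {e} → D k e → D u e → D uw e
      u→uw ke ue = same-on Fkw ¬Fku ku∉ uw∉ kw⊕ku≡uw (K.x⊆y ke)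
        (same-on Fk ¬Fu u∉ ku∉ refl ke ue)

      uw→u : ∀ {e} → D k e → D uw e → D u e
      uw→u ke uwe = same-on Fkw ¬Fkuw kuw∉ u∉ kw⊕kuw≡u (K.x⊆y ke)
        (same-on Fk ¬Fuw uw∉ kuw∉ refl ke uwe)

      module _ (none : ∀ {e} → D u e → D uw e → D w e) where

        ¬uℓ : ¬ D u ℓ
        ¬uℓ p = ¬wℓ (none p (u→uw (F-ℓ Fk) p))

        ¬uwℓ : ¬ D uw ℓ
        ¬uwℓ p = ¬wℓ (none (uw→u (F-ℓ Fk) p) p)

        w⊆u : ∀ {e} → D w e → D u e
        w⊆u {e} we = decidable-stable (D? u e) λ ¬ue →
          let ke  = K.w⊆x we
              ¬kue = λ kue → ¬ue (same-on Fk ¬Fku ku∉ u∉ (⊕-cancelˡ k u) ke kue)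
          in case (OneOfThree.x→w {x = k} {y = ku} (⊕-cancelˡ k u) (proj₁ Fk) ku∉ ke ¬kue ¬ue (F-ℓ Fk))
          where
          case : D u ℓ ⊎ D u (ℓ ⊕ e) → ⊥
          case (inj₁ p) = ¬uℓ p
          case (inj₂ p) = ¬wℓ (D-cancelʳ (none p (u→uw (D-⊕ (F-ℓ Fk) (K.w⊆x we)) p)) we)

        -- Stated for free u, uw, ku so that it gives both inclusions. As ℓ lies in D k and D kw but
        -- not in the groups of u, ku, uw, each of the two lines passes e on up to ℓ, and two
        -- corrections by ℓ cancel.
        u⊆uw : ∀ {u uw ku} → ¬ F u → ¬ F ku → ¬ Z u → ¬ Z uw → ¬ Z ku → k ⊕ u ≡ ku → kw ⊕ ku ≡ uw →
          (∀ {e} → D k e → D u e → D uw e) → ¬ D u ℓ → ¬ D uw ℓ → ∀ {e} → D u e → D uw e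
        u⊆uw {u} {uw} {ku} ¬Fu ¬Fku u∉ uw∉ ku∉ ℓ₁ ℓ₂ u→uw ¬uℓ ¬uwℓ {e} ue =
          decidable-stable (D? uw e) contra
          where
          ¬kuℓ : ¬ D ku ℓ
          ¬kuℓ p = ¬uℓ (same-on Fk ¬Fku ku∉ u∉ (line-rot ℓ₁) (F-ℓ Fk) p)
          contra : ¬ ¬ D uw e
          contra ¬uwe with OneOfThree.y→w ℓ₁ (proj₁ Fk) u∉ (F-ℓ Fk) ¬uℓ ¬kuℓ ue
          ... | inj₁ kue = ¬Fu (⊆-F u∉ (TwoOfThree.w⊆x (line-rot′ ℓ₁) (proj₁ Fk) ue kue (λ ke → ¬uwe (u→uw ke ue))) Fk)
          ... | inj₂ kueℓ with OneOfThree.y→w ℓ₂ (proj₁ Fkw) ku∉ (F-ℓ Fkw) ¬kuℓ ¬uwℓ kueℓ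
          ... | inj₂ p = ¬uwe (p ◂ᴰ ⊕-cancelʳ e ℓ)
          ... | inj₁ p = ¬kuℓ (TwoOfThree.w⊆x (line-rot′ ℓ₂) (proj₁ Fkw) kueℓ p
                  (λ q → ¬uwe (u→uw (D-cancelʳ (K.y⊆x q) (F-ℓ Fk)) ue)) (F-ℓ Fkw))

      invariant : f uw ≡ f u
      invariant with any? (λ e → D? u e ×-dec (D? uw e ×-dec ¬? (D? w e)))
      ... | yes (e , p , q , ¬r) = translated p q refl fw (moved ¬r (inZ p) coset-refl fw)
      ... | no no-e = translated-flat refl fw u∉ uw∉ (w⊆u none)
              (u⊆uw none ¬Fu ¬Fku u∉ uw∉ ku∉ refl kw⊕ku≡uw u→uw (¬uℓ none) (¬uwℓ none))
              (u⊆uw none ¬Fuw ¬Fkuw uw∉ u∉ kuw∉ refl kw⊕kuw≡u uw→u (¬uwℓ none) (¬uℓ none))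
        where
        none : ∀ {e} → D u e → D uw e → D w e
        none {e} p q = decidable-stable (D? w e) λ ¬r → no-e (e , p , q , ¬r)

    F-empty : ∀ {k} → ¬ F k
    F-empty Fk = trivial Fk Xl l∉ λ {w} {u} fw Xw ¬Xu → sub fw Xw ¬Xu (outside ¬Xu)
      where
      sub : ∀ {w u} → f w ≡ true → X w → ¬ X u → F u ⊎ ∃[ k ] F k × ¬ F (k ⊕ u) → f (u ⊕ w) ≡ f u
      sub {w} {u} fw Xw ¬Xu (inj₁ Fu) = let (e , ¬we , F-e) = missing (proj₁ Xw) (f⇒∉Z fw) in
        translated (F-e Fu) (F-e (proj₂ Xw u Fu)) refl fw (moved ¬we (inZ (F-e Fu)) coset-refl fw)
      sub {w} {u} fw Xw ¬Xu (inj₂ (k , Fk , ¬Fku)) with F? u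
      ... | yes Fu = sub fw Xw ¬Xu (inj₁ Fu)
      ... | no ¬Fu = invariant fw Xw Fk ¬Fku ¬Xu ¬Fu

  close : ∀ {x y a b} → ¬ Z x → ¬ Z y → D x a → D x b → ¬ D y a → ¬ D y b → D y (a ⊕ b)
  close {y = y} {a} {b} x∉ y∉ xa xb ¬ya ¬yb =
    decidable-stable (D? y (a ⊕ b)) λ ¬yab → Gap.F-empty y∉ ¬ya ¬yb ¬yab (x∉ , xa , xb)

  -- All D x have index at most 2 in Z, respectively order at most 2.
  LargeStabilisers SmallStabilisers : Set
  LargeStabilisers = ∀ {x d e} → ¬ Z x → Z d → Z e → ¬ D x d → ¬ D x e → D x (d ⊕ e)
  SmallStabilisers = ∀ {x d e} → ¬ Z x → D x d → D x e → d ≢ 0ᵛ → e ≢ 0ᵛ → d ≡ e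

  -- If D x has index above 2, some groups D y and D w contain c and c′ with c, c′, c ⊕ c′ outside D
  -- x. By `close`, no group contains both c and c′. This collapses D y to {0, c} and D w to {0,
  -- c′}; a group with two distinct nonzero elements would, again by `close`, contain both c and c′.
  large-or-small : LargeStabilisers ⊎ SmallStabilisers
  large-or-small with any? (λ x → any? λ d → any? λ e → ¬? (Z? x) ×-dec (Z? d ×-dec (Z? e ×-dec
                        (¬? (D? x d) ×-dec (¬? (D? x e) ×-dec ¬? (D? x (d ⊕ e)))))))
  ... | no none = inj₁ λ {x} {d} {e} x∉ Zd Ze p q →
          decidable-stable (D? x (d ⊕ e)) λ r → none (x , d , e , x∉ , Zd , Ze , p , q , r)
  ... | yes (x , d , e , x∉ , Zd , Ze , ¬xd , ¬xe , ¬xde)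
      with escapes (D? x) (record { 0∈ = D-0 ; ⊕∈ = D-⊕ }) inZ Zd ¬xd
  ... | y , c , y∉ , yc , ¬xc
      with escapes {U = λ u → D x u ⊎ D x (u ⊕ c)} (λ u → D? x u ⊎-dec D? x (u ⊕ c)) coset-sub coset⊆Z
             Zd∪Ze ¬Ud∪Ue
    where
    Zc : Z c
    Zc = inZ yc
    coset⊆Z : ∀ {u} → D x u ⊎ D x (u ⊕ c) → Z u
    coset⊆Z (inj₁ p) = inZ p
    coset⊆Z {u} (inj₂ p) = Z-⊕ (inZ p) Zc ◂ᶻ ⊕-cancelʳ u c
    coset-sub : Subspace (λ u → D x u ⊎ D x (u ⊕ c))
    coset-sub = record { 0∈ = inj₁ D-0 ; ⊕∈ = add }
      where
      add : ∀ {u v} → D x u ⊎ D x (u ⊕ c) → D x v ⊎ D x (v ⊕ c) → D x (u ⊕ v) ⊎ D x (u ⊕ v ⊕ c)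
      add (inj₁ p) (inj₁ q) = inj₁ (D-⊕ p q)
      add {u} {v} (inj₁ p) (inj₂ q) = inj₂ (D-⊕ p q ◂ᴰ sym (⊕-assoc u v c))
      add {u} {v} (inj₂ p) (inj₁ q) = inj₂ (D-⊕ p q ◂ᴰ ⊕! (u ∷ v ∷ c ∷ []) (v0 :+ v2 :+ v1) (v0 :+ v1 :+ v2))
      add {u} {v} (inj₂ p) (inj₂ q) = inj₁ (D-⊕ p q ◂ᴰ ⊕! (u ∷ v ∷ c ∷ []) (v0 :+ v2 :+ (v1 :+ v2)) (v0 :+ v1))
    -- If d ⊕ c and e ⊕ c were both in D x, so would be d ⊕ e.
    one-fails : ∃[ g ] Z g × ¬ (D x g ⊎ D x (g ⊕ c))
    one-fails with D? x (d ⊕ c)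
    ... | no ¬p = d , Zd , [ ¬xd , ¬p ]
    ... | yes p = e , Ze , [ ¬xe , (λ q → ¬xde (D-⊕ p q ◂ᴰ ⊕! (d ∷ e ∷ c ∷ []) (v0 :+ v2 :+ (v1 :+ v2)) (v0 :+ v1))) ]
    Zd∪Ze = proj₁ (proj₂ one-fails)
    ¬Ud∪Ue = proj₂ (proj₂ one-fails)
  ... | w , c′ , w∉ , wc′ , ¬U = inj₂ small
    where
    ¬xc′ : ¬ D x c′
    ¬xc′ p = ¬U (inj₁ p)
    ¬xcc′ : ¬ D x (c ⊕ c′)
    ¬xcc′ p = ¬U (inj₂ (p ◂ᴰ ⊕-comm c c′))
    no-both : ∀ {v} → ¬ Z v → D v c → D v c′ → ⊥
    no-both v∉ p q = ¬xcc′ (close v∉ x∉ p q ¬xc ¬xc′)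
    y∩w⊆x : ∀ {g} → D y g → D w g → D x g
    y∩w⊆x {g} yg wg = decidable-stable (D? x g) λ ¬xg →
      ¬xcc′ (D-⊕ (close y∉ x∉ yc yg ¬xc ¬xg) (close w∉ x∉ wc′ wg ¬xc′ ¬xg)
        ◂ᴰ ⊕! (c ∷ c′ ∷ g ∷ []) (v0 :+ v2 :+ (v1 :+ v2)) (v0 :+ v1))
    x∩y⊆w : ∀ {g} → D x g → D y g → D w g
    x∩y⊆w {g} xg yg = decidable-stable (D? w g) λ ¬wg →
      ¬xc (D-cancelˡ (y∩w⊆x (D-⊕ yg yc) (close y∉ w∉ yg yc ¬wg (λ wc → ¬xc (y∩w⊆x yc wc)))) xg)
    -- A common element g of D x, D y and D w lies in every D v: otherwise D v would meet
    -- both {c, c + g} and {c′, c′ + g}.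
    x∩y≡0 : ∀ {g} → D x g → D y g → g ≡ 0ᵛ
    x∩y≡0 {g} xg yg = decidable-stable (g ≟ᵛ 0ᵛ) λ g≢0 →
      let (v , v∉ , ¬vg) = Z-moved (inZ xg) g≢0 in
      contra v∉ ¬vg (either y∉ yc yg v∉ ¬vg) (either w∉ wc′ (x∩y⊆w xg yg) v∉ ¬vg)
      where
      either : ∀ {y c v} → ¬ Z y → D y c → D y g → ¬ Z v → ¬ D v g → D v c ⊎ D v (c ⊕ g)
      either {y} {c} {v} y∉ yc yg v∉ ¬vg with D? v c
      ... | yes p = inj₁ p
      ... | no ¬p = inj₂ (close y∉ v∉ yc yg ¬p ¬vg)
      ¬xcg : ∀ {c} → ¬ D x c → ¬ D x (c ⊕ g)
      ¬xcg ¬xc p = ¬xc (D-cancelʳ p xg)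
      contra : ∀ {v} → ¬ Z v → ¬ D v g → D v c ⊎ D v (c ⊕ g) → D v c′ ⊎ D v (c′ ⊕ g) → ⊥
      contra v∉ ¬vg (inj₁ p) (inj₁ q) = no-both v∉ p q
      contra v∉ ¬vg (inj₁ p) (inj₂ q) = ¬xcc′ (D-cancelʳ (close v∉ x∉ p q ¬xc (¬xcg ¬xc′) ◂ᴰ sym (⊕-assoc c c′ g)) xg)
      contra v∉ ¬vg (inj₂ p) (inj₁ q) = ¬xcc′ (D-cancelʳ (close v∉ x∉ p q (¬xcg ¬xc) ¬xc′
        ◂ᴰ ⊕! (c ∷ c′ ∷ g ∷ []) (v0 :+ v2 :+ v1) (v0 :+ v1 :+ v2)) xg)
      contra v∉ ¬vg (inj₂ p) (inj₂ q) = ¬xcc′ (close v∉ x∉ p q (¬xcg ¬xc) (¬xcg ¬xc′)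
        ◂ᴰ ⊕! (c ∷ c′ ∷ g ∷ []) (v0 :+ v2 :+ (v1 :+ v2)) (v0 :+ v1))
    y∩w≡0 : ∀ {g} → D y g → D w g → g ≡ 0ᵛ
    y∩w≡0 yg wg = x∩y≡0 (y∩w⊆x yg wg) yg
    y≡0c : ∀ {g} → D y g → g ≡ 0ᵛ ⊎ g ≡ c
    y≡0c {g} yg with g ≟ᵛ 0ᵛ
    ... | yes p = inj₁ p
    ... | no ¬p = inj₂ (≡-from-⊕ g c (x∩y≡0 (close y∉ x∉ yg yc (λ xg → ¬p (x∩y≡0 xg yg)) ¬xc) (D-⊕ yg yc)))
    w≡0c′ : ∀ {g} → D w g → g ≡ 0ᵛ ⊎ g ≡ c′
    w≡0c′ {g} wg with g ≟ᵛ 0ᵛ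
    ... | yes p = inj₁ p
    ... | no ¬p = inj₂ (≡-from-⊕ g c′ (y∩w≡0 (close w∉ y∉ wg wc′ (λ yg → ¬p (y∩w≡0 yg wg))
                    (λ yc′ → ¬xc′ (y∩w⊆x yc′ wc′))) (D-⊕ wg wc′)))
    meets : ∀ {v d e c y} → ¬ Z v → ¬ Z y → (∀ {g} → D y g → g ≡ 0ᵛ ⊎ g ≡ c) →
      D v d → D v e → d ≢ 0ᵛ → e ≢ 0ᵛ → d ≢ e → D v c
    meets {v} {d} {e} {c} {y} v∉ y∉ y≡ vd ve d≢0 e≢0 d≢e with D? y d | D? y e
    ... | yes p | _     = [ (λ q → contradiction q d≢0) , (λ { refl → vd }) ] (y≡ p)
    ... | no _  | yes p = [ (λ q → contradiction q e≢0) , (λ { refl → ve }) ] (y≡ p)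
    ... | no p  | no q  = [ (λ r → contradiction (≡-from-⊕ d e r) d≢e) , (λ { refl → D-⊕ vd ve }) ]
                            (y≡ (close v∉ y∉ vd ve p q))
    small : SmallStabilisers
    small {v} {d} {e} v∉ vd ve d≢0 e≢0 = decidable-stable (d ≟ᵛ e) λ d≢e →
      no-both v∉ (meets v∉ y∉ y≡0c vd ve d≢0 e≢0 d≢e) (meets v∉ w∉ w≡0c′ vd ve d≢0 e≢0 d≢e)

  -- `TwoOfThree` keeps d and e out of D s, and `OneOfThree` then leaves only d ⊕ e.
  third-sum : ∀ {x v s d e} → x ⊕ v ≡ s → ¬ Z x → ¬ Z v → D x e → ¬ D v e → D v d → ¬ D x d → D s (d ⊕ e)
  third-sum {s = s} {d} {e} line x∉ v∉ xe ¬ve vd ¬xd = pick (OneOfThree.y→w line x∉ v∉ xe ¬ve ¬se vd)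
    where
    ¬se : ¬ D s e
    ¬se se = ¬xd (TwoOfThree.w⊆x (line-rot line) v∉ xe se ¬ve vd)
    ¬sd : ¬ D s d
    ¬sd sd = ¬ve (TwoOfThree.w⊆x (line-rot (line-swap line)) x∉ vd sd ¬xd xe)
    pick : _ → _
    pick (inj₁ sd) = ⊥-elim (¬sd sd)
    pick (inj₂ p)  = p

  -- On the line x ⊕ v, y ⊕ v, x ⊕ y exactly the first two groups contain d ⊕ e,
  -- so they contain the third group and hence e.
  no-equal-line : ∀ {x y w v d e} → x ⊕ y ≡ w → ¬ Z x → ¬ Z y → ¬ Z w → ¬ Z v →
    D x e → D y e → D w e → ¬ D x d → ¬ D y d → ¬ D w d → D v d → ¬ D v e → ⊥
  no-equal-line {x} {y} {v = v} {d} {e} refl x∉ y∉ w∉ v∉ xe ye we ¬xd ¬yd ¬wd vd ¬ve =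
    ¬wd-sum (TwoOfThree.w⊆x {x = x ⊕ v} {y = y ⊕ v} line w∉ xv yv ¬wde we)
    where
    line : x ⊕ v ⊕ (y ⊕ v) ≡ x ⊕ y
    line = ⊕! (x ∷ y ∷ v ∷ []) (v0 :+ v2 :+ (v1 :+ v2)) (v0 :+ v1)
    xv : D (x ⊕ v) (d ⊕ e)
    xv = third-sum refl x∉ v∉ xe ¬ve vd ¬xd
    yv : D (y ⊕ v) (d ⊕ e)
    yv = third-sum refl y∉ v∉ ye ¬ve vd ¬yd
    ¬wde : ¬ D (x ⊕ y) (d ⊕ e)
    ¬wde p = ¬wd (D-cancelʳ p we)
    ¬wd-sum : ¬ D (x ⊕ v) e
    ¬wd-sum p = ¬xd (TwoOfThree.w⊆x {x = x} {y = x ⊕ v} (⊕-cancelˡ x v) v∉ xe p ¬ve vd)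

-- Groups of order at most two: PG-sums

module SmallCase {n} (C : Configuration n) (small : Cosets.SmallStabilisers C) where

  open Cosets C

  private variable
    d e u v w x y z : V n

  ⊕≢0 : d ≢ e → d ⊕ e ≢ 0ᵛ
  ⊕≢0 {d} {e} d≢e p = d≢e (≡-from-⊕ d e p)

  -- The groups generate Z, and `a₀`, `b₀` make Z larger than {0, z}.
  other-group : ∀ z → Z z → ∃[ v ] ∃[ d ] ¬ Z v × D v d × d ≢ 0ᵛ × d ≢ z
  other-group z Zz = let (v , d , v∉ , p , q) = escape in v , d , v∉ , p , (λ r → q (inj₁ r)) , (λ r → q (inj₂ r))
    where
    U : V n → Set
    U u = u ≡ 0ᵛ ⊎ u ≡ z
    U-sub : Subspace U
    U-sub = record { 0∈ = inj₁ refl ; ⊕∈ = add }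
      where
      add : U x → U y → U (x ⊕ y)
      add (inj₁ refl) (inj₁ refl) = inj₁ (⊕-same _)
      add (inj₁ refl) (inj₂ refl) = inj₂ (⊕-identityˡ _)
      add (inj₂ refl) (inj₁ refl) = inj₂ (⊕-identityʳ _)
      add (inj₂ refl) (inj₂ refl) = inj₁ (⊕-same _)
    U⊆Z : U e → Z e
    U⊆Z (inj₁ refl) = Subspace.0∈ Z-sub
    U⊆Z (inj₂ refl) = Zz
    escape : ∃[ v ] ∃[ d ] ¬ Z v × D v d × ¬ U d
    escape with a₀ ≟ᵛ z
    ... | no a₀≢z  = escapes (λ u → (u ≟ᵛ 0ᵛ) ⊎-dec (u ≟ᵛ z)) U-sub U⊆Z Za₀ [ a₀≢0 , a₀≢z ]
    ... | yes refl = escapes (λ u → (u ≟ᵛ 0ᵛ) ⊎-dec (u ≟ᵛ z)) U-sub U⊆Z Zb₀ [ b₀≢0 , (λ p → a₀≢b₀ (sym p)) ]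

  F : V n → Set
  F x = ¬ Z x × ∃[ e ] e ≢ 0ᵛ × D x e

  F-stable : Stable F
  F-stable = record
    { F?   = λ x → ¬? (Z? x) ×-dec any? λ e → ¬? (e ≟ᵛ 0ᵛ) ×-dec D? x e
    ; resp = λ { p (x∉ , e , e≢0 , q) → (λ Zy → x∉ (coset-Z (coset-sym p) Zy)) , e , e≢0 , D-shift p q }
    ; F⇒∉Z = proj₁ }

  open Stable F-stable
  open Stabiliser F-stable

  trivial-group : ¬ Z x → ¬ F x → D x e → e ≡ 0ᵛ
  trivial-group {e = e} x∉ ¬Fx p = decidable-stable (e ≟ᵛ 0ᵛ) λ e≢0 → ¬Fx (x∉ , e , e≢0 , p)

  -- A nonzero e in D (v ⊕ w) different from d would survive in D w as e or e ⊕ d, both nonzero.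
  inherit : ¬ Z v → ¬ Z w → ¬ F w → D v d → d ≢ 0ᵛ → F (v ⊕ w) → D (v ⊕ w) d
  inherit {v} {w} {d} v∉ w∉ ¬Fw vd d≢0 (vw∉ , e , e≢0 , p) =
    decidable-stable (D? (v ⊕ w) d) λ ¬q →
      [ (λ r → e≢0 (trivial-group w∉ ¬Fw r))
      , (λ r → ⊕≢0 (λ { refl → ¬q p }) (trivial-group w∉ ¬Fw r)) ]
      (OneOfThree.y→w {x = v} {y = v ⊕ w} (⊕-cancelˡ v w) v∉ vw∉ vd ¬q
         (λ r → d≢0 (trivial-group w∉ ¬Fw r)) p)

  module Repeated {x y z} (x∉ : ¬ Z x) (y∉ : ¬ Z y) (xz : D x z) (yz : D y z) (z≢0 : z ≢ 0ᵛ)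
    (w∉ : ¬ Z (x ⊕ y)) (¬Fw : ¬ F (x ⊕ y)) where

    -- The way from k to k ⊕ (x ⊕ y) leads through y ⊕ k, whose group contains d ⊕ z by `third-sum`;
    -- adding x preserves this element up to z, so it stays nonzero.
    F-add : ∀ {k d} → ¬ Z k → D k d → d ≢ 0ᵛ → d ≢ z → F (k ⊕ (x ⊕ y))
    F-add {k} {d} k∉ kd d≢0 d≢z = decidable-stable (F? _) λ ¬Fkw →
      let ¬kz = λ kz → d≢z (small k∉ kd kz d≢0 z≢0)
          ¬yd = λ yd → d≢z (small y∉ yd yz d≢0 z≢0)
          p : D (y ⊕ k) (d ⊕ z)
          p = third-sum refl y∉ k∉ yz ¬kz kd ¬yd
          yk∉ = D-separates yz ¬kz
          kw∉ : ¬ Z (k ⊕ (x ⊕ y))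
          kw∉ = λ r → ¬Fw (resp r (k∉ , d , d≢0 , kd))
          ¬ykz : ¬ D (y ⊕ k) z
          ¬ykz = λ q → d≢0 (trivial-sum (small yk∉ p q (⊕≢0 d≢z) z≢0))
          line : x ⊕ (y ⊕ k) ≡ k ⊕ (x ⊕ y)
          line = ⊕! (x ∷ y ∷ k ∷ []) (v0 :+ (v1 :+ v2)) (v2 :+ (v0 :+ v1))
      in [ (λ r → ¬Fkw (kw∉ , _ , ⊕≢0 d≢z , r))
         , (λ r → ¬Fkw (kw∉ , _ , (λ s → d≢0 (trans (sym (⊕-cancelʳ d z)) s)) , r)) ]
         (OneOfThree.y→w line x∉ yk∉ xz ¬ykz (λ r → ¬Fkw (kw∉ , z , z≢0 , r)) p)
      where
      trivial-sum : ∀ {d} → d ⊕ z ≡ z → d ≡ 0ᵛ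
      trivial-sum {d} q = trans (sym (⊕-cancelʳ d z)) (trans (cong (_⊕ z) q) (⊕-same z))

  -- `F-add` does not reach groups equal to {0, z}. For these, x and y give way to v and v ⊕ (x ⊕
  -- y), which share an element e other than z.
  F-preserved : ¬ Z x → ¬ Z y → D x z → D y z → z ≢ 0ᵛ → ¬ Z (x ⊕ y) → ¬ F (x ⊕ y) →
    ∀ k → F k → F (k ⊕ (x ⊕ y))
  F-preserved {x} {y} {z} x∉ y∉ xz yz z≢0 w∉ ¬Fw k (k∉ , d , d≢0 , kd) with d ≟ᵛ z
  ... | no d≢z   = Repeated.F-add x∉ y∉ xz yz z≢0 w∉ ¬Fw k∉ kd d≢0 d≢z
  ... | yes refl with other-group z (D.inZ xz)
  ... | v , e , v∉ , ve , e≢0 , e≢z =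
    let Fvw = Repeated.F-add x∉ y∉ xz yz z≢0 w∉ ¬Fw v∉ ve e≢0 e≢z
        back = ⊕-cancelˡ v (x ⊕ y)
    in subst (λ t → F (k ⊕ t)) back
         (Repeated.F-add v∉ (proj₁ Fvw) ve (inherit v∉ w∉ ¬Fw ve e≢0 Fvw) e≢0
           (subst (λ t → ¬ Z t) (sym back) w∉) (subst (λ t → ¬ F t) (sym back) ¬Fw)
           k∉ kd d≢0 (λ p → e≢z (sym p)))

  -- If z lies in the third group too, `no-equal-line` applies. Otherwise the third group is
  -- trivial, x ⊕ y stabilises F, and the stabiliser of F would yield a decomposer.
  groups-distinct : ¬ Z x → ¬ Z y → ¬ Z (x ⊕ y) → z ≢ 0ᵛ → D x z → D y z → ⊥
  groups-distinct {x} {y} {z} x∉ y∉ w∉ z≢0 xz yz with D? (x ⊕ y) z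
  ... | yes wz with other-group z (D.inZ xz)
  ... | v , d , v∉ , vd , d≢0 , d≢z = no-equal-line refl x∉ y∉ w∉ v∉ xz yz wz
    (λ p → d≢z (small x∉ p xz d≢0 z≢0)) (λ p → d≢z (small y∉ p yz d≢0 z≢0))
    (λ p → d≢z (small w∉ p wz d≢0 z≢0)) vd (λ p → d≢z (small v∉ vd p d≢0 z≢0))
  groups-distinct {x} {y} {z} x∉ y∉ w∉ z≢0 xz yz | no ¬wz =
    trivial (x∉ , z , z≢0 , xz) (¬Fw , F-preserved x∉ y∉ xz yz z≢0 w∉ ¬Fw) w∉ sub
    where
    ¬Fw : ¬ F (x ⊕ y)
    ¬Fw (_ , e , e≢0 , p) with small x∉ (TwoOfThree.w⊆x refl w∉ xz yz ¬wz p) xz e≢0 z≢0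
    ... | refl = ¬wz p
    sub : ∀ {w u} → f w ≡ true → X w → ¬ X u → f (u ⊕ w) ≡ f u
    sub {w} {u} fw Xw ¬Xu with F? u
    ... | yes Fu@(u∉ , e , e≢0 , ue) =
      translated ue (inherit u∉ (f⇒∉Z fw) (proj₁ Xw) ue e≢0 (proj₂ Xw u Fu)) refl fw
        (moved (λ p → e≢0 (trivial-group (f⇒∉Z fw) (proj₁ Xw) p)) (D.inZ ue) coset-refl fw)
    ... | no ¬Fu = translated-flat refl fw u∉ uw∉
        (λ p → zero-group (trivial-group (f⇒∉Z fw) (proj₁ Xw) p))
        (λ p → zero-group (trivial-group u∉ ¬Fu p))
        (λ p → zero-group (trivial-group uw∉ (λ q → ¬Fu (X-F Xw q)) p))
      where
      u∉ : ¬ Z u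
      u∉ p = ¬Xu (Z⊆X p)
      uw∉ : ¬ Z (u ⊕ w)
      uw∉ p = ¬Xu (X-cancel Xw (Z⊆X p))
      zero-group : ∀ {e v} → e ≡ 0ᵛ → D v e
      zero-group refl = D-0

  -- Points x, y of E are called adjacent if x ⊕ y lies in E.

  -- Of the partners y and y ⊕ z in E, x is adjacent to exactly one: both would make z common to D y
  -- and D (x ⊕ y), neither would contradict `third`.
  partner⇒ : f x ≡ true → f y ≡ true → ¬ Z (x ⊕ y) → D y z → z ≢ 0ᵛ →
    f (x ⊕ y) ≡ true → f (x ⊕ y ⊕ z) ≡ false
  partner⇒ {x} {y} fx fy w∉ yz z≢0 fw = ¬true⇒false λ p →
    groups-distinct (f⇒∉Z fy) w∉ (λ q → f⇒∉Z fx (subst Z (⊕! (x ∷ y ∷ []) (v1 :+ (v0 :+ v1)) v0) q))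
      z≢0 yz (D-intro fw (D.inZ yz) p)

  partner⇐ : f x ≡ true → f y ≡ true → ¬ Z (x ⊕ y) → D y z → z ≢ 0ᵛ →
    f (x ⊕ y) ≡ false → f (x ⊕ y ⊕ z) ≡ true
  partner⇐ {x} {y} {z} fx fy w∉ yz z≢0 fw =
    pick (OneOfThree.third {x = y} {y = x} (⊕-comm y x) (f⇒∉Z fy) (f⇒∉Z fx) yz ¬xz ¬wz coset-refl coset-refl fy fx)
    where
    ¬xz : ¬ D x z
    ¬xz p = groups-distinct (f⇒∉Z fx) (f⇒∉Z fy) w∉ z≢0 p yz
    ¬wz : ¬ D (x ⊕ y) z
    ¬wz p = groups-distinct (f⇒∉Z fy) w∉ (λ q → f⇒∉Z fx (subst Z (⊕! (x ∷ y ∷ []) (v1 :+ (v0 :+ v1)) v0) q)) z≢0 yz p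
    pick : ∃[ s ] (s ≡ y ⊕ x ⊎ s ≡ y ⊕ x ⊕ z) × f s ≡ true → f (x ⊕ y ⊕ z) ≡ true
    pick (_ , inj₁ refl , p) = clash (p ◂ ⊕-comm y x) fw
    pick (_ , inj₂ refl , p) = p ◂ cong (_⊕ z) (⊕-comm y x)

  -- `aligned` with a point s of E in the coset of x ⊕ y leaves a defect g that is 0 or a period of
  -- that coset.
  trivial-adjacent : f x ≡ true → f y ≡ true → ¬ Z (x ⊕ y) → ¬ F x → ¬ F y → f (x ⊕ y) ≡ true
  trivial-adjacent {x} {y} fx fy w∉ ¬Fx ¬Fy with rep w∉
  ... | s , xs , fs = case (aligned fx fy fs xs refl)
    where
    g = x ⊕ y ⊕ s
    s⊕g : s ⊕ g ≡ x ⊕ y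
    s⊕g = ⊕! (x ∷ y ∷ s ∷ []) (v2 :+ (v0 :+ v1 :+ v2)) (v0 :+ v1)
    s≡ : g ≡ 0ᵛ → f (x ⊕ y) ≡ true
    s≡ p = fs ◂ sym (≡-from-⊕ (x ⊕ y) s p)
    case : D x g ⊎ D y g ⊎ D s g → f (x ⊕ y) ≡ true
    case (inj₁ p)        = s≡ (trivial-group (f⇒∉Z fx) ¬Fx p)
    case (inj₂ (inj₁ p)) = s≡ (trivial-group (f⇒∉Z fy) ¬Fy p)
    case (inj₂ (inj₂ p)) = trans (D-apply p coset-refl) fs ◂ s⊕g

  module _ {x y w} (fx : f x ≡ true) (fy : f y ≡ true) (fw : f w ≡ true)
    (fxy : f (x ⊕ y) ≡ true) (fyw : f (y ⊕ w) ≡ true) where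

    -- Replacing a point by its partner flips its adjacencies, so z provides a claw in either case:
    -- x ⊕ z, y, y ⊕ w ⊕ x if the last point is in E, and x, w, y ⊕ w ⊕ x ⊕ z otherwise.
    no-gap : ∀ {z} → ¬ Z (x ⊕ w) → D x z → z ≢ 0ᵛ → f (x ⊕ w) ≡ true
    no-gap {z} xw∉ xz z≢0 with true? (f (x ⊕ w))
    ... | inj₁ p   = p
    ... | inj₂ fxw = ⊥-elim contra
      where
      Zz : Z z
      Zz = D.inZ xz
      ρ : Vec (V n) 4
      ρ = x ∷ y ∷ w ∷ z ∷ []
      f-xz : f (x ⊕ z) ≡ true
      f-xz = trans (D-apply xz coset-refl) fx
      ¬yz : ¬ D y z
      ¬yz p = groups-distinct (f⇒∉Z fx) (f⇒∉Z fy) (f⇒∉Z fxy) z≢0 xz p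
      ¬wz : ¬ D w z
      ¬wz p = groups-distinct (f⇒∉Z fx) (f⇒∉Z fw) xw∉ z≢0 xz p
      xyz : f (y ⊕ x ⊕ z) ≡ false
      xyz = partner⇒ fy fx (f⇒∉Z (fxy ◂ ⊕-comm x y)) xz z≢0 (fxy ◂ ⊕-comm x y)
      wz : f (w ⊕ z) ≡ false
      wz = moved ¬wz Zz coset-refl fw
      xyw∉ : ¬ Z (y ⊕ w ⊕ x)
      xyw∉ Zg with y ⊕ w ⊕ x ≟ᵛ 0ᵛ
      ... | yes g≡0 = clash (fy ◂ trans (⊕! ρ v1 ((v1 :+ v2 :+ v0) :+ (v0 :+ v2)))
                        (trans (cong (_⊕ (x ⊕ w)) g≡0) (⊕-identityˡ (x ⊕ w)))) fxw
      ... | no g≢0 = clash (fxy ◂ trans (⊕! ρ (v0 :+ v1) (v2 :+ (v1 :+ v2 :+ v0)))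
                       (cong (w ⊕_) (small (f⇒∉Z fx) (D-intro fx Zg
                         (fyw ◂ ⊕! ρ (v1 :+ v2) (v0 :+ (v1 :+ v2 :+ v0)))) xz g≢0 z≢0))) wz
      ywz : f (y ⊕ w ⊕ z) ≡ false
      ywz = moved (λ p → groups-distinct (f⇒∉Z fyw) (f⇒∉Z fx) xyw∉ z≢0 p xz) Zz coset-refl fyw
      contra : ⊥
      contra with true? (f (y ⊕ w ⊕ x))
      ... | inj₁ g = noClaw (x ⊕ z) y (y ⊕ w ⊕ x) f-xz fy g
        (xyz ◂ ⊕! ρ (v1 :+ v0 :+ v3) (v0 :+ v3 :+ v1))
        (ywz ◂ ⊕! ρ (v1 :+ v2 :+ v3) (v0 :+ v3 :+ (v1 :+ v2 :+ v0)))
        (fxw ◂ ⊕! ρ (v0 :+ v2) (v1 :+ (v1 :+ v2 :+ v0)))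
        (wz ◂ ⊕! ρ (v2 :+ v3) (v0 :+ v3 :+ v1 :+ (v1 :+ v2 :+ v0)))
      ... | inj₂ g = noClaw x w (y ⊕ w ⊕ x ⊕ z) fx fw (partner⇐ fyw fx xyw∉ xz z≢0 g)
        fxw
        (ywz ◂ ⊕! ρ (v1 :+ v2 :+ v3) (v0 :+ (v1 :+ v2 :+ v0 :+ v3)))
        (xyz ◂ ⊕! ρ (v1 :+ v0 :+ v3) (v2 :+ (v1 :+ v2 :+ v0 :+ v3)))
        (moved ¬yz Zz coset-refl fy ◂ ⊕! ρ (v1 :+ v3) (v0 :+ v2 :+ (v1 :+ v2 :+ v0 :+ v3)))

  adjacent-trans : ∀ {x y w} → f x ≡ true → f y ≡ true → f w ≡ true → f (x ⊕ y) ≡ true → f (y ⊕ w) ≡ true →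
    x ≢ w → f (x ⊕ w) ≡ true
  adjacent-trans {x} {y} {w} fx fy fw fxy fyw x≢w with Z? (x ⊕ w) | F? x | F? w
  -- Here x and w are partners, and y is adjacent to only one of them.
  ... | yes Zg | _ | _ = clash
    (fyw ◂ ⊕! (x ∷ y ∷ w ∷ []) (v1 :+ v2) (v1 :+ v0 :+ (v0 :+ v2)))
    (partner⇒ fy fx (f⇒∉Z fyx) (D-intro fx Zg (fw ◂ sym (⊕-cancelˡ x w))) (⊕≢0 x≢w) fyx)
    where
    fyx : f (y ⊕ x) ≡ true
    fyx = fxy ◂ ⊕-comm x y
  ... | no g∉ | yes (_ , z , z≢0 , xz) | _ = no-gap fx fy fw fxy fyw g∉ xz z≢0
  ... | no g∉ | no _ | yes (_ , z , z≢0 , wz) =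
    no-gap fw fy fx (fyw ◂ ⊕-comm y w) (fxy ◂ ⊕-comm x y) (λ p → g∉ (subst Z (⊕-comm w x) p)) wz z≢0 ◂ ⊕-comm w x
  ... | no g∉ | no ¬Fx | no ¬Fw = trivial-adjacent fx fw g∉ ¬Fx ¬Fw

  -- If x and y were partners, w would be adjacent to one of them; and w cannot be in their coset,
  -- which has only two points of E.
  same-coset : f x ≡ true → f y ≡ true → f w ≡ true → x ≢ y → x ≢ w → y ≢ w →
    f (x ⊕ w) ≡ false → f (y ⊕ w) ≡ false → ¬ Z (x ⊕ y)
  same-coset {x} {y} {w} fx fy fw x≢y x≢w y≢w fxw fyw Zg with Z? (w ⊕ x)
  ... | yes Zh = y≢w (begin
      y              ≡⟨ ⊕-cancelˡ x y ⟨
      x ⊕ (x ⊕ y)    ≡⟨ cong (x ⊕_) (small (f⇒∉Z fx) xg (D-intro fx (subst Z (⊕-comm w x) Zh) (fw ◂ sym (⊕-cancelˡ x w)))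
                         (⊕≢0 x≢y) (⊕≢0 x≢w)) ⟩
      x ⊕ (x ⊕ w)    ≡⟨ ⊕-cancelˡ x w ⟩
      w              ∎)
    where
    open ≡-Reasoning
    xg : D x (x ⊕ y)
    xg = D-intro fx Zg (fy ◂ sym (⊕-cancelˡ x y))
  ... | no h∉ = clash
    (partner⇐ fw fx h∉ (D-intro fx Zg (fy ◂ sym (⊕-cancelˡ x y))) (⊕≢0 x≢y) (fxw ◂ ⊕-comm x w)
      ◂ ⊕! (x ∷ y ∷ w ∷ []) (v2 :+ v0 :+ (v0 :+ v1)) (v1 :+ v2)) fyw

  no-three-nonadjacent : ∀ {x y w} → f x ≡ true → f y ≡ true → f w ≡ true → x ≢ y → x ≢ w → y ≢ w →
    f (x ⊕ y) ≡ false → f (x ⊕ w) ≡ false → f (y ⊕ w) ≡ false → ⊥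
  no-three-nonadjacent {x} {y} {w} fx fy fw x≢y x≢w y≢w fxy fxw fyw =
    clash (trivial-adjacent fx fy xy∉
            (no-F fx fy fw y≢w (λ p → xy∉ (subst Z (⊕-comm y x) p)) (λ p → xw∉ (subst Z (⊕-comm w x) p)) fxy fxw fyw)
            (no-F fy fx fw x≢w xy∉ (λ p → yw∉ (subst Z (⊕-comm w y) p)) (fxy ◂ ⊕-comm x y) fyw fxw)) fxy
    where
    xy∉ : ¬ Z (x ⊕ y)
    xy∉ = same-coset fx fy fw x≢y x≢w y≢w fxw fyw
    xw∉ : ¬ Z (x ⊕ w)
    xw∉ = same-coset fx fw fy x≢w x≢y (λ p → y≢w (sym p)) fxy (fyw ◂ ⊕-comm y w)
    yw∉ : ¬ Z (y ⊕ w)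
    yw∉ = same-coset fy fw fx y≢w (λ p → x≢y (sym p)) (λ p → x≢w (sym p)) (fxy ◂ ⊕-comm x y) (fxw ◂ ⊕-comm x w)
    -- A partner x ⊕ z would be adjacent to both y and w, and transitivity would make these
    -- adjacent.
    no-F : ∀ {x y w} → f x ≡ true → f y ≡ true → f w ≡ true → y ≢ w → ¬ Z (y ⊕ x) → ¬ Z (w ⊕ x) →
      f (x ⊕ y) ≡ false → f (x ⊕ w) ≡ false → f (y ⊕ w) ≡ false → ¬ F x
    no-F {x} {y} {w} fx fy fw y≢w yx∉ wx∉ fxy fxw fyw (_ , z , z≢0 , xz) = clash
      (adjacent-trans fy (trans (D-apply xz coset-refl) fx) fw
        (partner⇐ fy fx yx∉ xz z≢0 (fxy ◂ ⊕-comm x y) ◂ ⊕-assoc y x z)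
        (partner⇐ fw fx wx∉ xz z≢0 (fxw ◂ ⊕-comm x w) ◂ ⊕! (x ∷ w ∷ z ∷ []) (v1 :+ v0 :+ v2) (v0 :+ v2 :+ v1))
        y≢w) fyw

-- `⊕!` in dimension one.
xor! : ∀ {k} (ρ : Vec Bool k) (e₁ e₂ : Expr k) {_ : T (isZero (nf e₁ ⊕ nf e₂))} →
  head (⟦ e₁ ⟧ (map (_∷ []) ρ)) ≡ head (⟦ e₂ ⟧ (map (_∷ []) ρ))
xor! ρ e₁ e₂ {p} = cong head (⊕! (map (_∷ []) ρ) e₁ e₂ {p})

-- Polarisation: f is a quadratic form iff ∂ (∂ f x) vanishes for all x.
∂ : ∀ {n} → (V n → Bool) → V n → V n → Bool
∂ g x y = g (x ⊕ y) xor (g x xor g y)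

∂-comm : ∀ {n} (g : V n → Bool) x y → ∂ g x y ≡ ∂ g y x
∂-comm g x y = cong₂ _xor_ (cong g (⊕-comm x y)) (xor-comm (g x) (g y))

∂-cocycle : ∀ {n} (g : V n → Bool) x y w → ∂ g (x ⊕ y) w xor ∂ g x y ≡ ∂ g x (y ⊕ w) xor ∂ g y w
∂-cocycle g x y w = trans
  (cong (λ t → (g t xor (g (x ⊕ y) xor g w)) xor ∂ g x y) (⊕-assoc x y w))
  (xor! (g (x ⊕ (y ⊕ w)) ∷ g (x ⊕ y) ∷ g w ∷ g x ∷ g y ∷ g (y ⊕ w) ∷ [])
    ((v0 :+ (v1 :+ v2)) :+ (v1 :+ (v3 :+ v4))) ((v0 :+ (v3 :+ v5)) :+ (v5 :+ (v4 :+ v2))))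

∂-absorb : ∀ {n} (g : V n → Bool) x y → ∂ g (x ⊕ y) y ≡ ∂ g x y
∂-absorb g x y = trans (cong (λ t → g t xor (g (x ⊕ y) xor g y)) (⊕-cancelʳ x y))
  (xor! (g x ∷ g (x ⊕ y) ∷ g y ∷ []) (v0 :+ (v1 :+ v2)) (v1 :+ (v0 :+ v2)))

xor-false : ∀ {a b c d} → a xor b ≡ c xor d → a ≡ false → c ≡ false → d ≡ false → b ≡ false
xor-false p refl refl refl = p

-- Groups of index at most two: quadratic forms

module LargeCase {n} (C : Configuration n) (large : Cosets.LargeStabilisers C) where

  open Cosets C

  private variable
    d e m u v w x y z : V n

  Full : V n → Set
  Full x = ∀ e → Z e → D x e

  Full? : ∀ x → Dec (Full x)
  Full? x = all? λ e → Z? e →-dec D? x e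

  Full-shift : Z (x ⊕ y) → Full x → Full y
  Full-shift p q e Ze = D-shift p (q e Ze)

  Full-≡ : x ≡ y → Full x → Full y
  Full-≡ refl p = p

  Full⇒E : ¬ Z x → Full x → f x ≡ true
  Full⇒E {x} x∉ p = let (z , Zz , q) = Z-max x∉ in trans (sym (D-apply (p z Zz) coset-refl)) q

  not-full : ¬ Full x → ∃[ e ] Z e × ¬ D x e
  not-full {x} ¬p with any? (λ e → Z? e ×-dec ¬? (D? x e))
  ... | yes q   = q
  ... | no none = ⊥-elim (¬p λ e Ze → decidable-stable (D? x e) λ ¬q → none (e , Ze , ¬q))

  -- D w has index at most 2 in Z, and D x contains both D w and the element e outside it.
  two-full : x ⊕ y ≡ w → ¬ Z w → D x e → D y e → ¬ D w e → Full x
  two-full {x} {w = w} line w∉ xe ye ¬we d Zd = decidable-stable (D? x d) λ ¬xd →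
    ¬xd (D-cancelʳ (w⊆x (large w∉ Zd (D.inZ xe) (λ wd → ¬xd (w⊆x wd)) ¬we)) xe)
    where open TwoOfThree line w∉ xe ye ¬we

  N : V n → Set
  N x = ¬ Z x × ¬ Full x

  N? : ∀ x → Dec (N x)
  N? x = ¬? (Z? x) ×-dec ¬? (Full? x)

  full-separates : Full x → ¬ Full y → ¬ Z (x ⊕ y)
  full-separates p ¬q r = ¬q (Full-shift r p)

  ⊆-add-full : Full x → N y → N (x ⊕ y) → D y e → D (x ⊕ y) e
  ⊆-add-full {x} {y} {e} p (y∉ , ¬y) (xy∉ , ¬xy) q = decidable-stable (D? (x ⊕ y) e) λ ¬r →
    ¬y (two-full (⊕-comm y x) xy∉ q (p e (D.inZ q)) ¬r)

  add-distinct : N y → ¬ Z w → D y e → ¬ D w e → ¬ D (y ⊕ w) e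
  add-distinct {y} {w} (_ , ¬y) w∉ ye ¬we p = ¬y (two-full (⊕-cancelˡ y w) w∉ ye p ¬we)

  -- Distinct subgroups of index 2 do not contain each other.
  incomparable : N m → ¬ Z v → D m e → ¬ D v e → ∃[ g ] D v g × ¬ D m g
  incomparable {m} {v} {e} (m∉ , ¬m) v∉ me ¬ve with not-full ¬m
  ... | d , Zd , ¬md with D? v d
  ... | yes p = d , p , ¬md
  ... | no ¬p = d ⊕ e , large v∉ Zd (D.inZ me) ¬p ¬ve , λ q → ¬md (D-cancelʳ q me)

  nonzero-element : ¬ Z x → ∃[ g ] g ≢ 0ᵛ × D x g
  nonzero-element {x} x∉ with D? x a₀ | D? x b₀
  ... | yes p | _     = a₀ , a₀≢0 , p
  ... | no _  | yes p = b₀ , b₀≢0 , p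
  ... | no p  | no q  = a₀ ⊕ b₀ , (λ r → a₀≢b₀ (≡-from-⊕ a₀ b₀ r)) , large x∉ Za₀ Zb₀ p q

  -- Otherwise the group of x ⊕ v ⊕ m would omit g when read as (x ⊕ v) ⊕ m and contain g when read
  -- as (x ⊕ m) ⊕ v.
  spread : ∀ {x m v g} → ¬ Z x → Full x → N m → Full (x ⊕ m) → N v → D v g → ¬ D m g → Full (x ⊕ v)
  spread {x} {m} {v} {g} x∉ x-full (m∉ , ¬m) xm-full Nv@(v∉ , ¬v) vg ¬mg = decidable-stable (Full? (x ⊕ v)) λ ¬xv →
    let Nxv : N (x ⊕ v)
        Nxv = full-separates x-full ¬v , ¬xv
        ¬xvmg : ¬ D (x ⊕ v ⊕ m) g
        ¬xvmg = add-distinct Nxv m∉ (⊆-add-full x-full Nv Nxv vg) ¬mg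
        ¬xmvg : ¬ D (x ⊕ m ⊕ v) g
        ¬xmvg = subst (λ t → ¬ D t g) (⊕! (x ∷ m ∷ v ∷ []) (v0 :+ v2 :+ v1) (v0 :+ v1 :+ v2)) ¬xvmg
    in ¬xmvg (⊆-add-full xm-full Nv (full-separates xm-full ¬v , λ p → ¬xmvg (p g (D.inZ vg))) vg)

  -- If D v lies in D m, a coset v′ with another group serves as an intermediate step.
  spread-all : ∀ {x m v} → ¬ Z x → Full x → N m → Full (x ⊕ m) → N v → Full (x ⊕ v)
  spread-all {x} {m} {v} x∉ x-full Nm@(m∉ , ¬m) xm-full Nv@(v∉ , ¬v)
    with any? (λ g → D? v g ×-dec ¬? (D? m g))
  ... | yes (g , vg , ¬mg) = spread x∉ x-full Nm xm-full Nv vg ¬mg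
  ... | no none with nonzero-element m∉
  ... | g , g≢0 , mg with Z-moved (D.inZ mg) g≢0
  ... | v′ , v′∉ , ¬v′g with incomparable Nm v′∉ mg ¬v′g
  ... | g′ , v′g′ , ¬mg′ = spread x∉ x-full Nv′ (spread x∉ x-full Nm xm-full Nv′ v′g′ ¬mg′) Nv vg ¬v′g
    where
    Nv′ : N v′
    Nv′ = v′∉ , λ p → ¬v′g (p g (D.inZ mg))
    vg : D v g
    vg = decidable-stable (D? v g) λ ¬vg → none (incomparable Nm v∉ mg ¬vg)

  -- If two full points add up to one that is not full, then f is constantly 1
  -- outside a proper subspace, namely the stabiliser of F.
  F : V n → Set
  F x = (¬ Z x × Full x) × (∀ v → N v → Full (x ⊕ v))

  F-stable : Stable F
  F-stable = record
    { F?   = λ x → (¬? (Z? x) ×-dec Full? x) ×-dec all? λ v → N? v →-dec Full? (x ⊕ v)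
    ; resp = λ { {x} {y} p ((x∉ , q) , r) → ((λ Zy → x∉ (coset-Z (coset-sym p) Zy)) , Full-shift p q) ,
               λ v Nv → Full-shift (subst Z (⊕! (x ∷ y ∷ v ∷ []) (v0 :+ v1) (v0 :+ v2 :+ (v1 :+ v2))) p) (r v Nv) }
    ; F⇒∉Z = λ p → proj₁ (proj₁ p) }

  open Stable F-stable
  open Stabiliser F-stable

  F-add : ∀ {x v} → F x → N v → F (x ⊕ v)
  F-add {x} {v} ((x∉ , x-full) , p) Nv = (xv∉ , p v Nv) ,
    λ v′ Nv′ → spread-all xv∉ (p v Nv) Nv (Full-≡ (sym (⊕-cancelʳ x v)) x-full) Nv′
    where
    xv∉ : ¬ Z (x ⊕ v)
    xv∉ = full-separates x-full (proj₂ Nv)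

  N⊆X : ∀ {v} → N v → X v
  N⊆X Nv = (λ p → proj₂ Nv (proj₂ (proj₁ p))) , λ k Fk → F-add Fk Nv

  ∉F⇒X : ∀ {u} → ¬ F u → X u
  ∉F⇒X {u} ¬Fu with Z? u | Full? u | any? (λ v → N? v ×-dec ¬? (Full? (u ⊕ v)))
  ... | yes Zu | _ | _ = Z⊆X Zu
  ... | no u∉ | no ¬u | _ = N⊆X (u∉ , ¬u)
  ... | no u∉ | yes u-full | no none =
    ⊥-elim (¬Fu ((u∉ , u-full) , λ v Nv → decidable-stable (Full? (u ⊕ v)) λ ¬p → none (v , Nv , ¬p)))
  ... | no u∉ | yes u-full | yes (v , Nv , ¬uv) = X-cancel (N⊆X Nv)
    (N⊆X (full-separates u-full (proj₂ Nv) , ¬uv))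

  full-sum : ∀ {x y} → ¬ Z x → Full x → ¬ Z y → Full y → ¬ Z (x ⊕ y) → Full (x ⊕ y)
  full-sum {x} {y} x∉ x-full y∉ y-full w∉ = decidable-stable (Full? (x ⊕ y)) λ ¬w →
    let Nw = w∉ , ¬w
        xw-full = Full-≡ (sym (⊕-cancelˡ x y)) y-full
    in trivial ((x∉ , x-full) , λ v Nv → spread-all x∉ x-full Nw xw-full Nv) (N⊆X Nw) w∉ sub
    where
    sub : ∀ {w u} → f w ≡ true → X w → ¬ X u → f (u ⊕ w) ≡ f u
    sub {w} {u} fw Xw ¬Xu = trans (on-F (proj₂ Xw u Fu)) (sym (on-F Fu))
      where
      on-F : ∀ {v} → F v → f v ≡ true
      on-F ((v∉ , p) , _) = Full⇒E v∉ p
      Fu : F u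
      Fu = decidable-stable (F? u) λ p → ¬Xu (∉F⇒X p)

  both : x ⊕ y ≡ w → ¬ Z x → ¬ Z y → ¬ Z w → D x e → D y e → D w e
  both {x} {y} {e = e} refl x∉ y∉ w∉ xe ye = decidable-stable (D? (x ⊕ y) e) λ ¬we →
    ¬we (full-sum x∉ (two-full refl w∉ xe ye ¬we) y∉ (two-full (⊕-comm y x) w∉ ye xe ¬we) w∉ e (D.inZ xe))

  exactly-one : x ⊕ y ≡ w → ¬ Z x → ¬ Z y → ¬ Z w → D x e → ¬ D y e → ¬ D w e
  exactly-one line x∉ y∉ w∉ xe ¬ye we = ¬ye (both (line-rot line) x∉ w∉ y∉ xe we)

  -- If e were missing from all three groups, index at most 2 would make them equal. `no-equal-line`
  -- excludes this, using a coset v whose group omits some g of D x and therefore contains e or e ⊕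
  -- g.
  neither : x ⊕ y ≡ w → ¬ Z x → ¬ Z y → ¬ Z w → Z e → ¬ D x e → ¬ D y e → D w e
  neither {x} {y} {w} {e} line x∉ y∉ w∉ Ze ¬xe ¬ye = decidable-stable (D? w e) contra
    where
    ⊆-step : ∀ {x y w d} → x ⊕ y ≡ w → ¬ Z x → ¬ Z y → ¬ Z w → ¬ D x e → ¬ D y e → ¬ D w e → D x d → D y d
    ⊆-step {x} {y} {w} {d} line x∉ y∉ w∉ ¬xe ¬ye ¬we xd = decidable-stable (D? y d) λ ¬yd →
      ¬xe (D-cancelˡ (both (line-rot′ line) y∉ w∉ x∉ (large y∉ (D.inZ xd) Ze ¬yd ¬ye)
        (large w∉ (D.inZ xd) Ze (exactly-one line x∉ y∉ w∉ xd ¬yd) ¬we)) xd)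
    contra : ¬ ¬ D w e
    contra ¬we with nonzero-element x∉
    ... | g , g≢0 , xg with Z-moved (D.inZ xg) g≢0
    ... | v , v∉ , ¬vg with D? v e
    ... | yes ve = no-equal-line line x∉ y∉ w∉ v∉ xg
        (⊆-step line x∉ y∉ w∉ ¬xe ¬ye ¬we xg) (⊆-step (line-rot line) x∉ w∉ y∉ ¬xe ¬we ¬ye xg)
        ¬xe ¬ye ¬we ve ¬vg
    ... | no ¬ve = no-equal-line line x∉ y∉ w∉ v∉ xg yg wg
        (λ p → ¬xe (D-cancelʳ p xg)) (λ p → ¬ye (D-cancelʳ p yg)) (λ p → ¬we (D-cancelʳ p wg))
        (large v∉ Ze (D.inZ xg) ¬ve ¬vg) ¬vg
      where
      yg = ⊆-step line x∉ y∉ w∉ ¬xe ¬ye ¬we xg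
      wg = ⊆-step (line-rot line) x∉ w∉ y∉ ¬xe ¬we ¬ye xg

  -- A pairing of V with Z whose kernel at x outside Z is D x; `both`, `exactly-one` and `neither`
  -- become its additivity in x.
  p : V n → V n → Bool
  p x e = f (x ⊕ e) xor f x

  D⇒p : D x e → p x e ≡ false
  D⇒p {x} q = trans (cong (_xor f x) (D-apply q coset-refl)) (xor-same (f x))

  Z⇒p : Z x → Z e → p x e ≡ false
  Z⇒p Zx Ze = cong₂ _xor_ (Z-false (Subspace.⊕∈ Z-sub Zx Ze)) (Z-false Zx)

  -- When x is not in E, some x ⊕ z is, and index at most 2 puts z ⊕ e into D x.
  ¬D⇒p : ¬ Z x → Z e → ¬ D x e → p x e ≡ true
  ¬D⇒p {x} {e} x∉ Ze ¬xe with true? (f x)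
  ... | inj₁ fx = cong₂ _xor_ (moved ¬xe Ze coset-refl fx) fx
  ... | inj₂ fx with Z-max x∉
  ... | z , Zz , fxz = cong₂ _xor_
    (trans (D-apply xze (shift∈ Zz)) fxz ◂ ⊕! (x ∷ z ∷ e ∷ []) (v0 :+ v1 :+ (v1 :+ v2)) (v0 :+ v2)) fx
    where
    xze : D x (z ⊕ e)
    xze = large x∉ Zz Ze (λ q → clash fxz (trans (D-apply q coset-refl) fx)) ¬xe

  p⇒D : ¬ Z x → Z e → p x e ≡ false → D x e
  p⇒D {x} {e} x∉ Ze q = decidable-stable (D? x e) λ ¬xe → clash (¬D⇒p x∉ Ze ¬xe) q

  p-coset : Z (x ⊕ y) → Z e → p x e ≡ p y e
  p-coset {x} {y} {e} xy Ze with Z? x | D? x e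
  ... | yes Zx | _ = trans (Z⇒p Zx Ze) (sym (Z⇒p (coset-Z xy Zx) Ze))
  ... | no x∉ | yes xe = trans (D⇒p xe) (sym (D⇒p (D-shift xy xe)))
  ... | no x∉ | no ¬xe = trans (¬D⇒p x∉ Ze ¬xe)
    (sym (¬D⇒p (λ Zy → x∉ (coset-Z (coset-sym xy) Zy)) Ze (λ ye → ¬xe (D-shift (coset-sym xy) ye))))

  p-⊕ˡ : ∀ x y → Z e → p (x ⊕ y) e ≡ p x e xor p y e
  p-⊕ˡ {e} x y Ze with Z? x | Z? y | Z? (x ⊕ y)
  ... | yes Zx | _ | _ = trans (p-coset (subst Z (⊕! (x ∷ y ∷ []) v0 (v0 :+ v1 :+ v1)) Zx) Ze)
                           (cong (_xor p y e) (sym (Z⇒p Zx Ze)))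
  ... | no _ | yes Zy | _ =
    trans (trans (p-coset (subst Z (⊕! (x ∷ y ∷ []) v1 (v0 :+ v1 :+ v0)) Zy) Ze) (sym (xor-identityʳ _)))
                           (cong (p x e xor_) (sym (Z⇒p Zy Ze)))
  ... | no _ | no _ | yes Zw =
    trans (Z⇒p Zw Ze) (sym (trans (cong (p x e xor_) (sym (p-coset Zw Ze))) (xor-same (p x e))))
  ... | no x∉ | no y∉ | no w∉ with D? x e | D? y e
  ... | yes q | yes r = trans (D⇒p (both refl x∉ y∉ w∉ q r)) (sym (cong₂ _xor_ (D⇒p q) (D⇒p r)))
  ... | yes q | no r  = trans (¬D⇒p w∉ Ze (exactly-one refl x∉ y∉ w∉ q r)) (sym (cong₂ _xor_ (D⇒p q) (¬D⇒p y∉ Ze r)))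
  ... | no q  | yes r = trans (¬D⇒p w∉ Ze (exactly-one (⊕-comm y x) y∉ x∉ w∉ r q))
    (sym (cong₂ _xor_ (¬D⇒p x∉ Ze q) (D⇒p r)))
  ... | no q  | no r  = trans (D⇒p (neither refl x∉ y∉ w∉ Ze q r)) (sym (cong₂ _xor_ (¬D⇒p x∉ Ze q) (¬D⇒p y∉ Ze r)))

  p-⊕ʳ : ∀ x → Z d → Z e → p x (d ⊕ e) ≡ p x d xor p x e
  p-⊕ʳ {d} {e} x Zd Ze = begin
    f (x ⊕ (d ⊕ e)) xor f x       ≡⟨ cong (λ t → f t xor f x) (⊕-assoc x d e) ⟨
    f (x ⊕ d ⊕ e) xor f x         ≡⟨ xor! (f (x ⊕ d ⊕ e) ∷ f x ∷ f (x ⊕ d) ∷ []) (v0 :+ v1) ((v2 :+ v1) :+ (v0 :+ v2)) ⟩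
    p x d xor p (x ⊕ d) e         ≡⟨ cong (p x d xor_) (p-coset (coset-sym (shift∈ Zd)) Ze) ⟩
    p x d xor p x e               ∎
    where open ≡-Reasoning

  f-shift : ∀ x e → f (x ⊕ e) ≡ f x xor p x e
  f-shift x e = xor! (f (x ⊕ e) ∷ f x ∷ []) v0 (v1 :+ (v0 :+ v1))

  -- Prescribing values of linear functionals on Z

  record Functional (φ : V n → Bool) : Set where
    constructor functional
    field additive : ∀ {d e} → Z d → Z e → φ (d ⊕ e) ≡ φ d xor φ e
  open Functional

  p-functional : ∀ x → Functional (p x)
  p-functional x = functional (p-⊕ʳ x)

  infixl 6 _⊞_ _⊞ᶠ_
  _⊞_ : (V n → Bool) → (V n → Bool) → V n → Bool
  (φ ⊞ ψ) z = φ z xor ψ z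

  _⊞ᶠ_ : {φ ψ : V n → Bool} → Functional φ → Functional ψ → Functional (φ ⊞ ψ)
  _⊞ᶠ_ {φ} {ψ} F G = functional λ {d} {e} Zd Ze → trans (cong₂ _xor_ (additive F Zd Ze) (additive G Zd Ze))
    (xor! (φ d ∷ φ e ∷ ψ d ∷ ψ e ∷ []) ((v0 :+ v1) :+ (v2 :+ v3)) ((v0 :+ v2) :+ (v1 :+ v3)))

  -- Linear independence of functionals is expressed below by `Nonzero` of every nontrivial sum.
  Nonzero : (V n → Bool) → Set
  Nonzero φ = ∃[ z ] Z z × φ z ≡ true

  Nonzero-≗ : {φ ψ : V n → Bool} → (∀ z → Z z → φ z ≡ ψ z) → Nonzero φ → Nonzero ψ
  Nonzero-≗ eq (z , Zz , q) = z , Zz , trans (sym (eq z Zz)) q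

  -- The hypotheses put φ outside the span of ψ; one of the two witnesses or their sum serves.
  separate : {φ ψ : V n → Bool} → Functional φ → Functional ψ → Nonzero φ → Nonzero (φ ⊞ ψ) →
    ∃[ z ] Z z × φ z ≡ true × ψ z ≡ false
  separate {φ} {ψ} Fφ Fψ (z , Zz , φz) (z′ , Zz′ , s) with true? (ψ z) | true? (φ z′)
  ... | inj₂ ψz | _        = z , Zz , φz , ψz
  ... | inj₁ ψz | inj₁ φz′ = z′ , Zz′ , φz′ , ¬true⇒false λ ψz′ → clash s (cong₂ _xor_ φz′ ψz′)
  ... | inj₁ ψz | inj₂ φz′ = z ⊕ z′ , Subspace.⊕∈ Z-sub Zz Zz′ ,
    trans (additive Fφ Zz Zz′) (cong₂ _xor_ φz φz′) ,
    trans (additive Fψ Zz Zz′) (cong₂ _xor_ ψz (trans (sym (cong (_xor ψ z′) φz′)) s))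

  separate₂ : {φ ψ χ : V n → Bool} → Functional φ → Functional ψ → Functional χ →
    Nonzero φ → Nonzero (φ ⊞ ψ) → Nonzero (φ ⊞ χ) → Nonzero (φ ⊞ χ ⊞ ψ) →
    ∃[ z ] Z z × φ z ≡ true × ψ z ≡ false × χ z ≡ false
  separate₂ {φ} {ψ} {χ} Fφ Fψ Fχ φ≢ φψ≢ φχ≢ φχψ≢
    with separate Fφ Fψ φ≢ φψ≢ | separate (Fφ ⊞ᶠ Fχ) Fψ φχ≢ φχψ≢
  ... | z , Zz , φz , ψz | z′ , Zz′ , φχz′ , ψz′ with true? (χ z) | true? (χ z′)
  ... | inj₂ χz | _        = z , Zz , φz , ψz , χz
  ... | inj₁ χz | inj₂ χz′ = z′ , Zz′ , trans (sym (trans (cong (φ z′ xor_) χz′) (xor-identityʳ _))) φχz′ , ψz′ , χz′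
  ... | inj₁ χz | inj₁ χz′ = z ⊕ z′ , Subspace.⊕∈ Z-sub Zz Zz′ ,
    trans (additive Fφ Zz Zz′) (cong₂ _xor_ φz (¬true⇒false λ φz′ → clash φχz′ (cong₂ _xor_ φz′ χz′))) ,
    trans (additive Fψ Zz Zz′) (cong₂ _xor_ ψz ψz′) ,
    trans (additive Fχ Zz Zz′) (cong₂ _xor_ χz χz′)

  scale∈ : ∀ b {z} → Z z → Z (b · z)
  scale∈ true  Zz = Zz
  scale∈ false Zz = Subspace.0∈ Z-sub

  Functional-0 : {φ : V n → Bool} → Functional φ → φ 0ᵛ ≡ false
  Functional-0 {φ} F = begin
    φ 0ᵛ              ≡⟨ cong φ (⊕-same 0ᵛ) ⟨
    φ (0ᵛ ⊕ 0ᵛ)       ≡⟨ additive F (Subspace.0∈ Z-sub) (Subspace.0∈ Z-sub) ⟩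
    φ 0ᵛ xor φ 0ᵛ     ≡⟨ xor-same (φ 0ᵛ) ⟩
    false             ∎
    where open ≡-Reasoning

  scale-true : {φ : V n → Bool} → Functional φ → ∀ b {z} → φ z ≡ true → φ (b · z) ≡ b
  scale-true F true  q = q
  scale-true F false q = Functional-0 F

  scale-false : {φ : V n → Bool} → Functional φ → ∀ b {z} → φ z ≡ false → φ (b · z) ≡ false
  scale-false F true  q = q
  scale-false F false q = Functional-0 F

  solve₂ : {φ ψ : V n → Bool} → Functional φ → Functional ψ → Nonzero φ → Nonzero ψ → Nonzero (φ ⊞ ψ) →
    ∀ b c → ∃[ z ] Z z × φ z ≡ b × ψ z ≡ c
  solve₂ {φ} {ψ} Fφ Fψ φ≢ ψ≢ φψ≢ b c
    with separate Fφ Fψ φ≢ φψ≢ | separate Fψ Fφ ψ≢ (Nonzero-≗ (λ z _ → xor-comm (φ z) (ψ z)) φψ≢)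
  ... | z , Zz , φz , ψz | z′ , Zz′ , ψz′ , φz′ =
    b · z ⊕ c · z′ , Subspace.⊕∈ Z-sub (scale∈ b Zz) (scale∈ c Zz′) ,
    trans (additive Fφ (scale∈ b Zz) (scale∈ c Zz′))
      (trans (cong₂ _xor_ (scale-true Fφ b φz) (scale-false Fφ c φz′)) (xor-identityʳ b)) ,
    trans (additive Fψ (scale∈ b Zz) (scale∈ c Zz′))
      (cong₂ _xor_ (scale-false Fψ b ψz) (scale-true Fψ c ψz′))

  solve₃ : {φ ψ χ : V n → Bool} → Functional φ → Functional ψ → Functional χ →
    Nonzero φ → Nonzero ψ → Nonzero χ → Nonzero (φ ⊞ ψ) → Nonzero (φ ⊞ χ) → Nonzero (ψ ⊞ χ) →
    Nonzero (φ ⊞ ψ ⊞ χ) → ∀ a b c → ∃[ z ] Z z × φ z ≡ a × ψ z ≡ b × χ z ≡ c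
  solve₃ {φ} {ψ} {χ} Fφ Fψ Fχ φ≢ ψ≢ χ≢ φψ≢ φχ≢ ψχ≢ φψχ≢ a b c
    with separate₂ Fφ Fχ Fψ φ≢ φχ≢ φψ≢ φψχ≢
       | solve₂ Fψ Fχ ψ≢ χ≢ ψχ≢ b c
  ... | z , Zz , φz , χz , ψz | z′ , Zz′ , ψz′ , χz′ =
    s · z ⊕ z′ , Subspace.⊕∈ Z-sub (scale∈ s Zz) Zz′ ,
    trans (additive Fφ (scale∈ s Zz) Zz′) (trans (cong (_xor φ z′) (scale-true Fφ s φz))
      (xor! (a ∷ φ z′ ∷ []) (v0 :+ v1 :+ v1) v0)) ,
    trans (additive Fψ (scale∈ s Zz) Zz′) (cong₂ _xor_ (scale-false Fψ s ψz) ψz′) ,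
    trans (additive Fχ (scale∈ s Zz) Zz′) (cong₂ _xor_ (scale-false Fχ s χz) χz′)
    where
    s = a xor φ z′

  -- K is the radical of the bilinear pairing p between V and Z.
  K : V n → Set
  K x = ∀ e → Z e → p x e ≡ false

  K? : ∀ x → Dec (K x)
  K? x = all? λ e → Z? e →-dec (p x e Bool.≟ false)

  K-⊕ : K x → K y → K (x ⊕ y)
  K-⊕ {x} {y} q r e Ze = trans (p-⊕ˡ x y Ze) (cong₂ _xor_ (q e Ze) (r e Ze))

  K-cancelˡ : K x → K (x ⊕ y) → K y
  K-cancelˡ {x} {y} q r = subst K (⊕-cancelˡ x y) (K-⊕ q r)

  ¬K : ¬ K x → Nonzero (p x)
  ¬K {x} ¬Kx with any? (λ e → Z? e ×-dec (p x e Bool.≟ true))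
  ... | yes q   = q
  ... | no none = ⊥-elim (¬Kx λ e Ze → ¬true⇒false λ q → none (e , Ze , q))

  ¬K⇒∉Z : ¬ K x → ¬ Z x
  ¬K⇒∉Z ¬Kx Zx = ¬Kx λ e Ze → Z⇒p Zx Ze

  K⇒E : ¬ Z x → K x → f x ≡ true
  K⇒E x∉ q = Full⇒E x∉ λ e Ze → p⇒D x∉ Ze (q e Ze)

  f-0 : f 0ᵛ ≡ false
  f-0 = Z-false (Subspace.0∈ Z-sub)

  -- The third derivative of f

  B : V n → V n → Bool
  B = ∂ f

  Q : V n → V n → V n → Bool
  Q x = ∂ (B x)

  B-comm : ∀ x y → B x y ≡ B y x
  B-comm = ∂-comm f

  Q-swap₂₃ : ∀ x y w → Q x y w ≡ Q x w y
  Q-swap₂₃ x = ∂-comm (B x)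

  Q-swap₁₂ : ∀ x y w → Q x y w ≡ Q y x w
  Q-swap₁₂ x y w = begin
    (f (x ⊕ (y ⊕ w)) xor (f x xor f (y ⊕ w))) xor (B x y xor B x w)
      ≡⟨ cong₂ (λ s t → (f s xor (f x xor f (y ⊕ w))) xor (t xor B x w))
           (⊕! (x ∷ y ∷ w ∷ []) (v0 :+ (v1 :+ v2)) (v1 :+ (v0 :+ v2))) (B-comm x y) ⟩
    (f (y ⊕ (x ⊕ w)) xor (f x xor f (y ⊕ w))) xor (B y x xor B x w)
      ≡⟨ xor! (f (y ⊕ (x ⊕ w)) ∷ f x ∷ f (y ⊕ w) ∷ B y x ∷ f (x ⊕ w) ∷ f w ∷ f y ∷ [])
           ((v0 :+ (v1 :+ v2)) :+ (v3 :+ (v4 :+ (v1 :+ v5))))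
           ((v0 :+ (v6 :+ v4)) :+ (v3 :+ (v2 :+ (v6 :+ v5)))) ⟩
    (f (y ⊕ (x ⊕ w)) xor (f y xor f (x ⊕ w))) xor (B y x xor B y w)  ∎
    where open ≡-Reasoning

  Q-rotate : ∀ x y w → Q x y w ≡ Q w x y
  Q-rotate x y w = trans (Q-swap₂₃ x y w) (Q-swap₁₂ x w y)

  B-shift : ∀ x {z} → Z z → ∀ y → B (x ⊕ z) y ≡ B x y xor p y z
  B-shift x {z} Zz y = begin
    f (x ⊕ z ⊕ y) xor (f (x ⊕ z) xor f y)
      ≡⟨ cong (λ t → f t xor (f (x ⊕ z) xor f y)) (⊕! (x ∷ z ∷ y ∷ []) (v0 :+ v1 :+ v2) (v0 :+ v2 :+ v1)) ⟩
    f (x ⊕ y ⊕ z) xor (f (x ⊕ z) xor f y)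
      ≡⟨ cong₂ (λ s t → s xor (t xor f y)) (trans (f-shift (x ⊕ y) z) (cong (f (x ⊕ y) xor_) (p-⊕ˡ x y Zz)))
           (f-shift x z) ⟩
    (f (x ⊕ y) xor (p x z xor p y z)) xor ((f x xor p x z) xor f y)
      ≡⟨ xor! (f (x ⊕ y) ∷ p x z ∷ p y z ∷ f x ∷ f y ∷ [])
           ((v0 :+ (v1 :+ v2)) :+ ((v3 :+ v1) :+ v4)) ((v0 :+ (v3 :+ v4)) :+ v2) ⟩
    B x y xor p y z  ∎
    where open ≡-Reasoning

  -- Moving x by z adds the function `λ y → p y z` to B x; it is additive, so the next ∂ removes it.
  Q-shift : ∀ x {z} → Z z → ∀ y w → Q (x ⊕ z) y w ≡ Q x y w
  Q-shift x {z} Zz y w = begin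
    B (x ⊕ z) (y ⊕ w) xor (B (x ⊕ z) y xor B (x ⊕ z) w)
      ≡⟨ cong₂ _xor_ (trans (B-shift x Zz (y ⊕ w)) (cong (B x (y ⊕ w) xor_) (p-⊕ˡ y w Zz)))
           (cong₂ _xor_ (B-shift x Zz y) (B-shift x Zz w)) ⟩
    (B x (y ⊕ w) xor (p y z xor p w z)) xor ((B x y xor p y z) xor (B x w xor p w z))
      ≡⟨ xor! (B x (y ⊕ w) ∷ p y z ∷ p w z ∷ B x y ∷ B x w ∷ [])
           ((v0 :+ (v1 :+ v2)) :+ ((v3 :+ v1) :+ (v4 :+ v2))) (v0 :+ (v3 :+ v4)) ⟩
    Q x y w  ∎
    where open ≡-Reasoning

  Q-Z : ∀ {x} → Z x → ∀ y w → Q x y w ≡ false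
  Q-Z {x} Zx y w = begin
    Q x y w           ≡⟨ cong (λ t → Q t y w) (⊕-identityˡ x) ⟨
    Q (0ᵛ ⊕ x) y w    ≡⟨ Q-shift 0ᵛ Zx y w ⟩
    Q 0ᵛ y w          ≡⟨ cong₂ _xor_ (B-0 (y ⊕ w)) (cong₂ _xor_ (B-0 y) (B-0 w)) ⟩
    false             ∎
    where
    open ≡-Reasoning
    B-0 : ∀ y → B 0ᵛ y ≡ false
    B-0 y = trans (cong₂ (λ s t → f s xor (t xor f y)) (⊕-identityˡ y) f-0) (xor-same (f y))

  -- Moving x, y and w inside their cosets of Z, one can arrange that x, y, w lie in E
  -- and that their pairwise sums do not; Q x y w decides whether this is a claw.
  Q-vanishes : ∀ {x y w} →
    (∀ b c → ∃[ z ] Z z × p x z ≡ not (f x) × p y z ≡ b × p w z ≡ c) →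
    (∀ b c → ∃[ z ] Z z × p x z ≡ false × p y z ≡ b × p w z ≡ c) → Q x y w ≡ false
  -- A triangular choice: z₁ brings x into E and clears B x y and B x w, z₂ brings y into E and
  -- clears B y w without disturbing x, z₃ brings w into E without disturbing x and y.
  Q-vanishes {x} {y} {w} choose choose₀ with choose (B x y) (B x w)
  ... | z₁ , Zz₁ , xz₁ , yz₁ , wz₁ with choose₀ (not (f y)) (B y w)
  ... | z₂ , Zz₂ , xz₂ , yz₂ , wz₂ with choose₀ false (not (f w))
  ... | z₃ , Zz₃ , xz₃ , yz₃ , wz₃ = ¬true⇒false λ q → noClaw x₁ y₁ w₁ fx₁ fy₁ fw₁
      (sum-false fx₁ fy₁ Bxy) (sum-false fx₁ fw₁ Bxw) fyw
      (¬true⇒false λ r → clash (trans Q≡ q) (Q₁ (r ◂ ⊕-assoc x₁ y₁ w₁)))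
    where
    x₁ = x ⊕ z₁
    y₁ = y ⊕ z₂
    w₁ = w ⊕ z₃
    f-moved : ∀ u {z} → p u z ≡ not (f u) → f (u ⊕ z) ≡ true
    f-moved u {z} q = trans (f-shift u z) (trans (cong (f u xor_) q) (not-self (f u)))
      where
      not-self : ∀ b → b xor not b ≡ true
      not-self true  = refl
      not-self false = refl
    fx₁ : f x₁ ≡ true
    fx₁ = f-moved x xz₁
    fy₁ : f y₁ ≡ true
    fy₁ = f-moved y yz₂
    fw₁ : f w₁ ≡ true
    fw₁ = f-moved w wz₃
    p-x₁ : ∀ {z} → Z z → p x z ≡ false → p x₁ z ≡ false
    p-x₁ Zz q = trans (p-coset (coset-sym (shift∈ Zz₁)) Zz) q
    p-y₁ : ∀ {z} → Z z → p y z ≡ false → p y₁ z ≡ false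
    p-y₁ Zz q = trans (p-coset (coset-sym (shift∈ Zz₂)) Zz) q
    kill : ∀ u {z} → Z z → ∀ v → p v z ≡ B u v → B (u ⊕ z) v ≡ false
    kill u Zz v q = trans (B-shift u Zz v) (trans (cong (B u v xor_) q) (xor-same (B u v)))
    keep : ∀ u {z} → Z z → ∀ v → p v z ≡ false → B v u ≡ false → B v (u ⊕ z) ≡ false
    keep u {z} Zz v q r = trans (B-comm v (u ⊕ z)) (trans (B-shift u Zz v) (cong₂ _xor_ (trans (B-comm u v) r) q))
    Bxy : B x₁ y₁ ≡ false
    Bxy = keep y Zz₂ x₁ (p-x₁ Zz₂ xz₂) (kill x Zz₁ y yz₁)
    Bxw : B x₁ w₁ ≡ false
    Bxw = keep w Zz₃ x₁ (p-x₁ Zz₃ xz₃) (kill x Zz₁ w wz₁)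
    Byw : B y₁ w₁ ≡ false
    Byw = keep w Zz₃ y₁ (p-y₁ Zz₃ yz₃) (kill y Zz₂ w wz₂)
    sum-false : ∀ {u v} → f u ≡ true → f v ≡ true → B u v ≡ false → f (u ⊕ v) ≡ false
    sum-false {u} {v} fu fv q with f (u ⊕ v) | f u | f v
    sum-false refl refl refl | false | _ | _ = refl
    fyw : f (y₁ ⊕ w₁) ≡ false
    fyw = sum-false fy₁ fw₁ Byw
    Q≡ : Q x₁ y₁ w₁ ≡ Q x y w
    Q≡ = begin
      Q x₁ y₁ w₁  ≡⟨ Q-shift x Zz₁ y₁ w₁ ⟩
      Q x y₁ w₁   ≡⟨ Q-swap₁₂ x y₁ w₁ ⟩
      Q y₁ x w₁   ≡⟨ Q-shift y Zz₂ x w₁ ⟩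
      Q y x w₁    ≡⟨ Q-rotate y x w₁ ⟩
      Q w₁ y x    ≡⟨ Q-shift w Zz₃ y x ⟩
      Q w y x     ≡⟨ Q-rotate y x w ⟨
      Q y x w     ≡⟨ Q-swap₁₂ y x w ⟩
      Q x y w     ∎
      where open ≡-Reasoning
    Q₁ : f (x₁ ⊕ (y₁ ⊕ w₁)) ≡ true → Q x₁ y₁ w₁ ≡ false
    Q₁ q = cong₂ _xor_ (cong₂ _xor_ q (cong₂ _xor_ fx₁ fyw)) (cong₂ _xor_ Bxy Bxw)

  p-⊞ : ∀ x y → ¬ K (x ⊕ y) → Nonzero (p x ⊞ p y)
  p-⊞ x y ¬Kxy = Nonzero-≗ (λ z Zz → p-⊕ˡ x y Zz) (¬K ¬Kxy)

  Q-independent : ∀ x y w → ¬ K x → ¬ K y → ¬ K w → ¬ K (x ⊕ y) → ¬ K (x ⊕ w) → ¬ K (y ⊕ w) →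
    ¬ K (x ⊕ y ⊕ w) → Q x y w ≡ false
  Q-independent x y w ¬x ¬y ¬w ¬xy ¬xw ¬yw ¬xyw = Q-vanishes {x} {y} {w} (solve (not (f x))) (solve false)
    where
    xyw : Nonzero (p x ⊞ p y ⊞ p w)
    xyw = Nonzero-≗ {p (x ⊕ y ⊕ w)} {p x ⊞ p y ⊞ p w}
      (λ z Zz → trans (p-⊕ˡ (x ⊕ y) w Zz) (cong (_xor p w z) (p-⊕ˡ x y Zz))) (¬K ¬xyw)
    solve : ∀ a b c → ∃[ z ] Z z × p x z ≡ a × p y z ≡ b × p w z ≡ c
    solve = solve₃ {p x} {p y} {p w} (p-functional x) (p-functional y) (p-functional w)
      (¬K ¬x) (¬K ¬y) (¬K ¬w) (p-⊞ x y ¬xy) (p-⊞ x w ¬xw) (p-⊞ y w ¬yw) xyw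

  Q-rank2 : ∀ x y w → K x → ¬ K y → ¬ K w → ¬ K (y ⊕ w) → Q x y w ≡ false
  Q-rank2 x y w Kx ¬y ¬w ¬yw = split (Z? x)
    where
    choose : ∀ {a} → false ≡ a → ∀ b c → ∃[ z ] Z z × p x z ≡ a × p y z ≡ b × p w z ≡ c
    choose refl b c =
      let (z , Zz , yz , wz) = solve₂ {p y} {p w} (p-functional y) (p-functional w) (¬K ¬y) (¬K ¬w) (p-⊞ y w ¬yw) b c
      in z , Zz , Kx z Zz , yz , wz
    split : Dec (Z x) → Q x y w ≡ false
    split (yes Zx) = Q-Z Zx y w
    -- Outside Z the radical lies in E, so x needs no correction and p x z = 0 is exactly what is
    -- asked for.
    split (no x∉)  = Q-vanishes {x} {y} {w} (choose (sym (cong not (K⇒E x∉ Kx)))) (choose refl)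

  moves : ∀ {g} → Z g → g ≢ 0ᵛ → ∃[ v ] p v g ≡ true
  moves Zg g≢0 = let (v , v∉ , ¬vg) = Z-moved Zg g≢0 in v , ¬D⇒p v∉ Zg ¬vg

  detects : p v e ≡ true → Z e → ¬ K v
  detects q Ze Kv = clash q (Kv _ Ze)

  -- The cocycle identity expresses Q w x y by three values of lower rank.
  Q-rank1 : ∀ x y w → K x → K y → ¬ K w → Q x y w ≡ false
  Q-rank1 x y w Kx Ky ¬w with nonzero-element (¬K⇒∉Z ¬w)
  -- p w vanishes at g and p v does not, so v and w are independent modulo K.
  ... | g , g≢0 , wg with moves (D.inZ wg) g≢0
  ... | v , vg = trans (Q-rotate x y w) (xor-false (∂-cocycle (B w) x y v)
      (trans (Q-swap₁₂ w (x ⊕ y) v) (Q-rank2 (x ⊕ y) w v (K-⊕ Kx Ky) ¬w ¬v ¬wv))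
      (trans (Q-swap₁₂ w x (y ⊕ v)) (Q-rank2 x w (y ⊕ v) Kx ¬w (λ q → ¬v (K-cancelˡ Ky q))
        λ q → ¬wv (K-cancelˡ Ky (subst K (⊕! (y ∷ w ∷ v ∷ []) (v1 :+ (v0 :+ v2)) (v0 :+ (v1 :+ v2))) q))))
      (trans (Q-swap₁₂ w y v) (Q-rank2 y w v Ky ¬w ¬v ¬wv)))
    where
    ¬v : ¬ K v
    ¬v = detects vg (D.inZ wg)
    ¬wv : ¬ K (w ⊕ v)
    ¬wv = detects (trans (p-⊕ˡ w v (D.inZ wg)) (cong₂ _xor_ (D⇒p wg) vg)) (D.inZ wg)

  Q-rank0 : ∀ x y w → K x → K y → K w → Q x y w ≡ false
  Q-rank0 x y w Kx Ky Kw with moves Za₀ a₀≢0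
  ... | v , vg = trans (Q-rotate x y w) (xor-false (∂-cocycle (B w) x y v)
      (Q-rank1 w (x ⊕ y) v Kw (K-⊕ Kx Ky) ¬v)
      (Q-rank1 w x (y ⊕ v) Kw Kx (λ q → ¬v (K-cancelˡ Ky q)))
      (Q-rank1 w y v Kw Ky ¬v))
    where
    ¬v : ¬ K v
    ¬v = detects vg Za₀

  Q-K : ∀ x y w → K x → Q x y w ≡ false
  Q-K x y w Kx = split (K? y) (K? w) (K? (y ⊕ w))
    where
    split : Dec (K y) → Dec (K w) → Dec (K (y ⊕ w)) → Q x y w ≡ false
    split (yes Ky) (yes Kw) _       = Q-rank0 x y w Kx Ky Kw
    split (yes Ky) (no ¬w) _        = Q-rank1 x y w Kx Ky ¬w
    split (no ¬y) (yes Kw) _        = trans (Q-swap₂₃ x y w) (Q-rank1 x w y Kx Kw ¬y)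
    split (no _) (no ¬w) (yes Kyw)  = trans (sym (∂-absorb (B x) y w)) (Q-rank1 x (y ⊕ w) w Kx Kyw ¬w)
    split (no ¬y) (no ¬w) (no ¬yw)  = Q-rank2 x y w Kx ¬y ¬w ¬yw

  Q-absorb : ∀ x y w → Q (x ⊕ y) y w ≡ Q x y w
  Q-absorb x y w = begin
    Q (x ⊕ y) y w   ≡⟨ Q-rotate (x ⊕ y) y w ⟩
    Q w (x ⊕ y) y   ≡⟨ ∂-absorb (B w) x y ⟩
    Q w x y         ≡⟨ Q-rotate x y w ⟨
    Q x y w         ∎
    where open ≡-Reasoning

  -- A dependency of x, y, w modulo K is turned by `Q-absorb` into an argument in K; independent
  -- triples are left to `Q-independent`.
  Q≡false : ∀ x y w → Q x y w ≡ false
  Q≡false x y w = split (K? x) (K? y) (K? w) (K? (x ⊕ y)) (K? (x ⊕ w)) (K? (y ⊕ w)) (K? (x ⊕ y ⊕ w))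
    where
    split : Dec (K x) → Dec (K y) → Dec (K w) → Dec (K (x ⊕ y)) → Dec (K (x ⊕ w)) → Dec (K (y ⊕ w)) →
      Dec (K (x ⊕ y ⊕ w)) → Q x y w ≡ false
    split (yes k) _ _ _ _ _ _ = Q-K x y w k
    split (no _) (yes k) _ _ _ _ _ = trans (Q-swap₁₂ x y w) (Q-K y x w k)
    split (no _) (no _) (yes k) _ _ _ _ = trans (Q-rotate x y w) (Q-K w x y k)
    split (no _) (no _) (no _) (yes k) _ _ _ = trans (sym (Q-absorb x y w)) (Q-K (x ⊕ y) y w k)
    split (no _) (no _) (no _) (no _) (yes k) _ _ =
      trans (Q-swap₂₃ x y w) (trans (sym (Q-absorb x w y)) (Q-K (x ⊕ w) w y k))
    split (no _) (no _) (no _) (no _) (no _) (yes k) _ =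
      trans (Q-swap₁₂ x y w) (trans (Q-swap₂₃ y x w) (trans (sym (Q-absorb y w x)) (Q-K (y ⊕ w) w x k)))
    split (no _) (no _) (no _) (no _) (no _) (no _) (yes k) =
      trans (sym (Q-absorb x y w)) (trans (Q-swap₂₃ (x ⊕ y) y w)
        (trans (sym (Q-absorb (x ⊕ y) w y)) (Q-K (x ⊕ y ⊕ w) w y k)))
    split (no a) (no b) (no c) (no d) (no e) (no g) (no h) = Q-independent x y w a b c d e g h

-- Recognising PG-sums and even-plane matroids

∧-true : ∀ {a b} → a ∧ b ≡ true → a ≡ true × b ≡ true
∧-true {true} {true} _ = refl , refl

∈-allV : ∀ {n} (x : V n) → x ∈ allV n
∈-allV []              = here refl
∈-allV (false ∷ x)     = ∈-++⁺ˡ (∈-map⁺ (false ∷_) (∈-allV x))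
∈-allV {suc n} (true ∷ x) = ∈-++⁺ʳ (List.map (false ∷_) (allV n)) (∈-map⁺ (true ∷_) (∈-allV x))

module _ {n} (f : V n → Bool) (f0 : f 0ᵛ ≡ false) where

  open Transport f

  empty-pgSum : (∀ x → f x ≡ false) → PGSum (mk n f f0)
  empty-pgSum none = (λ _ → false) , (λ _ → false) , (refl , λ _ _ ()) , (refl , λ _ _ ()) , (λ { _ (() , _) }) , none

  -- Under these hypotheses "equal or adjacent" is an equivalence relation on E
  -- with at most two classes; the classes are the two flats.
  adjacency-pgSum :
    (∀ {x y w} → f x ≡ true → f y ≡ true → f w ≡ true → f (x ⊕ y) ≡ true → f (y ⊕ w) ≡ true →
      x ≢ w → f (x ⊕ w) ≡ true) →
    (∀ {x y w} → f x ≡ true → f y ≡ true → f w ≡ true → x ≢ y → x ≢ w → y ≢ w →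
      f (x ⊕ y) ≡ false → f (x ⊕ w) ≡ false → f (y ⊕ w) ≡ false → ⊥) →
    ∀ {x₀} → f x₀ ≡ true → PGSum (mk n f f0)
  adjacency-pgSum adj-trans no-three {x₀} fx₀ =
    F₁ , F₂ , (cong (_∧ near 0ᵛ) f0 , closed₁) , (cong (_∧ not (near 0ᵛ)) f0 , closed₂) , disjoint , cover
    where
    near : V n → Bool
    near v = f (x₀ ⊕ v) ∨ does (v ≟ᵛ x₀)
    F₁ F₂ : V n → Bool
    F₁ v = f v ∧ near v
    F₂ v = f v ∧ not (near v)
    near⇒ : ∀ {v} → near v ≡ true → f (x₀ ⊕ v) ≡ true ⊎ v ≡ x₀
    near⇒ {v} p with f (x₀ ⊕ v)
    ... | true  = inj₁ refl
    ... | false = inj₂ (does-true (v ≟ᵛ x₀) p)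
    ⇒near : ∀ {v} → f (x₀ ⊕ v) ≡ true ⊎ v ≡ x₀ → near v ≡ true
    ⇒near {v} (inj₁ p) = cong (_∨ does (v ≟ᵛ x₀)) p
    ⇒near {v} (inj₂ p) = trans (cong (f (x₀ ⊕ v) ∨_) (dec-true (v ≟ᵛ x₀) p)) (∨-zeroʳ _)
    not-true : ∀ {b} → not b ≡ true → b ≡ false
    not-true {false} _ = refl
    far⇒ : ∀ {v} → near v ≡ false → f (x₀ ⊕ v) ≡ false × v ≢ x₀
    far⇒ p = ¬true⇒false (λ q → clash (⇒near (inj₁ q)) p) , λ q → clash (⇒near (inj₂ q)) p
    extend : ∀ {x y} → f x ≡ true → f y ≡ true → f (x ⊕ y) ≡ true → near x ≡ true → near y ≡ true
    extend {x} {y} fx fy fxy nx = split (near⇒ nx) (y ≟ᵛ x₀)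
      where
      split : f (x₀ ⊕ x) ≡ true ⊎ x ≡ x₀ → Dec (y ≡ x₀) → near y ≡ true
      split _           (yes p) = ⇒near (inj₂ p)
      split (inj₂ refl) (no _)  = ⇒near (inj₁ fxy)
      split (inj₁ p)    (no ¬q) = ⇒near (inj₁ (adj-trans fx₀ fx fy p fxy (λ r → ¬q (sym r))))
    related : ∀ {x y} → f x ≡ true → f y ≡ true → near x ≡ true → near y ≡ true → x ≢ y → f (x ⊕ y) ≡ true
    related {x} {y} fx fy nx ny x≢y with near⇒ nx | near⇒ ny
    ... | inj₂ refl | inj₂ refl = contradiction refl x≢y
    ... | inj₂ refl | inj₁ q    = q
    ... | inj₁ p    | inj₂ refl = p ◂ ⊕-comm y x
    ... | inj₁ p    | inj₁ q    = adj-trans fx fx₀ fy (p ◂ ⊕-comm x₀ x) q x≢y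
    closed₁ : ∀ x y → F₁ x ≡ true → F₁ y ≡ true → x ≢ y → F₁ (x ⊕ y) ≡ true
    closed₁ x y p q x≢y = let (fx , nx) = ∧-true p ; (fy , ny) = ∧-true q ; fxy = related fx fy nx ny x≢y in
      cong₂ _∧_ fxy (extend fx fxy (fy ◂ sym (⊕-cancelˡ x y)) nx)
    closed₂ : ∀ x y → F₂ x ≡ true → F₂ y ≡ true → x ≢ y → F₂ (x ⊕ y) ≡ true
    closed₂ x y p q x≢y =
      let (fx , nx) = ∧-true p ; (fy , ny) = ∧-true q
          (xn , x≢) = far⇒ (not-true nx) ; (yn , y≢) = far⇒ (not-true ny)
          fxy : f (x ⊕ y) ≡ true
          fxy = ¬false⇒true (no-three fx₀ fx fy (λ s → x≢ (sym s)) (λ s → y≢ (sym s)) x≢y xn yn)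
          far : near (x ⊕ y) ≡ false
          far = ¬true⇒false λ r → clash (extend fxy fx (fy ◂ ⊕! (x ∷ y ∷ []) v1 (v0 :+ v1 :+ v0)) r) (not-true nx)
      in cong₂ _∧_ fxy (cong not far)
    disjoint : ∀ v → ¬ (F₁ v ≡ true × F₂ v ≡ true)
    disjoint v (p , q) = clash (proj₂ (∧-true {f v} p)) (not-true (proj₂ (∧-true {f v} q)))
    cover : ∀ v → f v ≡ F₁ v ∨ F₂ v
    cover v with f v | near v
    ... | true  | true  = refl
    ... | true  | false = refl
    ... | false | _     = refl

  parity : ℕ → Bool
  parity zero    = false
  parity (suc k) = not (parity k)

  even-parity : ∀ k → parity k ≡ false → 2 ∣ k
  even-parity zero          _ = 2 ∣0
  even-parity (suc (suc k)) p = ∣m∣n⇒∣m+n (∣-refl {2}) (even-parity k (not-not p))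
    where
    not-not : ∀ {b} → not (not b) ≡ false → b ≡ false
    not-not {false} _ = refl

  filter-parity : ∀ {A : Set} (h : A → Bool) as →
    parity (length (filter (λ a → h a Bool.≟ true) as)) ≡ foldr (λ a b → h a xor b) false as
  filter-parity h []       = refl
  filter-parity h (a ∷ as) with h a
  ... | true  = cong not (filter-parity h as)
  ... | false = filter-parity h as

  -- At a basis of a plane, the third derivative expands into the sum of `f` over all seven points.
  quadratic-evenPlane : (∀ x y w → ∂ (∂ f x) y w ≡ false) → EvenPlane (mk n f f0)
  quadratic-evenPlane quad g lin _ = even-parity _ (trans (filter-parity h (allV 3)) sum≡)
    where
    h : V 3 → Bool
    h c = f (g c)
    e₁ e₂ e₃ : V 3
    e₁ = true ∷ false ∷ false ∷ []
    e₂ = false ∷ true ∷ false ∷ []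
    e₃ = false ∷ false ∷ true ∷ []
    ∂-h : ∀ a b → ∂ h a b ≡ ∂ f (g a) (g b)
    ∂-h a b = cong (λ t → f t xor (h a xor h b)) (lin a b)
    ∂²-h : ∂ (∂ h e₁) e₂ e₃ ≡ false
    ∂²-h = trans (cong₂ _xor_ (trans (∂-h e₁ (e₂ ⊕ e₃)) (cong (∂ f (g e₁)) (lin e₂ e₃)))
                              (cong₂ _xor_ (∂-h e₁ e₂) (∂-h e₁ e₃)))
                 (quad (g e₁) (g e₂) (g e₃))
    h0 : h 0ᵛ ≡ false
    h0 = trans (cong f (trans (lin 0ᵛ 0ᵛ) (⊕-same (g 0ᵛ)))) f0
    sum≡ : foldr (λ c b → h c xor b) false (allV 3) ≡ false
    sum≡ = trans (cong (_xor (h e₃ xor (h e₂ xor (h (e₂ ⊕ e₃) xor (h e₁ xor (h (e₁ ⊕ e₃) xor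
                   (h (e₁ ⊕ e₂) xor (h (e₁ ⊕ e₂ ⊕ e₃) xor false)))))))) h0) (trans
      (xor! (h e₁ ∷ h e₂ ∷ h e₃ ∷ h (e₁ ⊕ e₂) ∷ h (e₁ ⊕ e₃) ∷ h (e₂ ⊕ e₃) ∷ h (e₁ ⊕ e₂ ⊕ e₃) ∷ [])
        (v2 :+ (v1 :+ (v5 :+ (v0 :+ (v4 :+ (v3 :+ (v6 :+ :0)))))))
        ((v6 :+ (v0 :+ v5)) :+ ((v3 :+ (v0 :+ v1)) :+ (v4 :+ (v0 :+ v2)))))
      ∂²-h)

-- Maximal subspaces disjoint from E

record ZeroSpace {n} (f : V n → Bool) : Set₁ where
  field
    member  : V n → Set
    member? : ∀ x → Dec (member x)
    sub     : Subspace member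
    zeros   : ∀ {z} → member z → f z ≡ false
open ZeroSpace

module _ {n} {f : V n → Bool} where

  open Transport f

  adjoin : (Z : ZeroSpace f) (v : V n) → (∀ {z} → member Z z → f (v ⊕ z) ≡ false) →
    Σ (ZeroSpace f) λ Z′ → (∀ {z} → member Z z → member Z′ z) × member Z′ v
  adjoin Z v free = record
    { member  = λ x → member Z x ⊎ member Z (x ⊕ v)
    ; member? = λ x → member? Z x ⊎-dec member? Z (x ⊕ v)
    ; sub     = record { 0∈ = inj₁ 0∈ ; ⊕∈ = add }
    ; zeros   = λ { (inj₁ p) → zeros Z p ; {x} (inj₂ p) → free p ◂ ⊕! (v ∷ x ∷ []) (v0 :+ (v1 :+ v0)) v1 }
    } , inj₁ , inj₂ (subst (member Z) (sym (⊕-same v)) 0∈)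
    where
    open Subspace (sub Z)
    add : ∀ {x y} → member Z x ⊎ member Z (x ⊕ v) → member Z y ⊎ member Z (y ⊕ v) →
      member Z (x ⊕ y) ⊎ member Z (x ⊕ y ⊕ v)
    add (inj₁ p) (inj₁ q) = inj₁ (⊕∈ p q)
    add {x} {y} (inj₁ p) (inj₂ q) = inj₂ (subst (member Z) (sym (⊕-assoc x y v)) (⊕∈ p q))
    add {x} {y} (inj₂ p) (inj₁ q) = inj₂
      (subst (member Z) (⊕! (x ∷ y ∷ v ∷ []) (v0 :+ v2 :+ v1) (v0 :+ v1 :+ v2)) (⊕∈ p q))
    add {x} {y} (inj₂ p) (inj₂ q) = inj₁
      (subst (member Z) (⊕! (x ∷ y ∷ v ∷ []) (v0 :+ v2 :+ (v1 :+ v2)) (v0 :+ v1)) (⊕∈ p q))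

  -- A refused vector v stays refused: the witness z with v ⊕ z in E survives in every larger
  -- subspace, so one pass over the list suffices.
  saturate : (Z : ZeroSpace f) (vs : List (V n)) → Σ (ZeroSpace f) λ Z′ → (∀ {z} → member Z z → member Z′ z) ×
    (∀ {v} → v ∈ vs → ¬ member Z′ v → ∃[ z ] member Z′ z × f (v ⊕ z) ≡ true)
  saturate Z []       = Z , (λ p → p) , λ ()
  saturate Z (v ∷ vs) with any? (λ z → member? Z z ×-dec (f (v ⊕ z) Bool.≟ true))
  ... | yes (z , Zz , p) with saturate Z vs
  ... | Z′ , incl , max = Z′ , incl , λ { (here refl) _ → z , incl Zz , p ; (there q) → max q }
  saturate Z (v ∷ vs) | no none
    with adjoin Z v (λ {z} p → ¬true⇒false λ q → none (z , p , q))
  ... | Z₁ , incl₁ , v∈ with saturate Z₁ vs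
  ... | Z′ , incl , max = Z′ , (λ p → incl (incl₁ p)) ,
    λ { (here refl) ¬p → contradiction (incl v∈) ¬p ; (there q) → max q }

  zeroSpace : f 0ᵛ ≡ false → ZeroSpace f
  zeroSpace f0 = record
    { member  = _≡ 0ᵛ
    ; member? = _≟ᵛ 0ᵛ
    ; sub     = record { 0∈ = refl ; ⊕∈ = λ { refl refl → ⊕-same _ } }
    ; zeros   = λ { refl → f0 } }

  maximal : f 0ᵛ ≡ false → ∀ a b → f a ≡ false → f b ≡ false → f (a ⊕ b) ≡ false →
    Σ (ZeroSpace f) λ Z → member Z a × member Z b ×
      (∀ {v} → ¬ member Z v → ∃[ z ] member Z z × f (v ⊕ z) ≡ true)
  maximal f0 a b fa fb fab =
    let (Z₁ , incl₁ , a∈) = adjoin (zeroSpace f0) a λ { refl → fa ◂ sym (⊕-identityʳ a) }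
        (Z₂ , incl₂ , b∈) = adjoin Z₁ b λ { (inj₁ refl) → fb ◂ sym (⊕-identityʳ b)
                                         ; {z} (inj₂ p) → fab ◂ trans (⊕-comm a b) (cong (b ⊕_) (sym (≡-from-⊕ z a p))) }
        (Z₃ , incl₃ , max) = saturate Z₂ (allV n)
    in Z₃ , incl₃ (incl₂ a∈) , incl₃ b∈ , max (∈-allV _)

-- Lift-joins from decomposers

IsDecomposer : (V n → Bool) → (V n → Bool) → Set
IsDecomposer f Y = IsSubspace Y × Invariant f Y × (∃[ w ] Y w ≡ true × w ≢ 0ᵛ) × (∃[ x ] Y x ≡ false)

isDecomposer? : (f Y : V n → Bool) → Dec (IsDecomposer f Y)
isDecomposer? f Y =
  map′ (λ { (p , q) → record { has-0 = p ; closed = q } }) (λ s → IsSubspace.has-0 s , IsSubspace.closed s)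
       ((Y 0ᵛ Bool.≟ true) ×-dec all? λ x → all? λ y →
        (Y x Bool.≟ true) →-dec ((Y y Bool.≟ true) →-dec (Y (x ⊕ y) Bool.≟ true)))
  ×-dec (all? λ x → all? λ v → (Y x Bool.≟ false) →-dec ((Y v Bool.≟ true) →-dec (f (x ⊕ v) Bool.≟ f x)))
  ×-dec any? (λ w → (Y w Bool.≟ true) ×-dec ¬? (w ≟ᵛ 0ᵛ))
  ×-dec any? (λ x → Y x Bool.≟ false)

isDecomposer-≗ : (f : V n → Bool) {Y Y′ : V n → Bool} → (∀ x → Y x ≡ Y′ x) → IsDecomposer f Y → IsDecomposer f Y′
isDecomposer-≗ f eq (sub , inv , (w , Yw , w≢0) , (x , Yx)) =
  record { has-0  = to (IsSubspace.has-0 sub)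
         ; closed = λ x y p q → to (IsSubspace.closed sub x y (from p) (from q)) } ,
  (λ x v p q → inv x v (from p) (from q)) , (w , to Yw , w≢0) , (x , to Yx)
  where
  to : ∀ {v b} → _ ≡ b → _ ≡ b
  to {v} p = trans (sym (eq v)) p
  from : ∀ {v b} → _ ≡ b → _ ≡ b
  from {v} p = trans (eq v) p

prime-or-decomposer : (f : V n → Bool) → Prime f ⊎ ∃ (IsDecomposer f)
prime-or-decomposer f with anySet? (isDecomposer-≗ f) (isDecomposer? f)
... | yes d   = inj₂ d
... | no none = inj₁ λ Y sub inv w Yw w≢0 x →
  ¬false⇒true λ Yx → none (Y , sub , inv , (w , Yw , w≢0) , (x , Yx))

module LiftJoin {n} (f : V n → Bool) (f0 : f 0ᵛ ≡ false) (Y : V n → Bool)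
  (sub : IsSubspace Y) (inv : Invariant f Y) where

  open Splitting (splitting Y sub) public
  open ≡-Reasoning

  ι-0 : ι 0ᵛ 0ᵛ ≡ 0ᵛ
  ι-0 = begin
    ι 0ᵛ 0ᵛ                   ≡⟨ cong₂ ι (⊕-same 0ᵛ) (⊕-same 0ᵛ) ⟨
    ι (0ᵛ ⊕ 0ᵛ) (0ᵛ ⊕ 0ᵛ)     ≡⟨ ι-linear 0ᵛ 0ᵛ 0ᵛ 0ᵛ ⟩
    ι 0ᵛ 0ᵛ ⊕ ι 0ᵛ 0ᵛ         ≡⟨ ⊕-same _ ⟩
    0ᵛ                        ∎

  ι₁ : V n₁ → V n
  ι₁ u = ι u 0ᵛ

  ι₂ : V n₂ → V n
  ι₂ v = ι 0ᵛ v

  ι₁-linear : Linear ι₁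
  ι₁-linear u u′ = trans (cong (ι (u ⊕ u′)) (sym (⊕-same 0ᵛ))) (ι-linear u 0ᵛ u′ 0ᵛ)

  ι₂-linear : Linear ι₂
  ι₂-linear v v′ = trans (cong (λ t → ι t (v ⊕ v′)) (sym (⊕-same 0ᵛ))) (ι-linear 0ᵛ v 0ᵛ v′)

  M₁ M₂ : Matroid
  M₁ = mk n₁ (λ u → f (ι₁ u)) (trans (cong f ι-0) f0)
  M₂ = mk n₂ (λ v → f (ι₂ v)) (trans (cong f ι-0) f0)

  value : ∀ u v → f (ι u v) ≡ (f (ι₁ u) ∧ isZero v) ∨ f (ι₂ v)
  value u v with isZero v in z
  ... | true rewrite isZero-true v z = sym (begin
    f (ι₁ u) ∧ true ∨ f (ι 0ᵛ 0ᵛ)    ≡⟨ cong (f (ι₁ u) ∧ true ∨_) (trans (cong f ι-0) f0) ⟩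
    f (ι₁ u) ∧ true ∨ false          ≡⟨ ∨-identityʳ _ ⟩
    f (ι₁ u) ∧ true                  ≡⟨ ∧-identityʳ _ ⟩
    f (ι₁ u)                         ∎)
  ... | false = begin
    f (ι u v)                        ≡⟨ cong f (cong₂ ι (⊕-identityˡ u) (⊕-identityʳ v)) ⟨
    f (ι (0ᵛ ⊕ u) (v ⊕ 0ᵛ))          ≡⟨ cong f (ι-linear 0ᵛ v u 0ᵛ) ⟩
    f (ι₂ v ⊕ ι₁ u)                  ≡⟨ inv (ι₂ v) (ι₁ u) (trans (Y-ι 0ᵛ v) z) (trans (Y-ι u 0ᵛ) (isZero-0ᵛ n₂)) ⟩
    f (ι₂ v)                         ≡⟨ cong (_∨ f (ι₂ v)) (∧-zeroʳ (f (ι₁ u))) ⟨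
    f (ι₁ u) ∧ false ∨ f (ι₂ v)      ∎

  join≅ : (M₁ ⊗ M₂) ≅ mk n f f0
  join≅ = (λ x → ι (take n₁ x) (drop n₁ x)) , (λ y → π₁ y ++ π₂ y) ,
    (λ x y → trans (cong₂ ι (take-zipWith _xor_ x y) (drop-zipWith _xor_ x y)) (ι-linear _ _ _ _)) ,
    (λ x → trans (cong₂ _++_ (π₁-ι _ _) (π₂-ι _ _)) (take++drop≡id n₁ x)) ,
    (λ y → trans (cong₂ ι (take-++ (π₁ y) (π₂ y)) (drop-++ (π₁ y) (π₂ y))) (ι-π y)) ,
    (λ x → value (take n₁ x) (drop n₁ x))
    where
    take-++ : ∀ {a b} (x : V a) (y : V b) → take a (x ++ y) ≡ x
    take-++ {a} x y = ++-injectiveˡ _ x (take++drop≡id a (x ++ y))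
    drop-++ : ∀ {a b} (x : V a) (y : V b) → drop a (x ++ y) ≡ y
    drop-++ {a} x y = ++-injectiveʳ _ x (take++drop≡id a (x ++ y))

  n₁<n : ∀ {x} → Y x ≡ false → n₁ < n
  n₁<n {x} Yx = subst (n₁ <_) dims (m<m+n n₁ (positive (π₂ x) (begin
    isZero (π₂ x)          ≡⟨ Y-ι (π₁ x) (π₂ x) ⟨
    Y (ι (π₁ x) (π₂ x))    ≡⟨ cong Y (ι-π x) ⟩
    Y x                    ≡⟨ Yx ⟩
    false                  ∎)))
    where
    positive : ∀ {m} (v : V m) → isZero v ≡ false → 0 < m
    positive (_ ∷ _) _ = s≤s z≤n

  n₂<n : ∀ {w} → Y w ≡ true → w ≢ 0ᵛ → n₂ < n
  n₂<n {w} Yw w≢0 = subst (n₂ <_) dims (m<n+m n₂ (positive (π₁ w) λ π₁w≡0 → w≢0 (begin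
    w                     ≡⟨ ι-π w ⟨
    ι (π₁ w) (π₂ w)       ≡⟨ cong₂ ι π₁w≡0 (isZero-true (π₂ w) (begin
                              isZero (π₂ w)         ≡⟨ Y-ι (π₁ w) (π₂ w) ⟨
                              Y (ι (π₁ w) (π₂ w))   ≡⟨ cong Y (ι-π w) ⟩
                              Y w                   ≡⟨ Yw ⟩
                              true                  ∎)) ⟩
    ι 0ᵛ 0ᵛ               ≡⟨ ι-0 ⟩
    0ᵛ                    ∎)))
    where
    positive : ∀ {m} (v : V m) → v ≢ 0ᵛ → 0 < m
    positive []      p = contradiction refl p
    positive (_ ∷ _) _ = s≤s z≤n

-- Assembly of the classification

triangleFree-complement : (f : V n → Bool) (f0 : f 0ᵛ ≡ false) →
  TriangleFree (mk n f f0 ᶜ) → Generated (mk n f f0)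
triangleFree-complement {n} f f0 tf =
  -- The double complement agrees with `f` only pointwise, so `co-tf` has to be followed by the
  -- identity isomorphism.
  iso ((λ x → x) , (λ x → x) , (λ _ _ → refl) , (λ _ → refl) , (λ _ → refl) , twice) (co-tf {M = mk n f f0 ᶜ} tf)
  where
  twice : ∀ x → f x ≡ E ((mk n f f0 ᶜ) ᶜ) x
  twice x with isZero x in z
  ... | true  = trans (cong f (isZero-true x z)) f0
  ... | false = sym (not-involutive (f x))

complement-true : ∀ (f : V n → Bool) f0 x → E (mk n f f0 ᶜ) x ≡ true → f x ≡ false
complement-true f f0 x p with isZero x | f x
... | false | false = refl

prime-generated : (f : V n → Bool) (f0 : f 0ᵛ ≡ false) → NoClaw f → Prime f → Generated (mk n f f0)
prime-generated f f0 noClaw prime with any? (λ x → f x Bool.≟ true)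
... | no none = pg-sum (empty-pgSum f f0 λ x → ¬true⇒false λ p → none (x , p))
... | yes (x₀ , fx₀) with any? (λ a → any? λ b → ¬? (a ≟ᵛ 0ᵛ) ×-dec ¬? (b ≟ᵛ 0ᵛ) ×-dec ¬? (a ≟ᵛ b) ×-dec
                            (f a Bool.≟ false) ×-dec (f b Bool.≟ false) ×-dec (f (a ⊕ b) Bool.≟ false))
... | no none = triangleFree-complement f f0 λ a b a≢0 b≢0 a≢b (p , q , r) →
  none (a , b , isZero-false a a≢0 , isZero-false b b≢0 , a≢b ,
        complement-true f f0 a p , complement-true f f0 b q , complement-true f f0 (a ⊕ b) r)
... | yes (a , b , a≢0 , b≢0 , a≢b , fa , fb , fab) with maximal f0 a b fa fb fab
... | Z , Za , Zb , Z-max = classify (Cosets.large-or-small C)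
  where
  C : Configuration _
  C = record
    { f = f ; noClaw = noClaw ; prime = prime
    ; Z = member Z ; Z? = member? Z ; Z-sub = sub Z ; Z-false = zeros Z ; Z-max = Z-max
    ; a₀ = a ; b₀ = b ; Za₀ = Za ; Zb₀ = Zb ; a₀≢0 = a≢0 ; b₀≢0 = b≢0 ; a₀≢b₀ = a≢b
    ; x₀ = x₀ ; fx₀ = fx₀ }
  classify : _ → Generated (mk _ f f0)
  classify (inj₁ large) = even-plane (quadratic-evenPlane f f0 (LargeCase.Q≡false C large))
  classify (inj₂ small) = pg-sum (adjacency-pgSum f f0
    (SmallCase.adjacent-trans C small) (SmallCase.no-three-nonadjacent C small) fx₀)

-- Induction on the bound k: a decomposer is proper and nonzero, so both factors have smaller
-- dimension.
noClaw⇒generated : ∀ k M → dim M < k → NoClaw (E M) → Generated M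
noClaw⇒generated (suc k) (mk n f f0) (s≤s n≤k) noClaw with prime-or-decomposer f
... | inj₁ prime = prime-generated f f0 noClaw prime
... | inj₂ (Y , Y-sub , inv , (w , Yw , w≢0) , (x , Yx)) =
  iso join≅ (lift-join
    (noClaw⇒generated k M₁ (≤-trans (n₁<n Yx) n≤k) (noClaw-pullback ι₁ ι₁-linear (λ _ → refl) noClaw))
    (noClaw⇒generated k M₂ (≤-trans (n₂<n Yw w≢0) n≤k) (noClaw-pullback ι₂ ι₂-linear (λ _ → refl) noClaw)))
  where open LiftJoin f f0 Y Y-sub inv

theorem1p1 : (M : Matroid) → ClawFree M ⇔ Generated M
theorem1p1 M = mk⇔
  (λ clawFree → noClaw⇒generated (suc (dim M)) M ≤-refl (clawFree⇒noClaw M clawFree))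
  (λ generated → noClaw⇒clawFree M (generated⇒noClaw generated))
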